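{- Assume SETH. Let $\epsilon>0$ be a constant. Then every fully dynamic $(3/2-\epsilon)$-approximation algorithm for Diameter with polynomial preprocessing time requires $n^{2-o(1)}$ amortized update time or $n^{2-o(1)}$ amortized query time in the word-RAM model of computation with $O(\log n)$-bit words (that is, for no constant $\epsilon'>0$ can both the amortized update time and the amortized query time be $O(n^{2-\epsilon'})$), where $n$ is the number of vertices. This holds even for dynamic undirected unweighted graphs that are sparse (have $\tilde{O}(n)$ edges) at all times.
   Context: $\tilde{O}$ suppresses polylogarithmic factors. For a graph $G=(V,E)$, $d(u,v)$ is the length of a shortest path from $u$ to $v$, and the diameter is $\max_{u,v\in V} d(u,v)$. A fully dynamic algorithm preprocesses an initial graph and then supports edge insertions and edge deletions (updates) as well as queries asking for (an estimate of) the parameter of the current graph. An $\alpha$-approximation algorithm answers each query about a parameter with current value $P$ by a value $\hat P$ with $P\le \hat P\le \alpha P$ (equivalently, after rescaling, $P/\alpha\le\hat P\le P$). SETH (Strong Exponential Time Hypothesis): for every $\epsilon>0$ there is a $K$ such that $K$-SAT on $N$ variables cannot be solved in $2^{(1-\epsilon)N}\mathrm{poly}(N)$ time on a word-RAM with $O(\log N)$-bit words, even by randomized algorithms. -}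

module Defs where

open import Data.Bool using (Bool; true; false; _∧_; _∨_; _xor_; if_then_else_)
open import Data.Bool.Properties using (∧-comm; ∨-comm)
open import Data.Empty using (⊥-elim)
open import Data.Fin using (Fin; toℕ; fromℕ<; remQuot)
import Data.Fin as Fin
open import Data.List using (List; []; _∷_; length; filterᵇ; cartesianProduct; allFin; concatMap; map)
open import Data.List.Relation.Unary.All using (All)
open import Data.List.Relation.Unary.Unique.Propositional using (Unique)
open import Data.Nat using (ℕ; zero; suc; _+_; _*_; _∸_; _^_; _⊔_; _≤_; _<ᵇ_; _≡ᵇ_; _<?_; _/_; _%_; ⌊_/2⌋; NonZero)
open import Data.Nat.Logarithm using (⌊log₂_⌋)
open import Data.Nat.Properties using (m^n≢0)
import Data.Integer as ℤ
open import Data.Product using (Σ; ∃; ∃-syntax; _×_; _,_; proj₁; proj₂)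
open import Data.Rational as ℚ using (ℚ; 0ℚ; ↥_; ↧ₙ_)
open import Data.Unit using (⊤)
open import Data.Vec using (Vec; toList)
import Data.Vec.Relation.Unary.Any as Vec
open import Function using (_⇔_)
open import Relation.Binary.PropositionalEquality using (_≡_; _≢_; refl; sym; trans; cong; cong₂)
open import Relation.Nullary using (¬_; does; yes; no)

------------------------------------------------------------------------
-- Growth rates

-- t ≤ C · x ^ (m − ε), raised to the power of the denominator of ε and
-- cleared of the negative exponent (ε ≥ 0 and x ≥ 1 wherever this is used).

BoundedBy : (t C x m : ℕ) → ℚ → Set
BoundedBy t C x m ε = t ^ q * x ^ p ≤ C ^ q * x ^ (m * q)
  where
  p = ℤ.∣ ↥ ε ∣
  q = ↧ₙ ε

-- T(n) = O(n ^ (m − ε))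

IsO-power-minus : (ℕ → ℕ) → ℕ → ℚ → Set
IsO-power-minus T m ε = ∃[ C ] (∀ n → .{{NonZero n}} → BoundedBy (T n) C n m ε)

IsPolynomial : (ℕ → ℕ) → Set
IsPolynomial T = ∃[ C ] ∃[ k ] (∀ n → .{{NonZero n}} → T n ≤ C * n ^ k)

-- The number of binary digits of n, used for "log n" inside O(·) so that
-- it is never 0.

bitLength : ℕ → ℕ
bitLength n = suc ⌊log₂ n ⌋

-- The word lengths c · log n (c ranges over positive constants suc c).

wordLength : (c n : ℕ) → ℕ
wordLength c n = suc c * bitLength n

------------------------------------------------------------------------
-- Word-RAM
--
-- Programs are structured (while) programs over finitely many registers
-- and a random-access memory.  Numbers of at most w bits occupy one word,
-- and an instruction touching only such numbers costs 1; this is the usual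
-- word-RAM.  A number of more than w bits occupies several consecutive
-- words and an instruction touching numbers of up to k words is charged k²,
-- the cost of schoolbook arithmetic on w-bit words.  This includes
-- addresses: memory beyond 2 ^ w cells is reached by addresses of several
-- words, and paid for accordingly.

data Op : Set where
  add sub mul div mod and or xor shl shr lt eq : Op

data Cmd : Set where
  skip  : Cmd
  const : (r k : ℕ) → Cmd               -- r := k
  arith : Op → (r a b : ℕ) → Cmd        -- r := a op b
  load  : (r a : ℕ) → Cmd               -- r := M[a]
  store : (a r : ℕ) → Cmd               -- M[a] := r
  flip  : (r : ℕ) → Cmd                 -- r := a fresh uniformly random bit
  _⨾_   : Cmd → Cmd → Cmd
  ifnz  : (r : ℕ) → Cmd → Cmd → Cmd
  while : (r : ℕ) → Cmd → Cmd           -- while r ≠ 0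

infixr 5 _⨾_

bit : Bool → ℕ
bit b = if b then 1 else 0

-- The first argument bounds the number of digits to be treated.

bitwise : ℕ → (Bool → Bool → Bool) → ℕ → ℕ → ℕ
bitwise zero    f x y = 0
bitwise (suc d) f x y =
  bit (f (x % 2 ≡ᵇ 1) (y % 2 ≡ᵇ 1)) + 2 * bitwise d f ⌊ x /2⌋ ⌊ y /2⌋

⟦_⟧ : Op → ℕ → ℕ → ℕ
⟦ add ⟧ x y       = x + y
⟦ sub ⟧ x y       = x ∸ y
⟦ mul ⟧ x y       = x * y
⟦ div ⟧ x zero    = 0
⟦ div ⟧ x (suc y) = x / suc y
⟦ mod ⟧ x zero    = x
⟦ mod ⟧ x (suc y) = x % suc y
⟦ and ⟧ x y       = bitwise (bitLength (x ⊔ y)) _∧_ x y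
⟦ or ⟧  x y       = bitwise (bitLength (x ⊔ y)) _∨_ x y
⟦ xor ⟧ x y       = bitwise (bitLength (x ⊔ y)) _xor_ x y
⟦ shl ⟧ x y       = x * 2 ^ y
⟦ shr ⟧ x y       = _/_ x (2 ^ y) {{m^n≢0 2 y}}
⟦ lt ⟧  x y       = bit (x <ᵇ y)
⟦ eq ⟧  x y       = bit (x ≡ᵇ y)

-- The random bits are a finite tape, consumed from the front; `flip` gets
-- stuck on the empty tape.

record State : Set where
  constructor ⟪_,_,_⟫
  field
    reg  : ℕ → ℕ
    mem  : ℕ → ℕ
    tape : List Bool

open State public

_[_↦_] : (ℕ → ℕ) → ℕ → ℕ → (ℕ → ℕ)
(f [ i ↦ v ]) j = if j ≡ᵇ i then v else f j

setReg : State → ℕ → ℕ → State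
setReg s r v = record s { reg = reg s [ r ↦ v ] }

setMem : State → ℕ → ℕ → State
setMem s a v = record s { mem = mem s [ a ↦ v ] }

module Machine (w : ℕ) .{{_ : NonZero w}} where

  words : ℕ → ℕ
  words v = suc (⌊log₂ v ⌋ / w)

  cost : ℕ → ℕ
  cost v = words v ^ 2

  -- ⟨ c , s ⟩⇓⟨ s′ , t ⟩ : started in s, the program c halts in s′ after
  -- time t.  The cost of an instruction is that of the largest number it
  -- touches, since `cost` is monotone.

  data ⟨_,_⟩⇓⟨_,_⟩ : Cmd → State → State → ℕ → Set where

    ⇓skip  : ∀ {s} → ⟨ skip , s ⟩⇓⟨ s , 1 ⟩

    ⇓const : ∀ {s r k} → ⟨ const r k , s ⟩⇓⟨ setReg s r k , cost k ⟩

    ⇓arith : ∀ {s o r a b} →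
             let x = reg s a ; y = reg s b ; z = ⟦ o ⟧ x y in
             ⟨ arith o r a b , s ⟩⇓⟨ setReg s r z , cost (x ⊔ y ⊔ z) ⟩

    ⇓load  : ∀ {s r a} →
             let x = reg s a ; v = mem s x in
             ⟨ load r a , s ⟩⇓⟨ setReg s r v , cost (x ⊔ v) ⟩

    ⇓store : ∀ {s a r} →
             let x = reg s a ; v = reg s r in
             ⟨ store a r , s ⟩⇓⟨ setMem s x v , cost (x ⊔ v) ⟩

    ⇓flip  : ∀ {f m b bs r} →
             ⟨ flip r , ⟪ f , m , b ∷ bs ⟫ ⟩⇓⟨ ⟪ f [ r ↦ bit b ] , m , bs ⟫ , 1 ⟩

    ⇓seq   : ∀ {c d s s′ s″ t u} →
             ⟨ c , s ⟩⇓⟨ s′ , t ⟩ → ⟨ d , s′ ⟩⇓⟨ s″ , u ⟩ →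
             ⟨ c ⨾ d , s ⟩⇓⟨ s″ , t + u ⟩

    ⇓then  : ∀ {r c d s s′ t} → reg s r ≢ 0 →
             ⟨ c , s ⟩⇓⟨ s′ , t ⟩ →
             ⟨ ifnz r c d , s ⟩⇓⟨ s′ , cost (reg s r) + t ⟩

    ⇓else  : ∀ {r c d s s′ t} → reg s r ≡ 0 →
             ⟨ d , s ⟩⇓⟨ s′ , t ⟩ →
             ⟨ ifnz r c d , s ⟩⇓⟨ s′ , cost (reg s r) + t ⟩

    ⇓loop  : ∀ {r c s s′ s″ t u} → reg s r ≢ 0 →
             ⟨ c , s ⟩⇓⟨ s′ , t ⟩ → ⟨ while r c , s′ ⟩⇓⟨ s″ , u ⟩ →
             ⟨ while r c , s ⟩⇓⟨ s″ , cost (reg s r) + (t + u) ⟩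

    ⇓exit  : ∀ {r c s} → reg s r ≡ 0 →
             ⟨ while r c , s ⟩⇓⟨ s , cost (reg s r) ⟩

-- The cells listed, followed by zeros.

contents : List ℕ → ℕ → ℕ
contents []       i       = 0
contents (v ∷ vs) zero    = v
contents (v ∷ vs) (suc i) = contents vs i

-- For a uniformly random tape of L bits, P holds with probability at least
-- 2/3: at least that fraction of the 2 ^ L tapes can be listed, without
-- repetition, all satisfying P.

ProbAtLeast⅔ : ∀ {L} → (Vec Bool L → Set) → Set
ProbAtLeast⅔ {L} P =
  ∃[ vs ] (Unique vs × All P vs × 2 * 2 ^ L ≤ 3 * length vs)

------------------------------------------------------------------------
-- K-SAT and SETH

Literal : ℕ → Set
Literal N = Fin N × Bool

-- Literals may be repeated in a clause, which gives the clauses of fewer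
-- than K literals as well.

Clause : (K N : ℕ) → Set
Clause K N = Vec (Literal N) K

Satisfies : ∀ {K N} → (Fin N → Bool) → Clause K N → Set
Satisfies σ C = Vec.Any (λ l → σ (proj₁ l) ≡ proj₂ l) C

Satisfiable : ∀ {K N} → List (Clause K N) → Set
Satisfiable {N = N} φ = ∃[ σ ] All (Satisfies {N = N} σ) φ

literalCode : ∀ {N} → Literal N → ℕ
literalCode (x , b) = 2 * toℕ x + bit b

-- Register 0 holds N, register 1 the number of clauses, and the memory
-- the literals, K consecutive cells for each clause.

satInput : ∀ {K N} → List (Clause K N) → List Bool → State
satInput {N = N} φ bs =
  ⟪ contents (N ∷ length φ ∷ [])
  , contents (concatMap (λ C → map literalCode (toList C)) φ)
  , bs ⟫

-- A randomised program deciding K-SAT on N variables with error at most 1/3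
-- in time 2 ^ ((1 − ε) N) · poly(N), with words of O(log N) bits.  The
-- clauses of a formula are pairwise distinct, so the input has length
-- poly(N); with unrestricted repetitions no bound in terms of N alone
-- could hold.  L may exceed the number of bits a run consumes.

SolvableKSAT : ℕ → ℚ → Set
SolvableKSAT K ε =
  Σ Cmd λ program → ∃[ c ] ∃[ C ]
  (∀ N → .{{_ : NonZero N}} → (φ : List (Clause K N)) → Unique φ →
   let open Machine (wordLength c N) in
   ∃[ L ] Σ (Vec Bool L → State) λ final → Σ (Vec Bool L → ℕ) λ time →
     (∀ v → ⟨ program , satInput φ (toList v) ⟩⇓⟨ final v , time v ⟩)
   × (∀ v → BoundedBy (time v) (C * N ^ C) (2 ^ N) 1 ε)
   × ProbAtLeast⅔ (λ v → reg (final v) 0 ≡ 1 ⇔ Satisfiable φ))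

SETH : Set
SETH = ∀ ε → 0ℚ ℚ.< ε → ∃[ K ] ¬ SolvableKSAT K ε

------------------------------------------------------------------------
-- Undirected unweighted graphs and their diameter

record Graph (n : ℕ) : Set where
  field
    adj     : Fin n → Fin n → Bool
    adj-sym : ∀ u v → adj u v ≡ adj v u
    noLoop  : ∀ u → adj u u ≡ false

open Graph public

edgeCount : ∀ {n} → Graph n → ℕ
edgeCount {n} G =
  length (filterᵇ (λ (u , v) → (toℕ u <ᵇ toℕ v) ∧ adj G u v)
                  (cartesianProduct (allFin n) (allFin n)))

data Walk {n} (G : Graph n) : Fin n → Fin n → ℕ → Set where
  stop : ∀ {u} → Walk G u u 0
  step : ∀ {u v x k} → adj G u x ≡ true → Walk G x v k → Walk G u v (suc k)

-- A shortest walk is a path.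

IsDistance : ∀ {n} → Graph n → Fin n → Fin n → ℕ → Set
IsDistance G u v k = Walk G u v k × (∀ j → Walk G u v j → k ≤ j)

-- A disconnected graph has no diameter in ℕ.

IsDiameter : ∀ {n} → Graph n → ℕ → Set
IsDiameter G D =
    (∀ u v → ∃[ k ] (IsDistance G u v k × k ≤ D))
  × (∃[ u ] ∃[ v ] IsDistance G u v D)

fromℕ : ℕ → ℚ
fromℕ m = (ℤ.+ m) ℚ./ 1

Approximates : ℚ → ℕ → ℕ → Set
Approximates α P P̂ = P ≤ P̂ × fromℕ P̂ ℚ.≤ α ℚ.* fromℕ P

GraphClass : Set₁
GraphClass = ∀ {n} → Graph n → Set

AllGraphs : GraphClass
AllGraphs G = ⊤

-- c serves both as constant factor and as exponent of the logarithm.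

Sparse : ℕ → GraphClass
Sparse c {n} G = edgeCount G ≤ c * (n * bitLength n ^ c)

isPair : ∀ {n} → (u v x y : Fin n) → Bool
isPair u v x y =
  (does (x Fin.≟ u) ∧ does (y Fin.≟ v)) ∨ (does (x Fin.≟ v) ∧ does (y Fin.≟ u))

isPair-sym : ∀ {n} (u v x y : Fin n) → isPair u v x y ≡ isPair u v y x
isPair-sym u v x y = trans
  (∨-comm (does (x Fin.≟ u) ∧ does (y Fin.≟ v)) _)
  (cong₂ _∨_ (∧-comm (does (x Fin.≟ v)) _) (∧-comm (does (x Fin.≟ u)) _))

isPair-noLoop : ∀ {n} {u v : Fin n} → u ≢ v → ∀ x → isPair u v x x ≡ false
isPair-noLoop {u = u} {v} u≢v x with x Fin.≟ u | x Fin.≟ v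
... | yes p | yes q = ⊥-elim (u≢v (trans (sym p) q))
... | yes _ | no _  = refl
... | no _  | yes _ = refl
... | no _  | no _  = refl

setEdge : ∀ {n} → Bool → Graph n → (u v : Fin n) → u ≢ v → Graph n
setEdge b G u v u≢v = record
  { adj     = λ x y → if isPair u v x y then b else adj G x y
  ; adj-sym = λ x y → cong₂ (λ p e → if p then b else e)
                            (isPair-sym u v x y) (adj-sym G x y)
  ; noLoop  = λ x → trans
      (cong (λ p → if p then b else adj G x x) (isPair-noLoop u≢v x))
      (noLoop G x)
  }

------------------------------------------------------------------------
-- Fully dynamic algorithms

data Operation (n : ℕ) : Set where
  insert delete : (u v : Fin n) → u ≢ v → Operation n
  query         : Operation n

updates queries : ∀ {n} → List (Operation n) → ℕ
updates []                   = 0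
updates (insert _ _ _ ∷ ops) = suc (updates ops)
updates (delete _ _ _ ∷ ops) = suc (updates ops)
updates (query ∷ ops)        = updates ops

queries []                   = 0
queries (insert _ _ _ ∷ ops) = queries ops
queries (delete _ _ _ ∷ ops) = queries ops
queries (query ∷ ops)        = suc (queries ops)

-- Only absent edges are inserted, only present ones deleted, and the graph
-- is in the class at all times.

data Admissible (𝒞 : GraphClass) {n} (G : Graph n) : List (Operation n) → Set where
  done   : 𝒞 G → Admissible 𝒞 G []
  insert : ∀ {u v u≢v ops} → 𝒞 G → adj G u v ≡ false →
           Admissible 𝒞 (setEdge true G u v u≢v) ops →
           Admissible 𝒞 G (insert u v u≢v ∷ ops)
  delete : ∀ {u v u≢v ops} → 𝒞 G → adj G u v ≡ true →
           Admissible 𝒞 (setEdge false G u v u≢v) ops →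
           Admissible 𝒞 G (delete u v u≢v ∷ ops)
  query  : ∀ {ops} → 𝒞 G → Admissible 𝒞 G ops → Admissible 𝒞 G (query ∷ ops)

-- The answers given to the queries, in order, are all α-approximations of
-- the diameter of the graph current at the time of the query.

data AnswersCorrect (α : ℚ) {n} (G : Graph n) : List (Operation n) → List ℕ → Set where
  done   : AnswersCorrect α G [] []
  insert : ∀ {u v u≢v ops as} →
           AnswersCorrect α (setEdge true G u v u≢v) ops as →
           AnswersCorrect α G (insert u v u≢v ∷ ops) as
  delete : ∀ {u v u≢v ops as} →
           AnswersCorrect α (setEdge false G u v u≢v) ops as →
           AnswersCorrect α G (delete u v u≢v ∷ ops) as
  query  : ∀ {ops a as} → (∀ D → IsDiameter G D → Approximates α D a) →
           AnswersCorrect α G ops as →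
           AnswersCorrect α G (query ∷ ops) (a ∷ as)

record DynamicAlgorithm : Set where
  field
    preprocess insertion deletion answer : Cmd
    wordConstant                         : ℕ

open DynamicAlgorithm public

-- Register 0 holds n and the memory the adjacency matrix, row by row.

matrixCell : ∀ {n} → Graph n → ℕ → ℕ
matrixCell {n} G a with a <? n * n
... | yes a<n² = let (u , v) = remQuot n (fromℕ< a<n²) in bit (adj G u v)
... | no  _    = 0

graphInput : ∀ {n} → Graph n → List Bool → State
graphInput {n} G bs = ⟪ contents (n ∷ []) , matrixCell G , bs ⟫

-- The endpoints of the updated edge are passed in registers 0 and 1; all
-- else persists from one operation to the next.

withEdge : ∀ {n} → State → Fin n → Fin n → State
withEdge s u v = setReg (setReg s 0 (toℕ u)) 1 (toℕ v)

-- Session A w s ops as T : from state s, the operations are processed one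
-- after the other in total time T, the queries being answered by `as`
-- (taken from register 0).

module _ (A : DynamicAlgorithm) (w : ℕ) .{{_ : NonZero w}} where

  open Machine w

  data Session {n} (s : State) : List (Operation n) → List ℕ → ℕ → Set where
    done   : Session s [] [] 0
    insert : ∀ {u v u≢v ops as s′ t T} →
             ⟨ insertion A , withEdge s u v ⟩⇓⟨ s′ , t ⟩ →
             Session s′ ops as T →
             Session s (insert u v u≢v ∷ ops) as (t + T)
    delete : ∀ {u v u≢v ops as s′ t T} →
             ⟨ deletion A , withEdge s u v ⟩⇓⟨ s′ , t ⟩ →
             Session s′ ops as T →
             Session s (delete u v u≢v ∷ ops) as (t + T)
    query  : ∀ {ops as s′ t T} →
             ⟨ answer A , s ⟩⇓⟨ s′ , t ⟩ →
             Session s′ ops as T →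
             Session s (query ∷ ops) (reg s′ 0 ∷ as) (t + T)

-- A maintains an α-approximation of the diameter on the graphs of 𝒞, with
-- preprocessing time Tp and amortised update and query times Tu and Tq, in
-- the word-RAM with O(log n)-bit words.  A may be randomised: the time
-- bounds hold for all random bits, and on every sequence of operations
-- fixed in advance all answers are correct with probability at least 2/3.
-- For a deterministic A (one without `flip`) this says that the answers
-- are correct.

ApproximatesDiameter : GraphClass → ℚ → DynamicAlgorithm → (Tp Tu Tq : ℕ → ℕ) → Set
ApproximatesDiameter 𝒞 α A Tp Tu Tq =
  ∀ n → .{{_ : NonZero n}} → (G : Graph n) (ops : List (Operation n)) →
  Admissible 𝒞 G ops →
  let w = wordLength (wordConstant A) n ; open Machine w in
  ∃[ L ] Σ (Vec Bool L → State)  λ start   → Σ (Vec Bool L → ℕ) λ t →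
         Σ (Vec Bool L → List ℕ) λ answers → Σ (Vec Bool L → ℕ) λ T →
    (∀ v → ⟨ preprocess A , graphInput G (toList v) ⟩⇓⟨ start v , t v ⟩)
  × (∀ v → t v ≤ Tp n)
  × (∀ v → Session A w (start v) ops (answers v) (T v))
  × (∀ v → T v ≤ updates ops * Tu n + queries ops * Tq n)
  × ProbAtLeast⅔ (λ v → AnswersCorrect α G ops (answers v))

-- An algorithm as above with polynomial preprocessing time and with
-- amortised update and query times both O(n ^ (2 − ε)).

SubquadraticAlgorithm : GraphClass → (α ε : ℚ) → Set
SubquadraticAlgorithm 𝒞 α ε =
  Σ DynamicAlgorithm λ A → ∃[ Tp ] ∃[ Tu ] ∃[ Tq ]
    ( ApproximatesDiameter 𝒞 α A Tp Tu Tq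
    × IsPolynomial Tp
    × IsO-power-minus Tu 2 ε
    × IsO-power-minus Tq 2 ε )

3/2 : ℚ
3/2 = (ℤ.+ 3) ℚ./ 2

{-# OPTIONS --safe #-}
-- Let N be the number of variables of a K-SAT instance, h = N / d, H = 2 ^ h,
-- and split the variables into two blocks of size h and the rest.  One dynamic
-- graph serves all 2 ^ (N ∸ 2 h) assignments τ of the rest.  Each candidate
-- assignment of one of the two blocks is a star with legs of length ℓ, and a
-- leg for a clause that the candidate does not satisfy ends in a vertex u or w
-- of that clause, for the first and the second block respectively.  The edge
-- between u and w is present iff τ does not satisfy the clause either.  So two
-- candidates are joined by a short path through some clause unless together
-- with τ they satisfy all clauses: the diameter is at most 4 ℓ + 3 if no pair
-- completes τ, and exceeds 6 ℓ otherwise, a ratio that tends to 3 / 2.  A phase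
-- needs one query and two updates per clause on a graph with H · poly (N)
-- vertices.  With operations in time n ^ (2 − ε′) this amounts to
-- 2 ^ (N ∸ 2 h) · H ^ (2 − ε′) · poly (N), which saves a factor H ^ ε′ and
-- contradicts SETH.  As words have about log n, hence O(N), bits, simulating
-- the algorithm costs only a factor poly (N).
module Submission where
open import Defs
open import Data.Bool using (Bool; true; false; _∧_; _∨_; not; if_then_else_)
open import Data.Bool.Properties using (T-≡; ∨-zeroʳ; ∨-identityʳ; ∨-assoc; ¬-not)
open import Data.Empty using (⊥; ⊥-elim)
open import Data.Fin using (Fin; zero; suc; toℕ; fromℕ<; remQuot)
import Data.Fin as Fin
import Data.Bool
import Data.Bool.Properties
import Data.Fin.Properties as Finₚ
open import Data.List using (List; []; _∷_; length; filterᵇ; cartesianProduct; allFin; concatMap; map; _++_; tabulate)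
import Data.List.Properties as Listₚ
open import Data.List.Relation.Unary.All using (All; []; _∷_)
import Data.List.Relation.Unary.All as All
import Data.List.Relation.Unary.All.Properties as Allₚ
open import Data.List.Relation.Unary.Any using (Any; here; there)
import Data.List.Relation.Unary.Any as Any
open import Data.List.Relation.Unary.Unique.Propositional using (Unique; []; _∷_)
import Data.List.Relation.Unary.Unique.Propositional.Properties as Uniqueₚ
open import Data.List.Membership.Propositional using (_∈_)
import Data.List.Membership.Propositional.Properties as Memₚ
open import Data.Nat using (ℕ; s≤s⁻¹; >-nonZero⁻¹; zero; suc; pred; _+_; _*_; _∸_; _^_; _⊔_; _≤_; _<_; z≤n; s≤s; z<s; _<ᵇ_; _≡ᵇ_; _<?_; _≤?_; _≟_; _/_; _%_; NonZero; >-nonZero)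
open import Data.Nat.Logarithm using (⌊log₂_⌋; ⌊log₂⌋-mono-≤; ⌊log₂[2^n]⌋≡n)
open import Data.Nat.Properties
open import Data.Nat.DivMod hiding (result)
open import Data.Nat.Coprimality using (1-coprimeTo)
open import Data.Nat.Tactic.RingSolver using (solve-∀)
import Data.Integer as ℤ
import Data.Integer.Properties as ℤₚ
import Data.Integer.Tactic.RingSolver as ℤ-Solver
import Data.Rational.Unnormalised as ℚᵘ
import Data.Rational.Unnormalised.Properties as ℚᵘₚ
open import Data.Product using (Σ; ∃; ∃-syntax; _×_; _,_; proj₁; proj₂)
open import Data.Rational using (ℚ; 0ℚ; mkℚ; _-_; ↥_; ↧ₙ_)
import Data.Rational as ℚ
import Data.Rational.Properties as ℚₚ
import Data.Sum
open import Data.Sum using (_⊎_; inj₁; inj₂)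
open import Data.Unit using (⊤; tt)
open import Data.Vec using (Vec; []; _∷_; lookup; toList; _[_]≔_)
import Data.Vec as Vec
import Data.Vec.Properties as Vecₚ
import Data.Vec.Relation.Unary.Any as VAny
open import Function using (_∘_; id; _⇔_; mk⇔; Equivalence; case_of_)
open import Relation.Binary.PropositionalEquality using (_≡_; _≢_; ≢-sym; refl; sym; trans; cong; cong₂; subst; subst₂; module ≡-Reasoning)
open import Relation.Nullary using (¬_; Dec; yes; no; contradiction)
open import Relation.Nullary.Decidable using (True; toWitness; _×-dec_; ¬?; map′; from-yes)


-- The ratio 3 / 2 comes from dead ends. The far vertex of a dead leg gets out of its star only
-- through the centre, with 2 ℓ + 1 edges up to a shared vertex. Two of them are joined by one more
-- edge, a gate, if the candidates conflict; otherwise every walk also has to cross a third star,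
-- which costs 2 (ℓ + 1) and gives 6 ℓ + 4. A potential with levels 0 to 6 certifies this without an
-- analysis of walks. The relative block length 1 / d is dictated by the preprocessing: its time n ^
-- k with an arbitrary k must stay below 2 ^ N, so d is taken slightly larger than k. On the
-- machine, the algorithm under simulation owns the memory from address 0 on. Therefore the formula
-- is moved into a single register, as a number of poly (N) bits, before the adjacency matrix is
-- written. The time of the operations is bounded only in total, so all phases form one session, and
-- the time that it has left is passed along as credit.

sumTo : ℕ → (ℕ → ℕ) → ℕ
sumTo zero    f = 0
sumTo (suc n) f = sumTo n f + f n

sumTo-cong : ∀ n {f g : ℕ → ℕ} → (∀ i → i < n → f i ≡ g i) → sumTo n f ≡ sumTo n g
sumTo-cong zero    eqn = refl
sumTo-cong (suc n) eqn =
  cong₂ _+_ (sumTo-cong n λ i i<n → eqn i (m<n⇒m<1+n i<n)) (eqn n ≤-refl)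

sumTo-≤ : ∀ n {f : ℕ → ℕ} {b} → (∀ i → i < n → f i ≤ b) → sumTo n f ≤ n * b
sumTo-≤ zero            le = z≤n
sumTo-≤ (suc n) {f} {b} le = begin
  sumTo n f + f n  ≤⟨ +-mono-≤ (sumTo-≤ n λ i i<n → le i (m<n⇒m<1+n i<n)) (le n ≤-refl) ⟩
  n * b + b        ≡⟨ +-comm (n * b) b ⟩
  b + n * b        ∎
  where open ≤-Reasoning

-- Machine expressions yield only numbers, so predicates are tested for positivity: sums act as
-- disjunctions and existential quantifiers, products as conjunctions. This lemma and the next ones
-- translate between the two readings.
sumTo-pos : ∀ n {f : ℕ → ℕ} → 0 < sumTo n f → ∃[ i ] (i < n × 0 < f i)
sumTo-pos (suc n) {f} pos with f n in eqn
... | suc k = n , ≤-refl , subst (0 <_) (sym eqn) z<s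
... | zero with sumTo-pos n (subst (0 <_) (+-identityʳ _) pos)
...   | i , i<n , p = i , m<n⇒m<1+n i<n , p

pos-sumTo : ∀ n {f : ℕ → ℕ} i → i < n → 0 < f i → 0 < sumTo n f
pos-sumTo (suc n) {f} i i<1+n p with i ≟ n
... | yes refl = ≤-trans p (m≤n+m (f n) (sumTo n f))
... | no i≢n   = ≤-trans (pos-sumTo n i (≤∧≢⇒< (s≤s⁻¹ i<1+n) i≢n) p) (m≤m+n (sumTo n f) (f n))

pos-+ : ∀ m {n} → 0 < m + n → 0 < m ⊎ 0 < n
pos-+ zero    p = inj₂ p
pos-+ (suc m) p = inj₁ z<s

pos-* : ∀ m {n} → 0 < m * n → 0 < m × 0 < n
pos-* (suc m) {zero}  p = contradiction p (subst (λ z → ¬ (0 < z)) (sym (*-zeroʳ m)) λ ())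
pos-* (suc m) {suc n} p = z<s , z<s

*-pos : ∀ {m n} → 0 < m → 0 < n → 0 < m * n
*-pos {suc m} {suc n} _ _ = z<s

pos-bit : ∀ b → 0 < bit b → b ≡ true
pos-bit true _ = refl

bit-pos : ∀ {b} → b ≡ true → 0 < bit b
bit-pos refl = z<s

≡ᵇ-true : ∀ m n → (m ≡ᵇ n) ≡ true → m ≡ n
≡ᵇ-true m n eqn = ≡ᵇ⇒≡ m n (Equivalence.from T-≡ eqn)

true-≡ᵇ : ∀ m n → m ≡ n → (m ≡ᵇ n) ≡ true
true-≡ᵇ m n eqn = Equivalence.to T-≡ (≡⇒≡ᵇ m n eqn)

<ᵇ-true : ∀ m n → (m <ᵇ n) ≡ true → m < n
<ᵇ-true m n eqn = <ᵇ⇒< m n (Equivalence.from T-≡ eqn)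

true-<ᵇ : ∀ {m n} → m < n → (m <ᵇ n) ≡ true
true-<ᵇ lth = Equivalence.to T-≡ (<⇒<ᵇ lth)

false-<ᵇ : ∀ m n → n ≤ m → (m <ᵇ n) ≡ false
false-<ᵇ m n n≤m = ¬-not λ eqn → <⇒≱ (<ᵇ-true m n eqn) n≤m

<ᵇ-false : ∀ m n → (m <ᵇ n) ≡ false → n ≤ m
<ᵇ-false m n eqn with n ≤? m
... | yes p = p
... | no ¬p = contradiction (trans (sym (true-<ᵇ (≰⇒> ¬p))) eqn) λ ()

bit≤1 : ∀ b → bit b ≤ 1
bit≤1 true  = ≤-refl
bit≤1 false = z≤n

[f↦]-hit : ∀ (f : ℕ → ℕ) i v → (f [ i ↦ v ]) i ≡ v
[f↦]-hit f i v with i ≡ᵇ i in eqn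
... | true  = refl
... | false = contradiction (trans (sym (true-≡ᵇ i i refl)) eqn) λ ()

[f↦]-miss : ∀ (f : ℕ → ℕ) i v {j} → j ≢ i → (f [ i ↦ v ]) j ≡ f j
[f↦]-miss f i v {j} j≢i with j ≡ᵇ i in eqn
... | true  = contradiction (≡ᵇ-true j i eqn) j≢i
... | false = refl

1≤2^ : ∀ n → 1 ≤ 2 ^ n
1≤2^ n = >-nonZero⁻¹ (2 ^ n) {{m^n≢0 2 n}}

n<2^n : ∀ n → n < 2 ^ n
n<2^n zero    = z<s
n<2^n (suc n) = begin-strict
  suc n            ≤⟨ n<2^n n ⟩
  2 ^ n            <⟨ m<m+n (2 ^ n) (≤-trans (1≤2^ n) (m≤m+n _ 0)) ⟩
  2 * 2 ^ n        ∎
  where open ≤-Reasoning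

^-distribʳ-* : ∀ k m n → (m * n) ^ k ≡ m ^ k * n ^ k
^-distribʳ-* zero    m n = refl
^-distribʳ-* (suc k) m n = trans (cong (m * n *_) (^-distribʳ-* k m n)) (lem m n (m ^ k) (n ^ k))
  where
  lem : ∀ a b c d → a * b * (c * d) ≡ a * c * (b * d)
  lem = solve-∀

-- Arithmetic expressions: values, sizes, numbers of steps, compilation.

data Ar : Set where
  plus minus times quot rem less equal shiftr : Ar

toOp : Ar → Op
toOp plus   = add
toOp minus  = sub
toOp times  = mul
toOp quot   = div
toOp rem    = mod
toOp less   = lt
toOp equal  = eq
toOp shiftr = shr

-- Pure expressions over n variables; `sum x e` is Σ_{i < x} e with i bound
-- as variable 0 of e.  Loop bounds are variables so that running times can
-- be read off the syntax.

data Exp (n : ℕ) : Set where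
  var  : Fin n → Exp n
  lit  : ℕ → Exp n
  arop : Ar → Exp n → Exp n → Exp n
  pow2 : Fin n → Exp n
  sum  : Fin n → Exp (suc n) → Exp n

infixl 6 _⊞_ _⊟_
infixl 7 _⊠_
infix 5 _≺_
infix 4 _≐_
_⊞_ _⊟_ _⊠_ _≐_ _≺_ : ∀ {n} → Exp n → Exp n → Exp n
_⊞_ = arop plus
_⊟_ = arop minus
_⊠_ = arop times
_≐_ = arop equal
_≺_ = arop less

eval : ∀ {n} → Exp n → Vec ℕ n → ℕ
eval (var i)      ρ = lookup ρ i
eval (lit k)      ρ = k
eval (arop o d e) ρ = ⟦ toOp o ⟧ (eval d ρ) (eval e ρ)
eval (pow2 i)     ρ = 2 ^ lookup ρ i
eval (sum x e)    ρ = sumTo (lookup ρ x) (λ i → eval e (i ∷ ρ))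

-- The length of the value in units of `B` bits, provided that variables and literals take one unit.
-- A `sum` adds one unit for its at most `2 ^ B` terms.
width : ∀ {n} → Exp n → ℕ
width (var i)      = 1
width (lit k)      = 1
width (arop o d e) = width d + width e
width (pow2 i)     = 1
width (sum x e)    = suc (width e)


-- The number of consecutive temporary registers. A `sum` has an accumulator and a counter; the
-- third register, which `⊔ 1` secures, holds constants and then the term.
size : ∀ {n} → Exp n → ℕ
size (var i)      = 2
size (lit k)      = 1
size (arop o d e) = size d ⊔ suc (size e)
size (pow2 i)     = 1
size (sum x e)    = 2 + (size e ⊔ 1)


-- Counts instructions, with `X` above all loop bounds; each of them is later charged the same
-- amount `κ`. A `sum` has three instructions of preparation and a last test, and in every round a
-- test, three instructions and the term.
steps : ∀ {n} → Exp n → ℕ → ℕ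
steps (var i)      X = 2
steps (lit k)      X = 1
steps (arop o d e) X = steps d X + (steps e X + 1)
steps (pow2 i)     X = 2
steps (sum x e)    X = 4 + X * (4 + steps e X)

coeff degree : ∀ {n} → Exp n → ℕ
coeff (var i)      = 2
coeff (lit k)      = 1
coeff (arop o d e) = coeff d + (coeff e + 1)
coeff (pow2 i)     = 2
coeff (sum x e)    = 8 + coeff e
degree (var i)      = 0
degree (lit k)      = 0
degree (arop o d e) = degree d ⊔ degree e
degree (pow2 i)     = 0
degree (sum x e)    = suc (degree e)

^-pos : ∀ X k → 1 ≤ X → 1 ≤ X ^ k
^-pos X k 1≤X = ≤-trans (≤-reflexive (sym (^-zeroˡ k))) (^-monoˡ-≤ k 1≤X)

steps-≤ : ∀ {n} (e : Exp n) X → 1 ≤ X → steps e X ≤ coeff e * X ^ degree e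
steps-≤ (var i)      X p = ≤-refl
steps-≤ (lit k)      X p = ≤-refl
steps-≤ (pow2 i)     X p = ≤-refl
steps-≤ (arop o d e) X p = begin
  steps d X + (steps e X + 1)
    ≤⟨ +-mono-≤ (≤-trans (steps-≤ d X p) (*-monoʳ-≤ (coeff d) (up {degree d} (m≤m⊔n _ _))))
                (+-mono-≤ (≤-trans (steps-≤ e X p) (*-monoʳ-≤ (coeff e) (up {degree e} (m≤n⊔m (degree d) _))))
                          (≤-trans (^-pos X D p) (≤-reflexive (sym (*-identityˡ _))))) ⟩
  coeff d * X ^ D + (coeff e * X ^ D + 1 * X ^ D)
    ≡⟨ lem (coeff d) (coeff e) (X ^ D) ⟩
  (coeff d + (coeff e + 1)) * X ^ D ∎
  where
  open ≤-Reasoning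
  D = degree d ⊔ degree e
  up : ∀ {k} → k ≤ D → X ^ k ≤ X ^ D
  up = ^-monoʳ-≤ X {{>-nonZero p}}
  lem : ∀ a b x → a * x + (b * x + 1 * x) ≡ (a + (b + 1)) * x
  lem = solve-∀
steps-≤ (sum x e)    X p = begin
  4 + X * (4 + steps e X)
    ≤⟨ +-mono-≤ (*-monoʳ-≤ 4 (^-pos X (suc (degree e)) p))
         (*-monoʳ-≤ X (+-mono-≤ (*-monoʳ-≤ 4 (^-pos X (degree e) p)) (steps-≤ e X p))) ⟩
  4 * (X * Y) + X * (4 * Y + coeff e * Y)
    ≡⟨ lem X Y (coeff e) ⟩
  (8 + coeff e) * (X * Y) ∎
  where
  open ≤-Reasoning
  Y = X ^ degree e
  lem : ∀ x y c → 4 * (x * y) + x * (4 * y + c * y) ≡ (8 + c) * (x * y)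
  lem = solve-∀


-- `B` limits the lengths of numbers and `X` the loop bounds. The two are kept apart because values
-- may be as large as `2 ^ B`, while running times are polynomial in `X`.
Fits : ∀ {n} → ℕ → ℕ → Exp n → Vec ℕ n → Set
Fits B X (var i)      ρ = ⊤
Fits B X (lit k)      ρ = k ≤ 2 ^ B
Fits B X (arop o d e) ρ = Fits B X d ρ × Fits B X e ρ
Fits B X (pow2 i)     ρ = lookup ρ i ≤ B
Fits B X (sum x e)    ρ = lookup ρ x ≤ X × (∀ i → i < lookup ρ x → Fits B X e (i ∷ ρ))

Small : ∀ {n} → ℕ → Vec ℕ n → Set
Small B ρ = ∀ i → lookup ρ i ≤ 2 ^ B

small-∷ : ∀ B {n i} {ρ : Vec ℕ n} → i ≤ 2 ^ B → Small B ρ → Small B (i ∷ ρ)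
small-∷ B p ρ≤ zero    = p
small-∷ B p ρ≤ (suc i) = ρ≤ i

1≤width : ∀ {n} (e : Exp n) → 1 ≤ width e
1≤width (var i)      = ≤-refl
1≤width (lit k)      = ≤-refl
1≤width (arop o d e) = ≤-trans (1≤width d) (m≤m+n _ _)
1≤width (pow2 i)     = ≤-refl
1≤width (sum x e)    = z<s

2^-mono : ∀ {m n} → m ≤ n → 2 ^ m ≤ 2 ^ n
2^-mono = ^-monoʳ-≤ 2

1≤size : ∀ {n} (e : Exp n) → 1 ≤ size e
1≤size (var i)      = z<s
1≤size (lit k)      = z<s
1≤size (arop o d e) = ≤-trans (1≤size d) (m≤m⊔n _ _)
1≤size (pow2 i)     = z<s
1≤size (sum x e)    = z<s

div-≤ : ∀ x y → ⟦ div ⟧ x y ≤ x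
div-≤ x zero    = z≤n
div-≤ x (suc y) = m/n≤m x (suc y)

mod-≤ : ∀ x y → ⟦ mod ⟧ x y ≤ x
mod-≤ x zero    = ≤-refl
mod-≤ x (suc y) = m%n≤m x (suc y)

-- One rule serves sums and products, because m + n is at most m n as soon as both are at least 2.
-- This is why widths have to be positive.
arop-width : ∀ o {x y b c} → 1 ≤ b → 1 ≤ c → x ≤ 2 ^ b → y ≤ 2 ^ c →
             ⟦ toOp o ⟧ x y ≤ 2 ^ (b + c)
arop-width o {x} {y} {b} {c} 1≤b 1≤c p q = go o
  where
  x≤ : x ≤ 2 ^ (b + c)
  x≤ = ≤-trans p (2^-mono (m≤m+n b c))
  2≤ : ∀ {k} → 1 ≤ k → 2 ≤ 2 ^ k
  2≤ = 2^-mono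
  sum≤prod : ∀ {m n} → 2 ≤ m → 2 ≤ n → m + n ≤ m * n
  sum≤prod {suc m} {n} (s≤s 1≤m) 2≤n = begin
    suc m + n   ≡⟨ lem m n ⟩
    n + suc m   ≤⟨ +-monoʳ-≤ n (≤-trans (≤-trans (+-monoˡ-≤ m 1≤m) (≤-reflexive (l2 m))) (*-monoʳ-≤ m 2≤n)) ⟩
    n + m * n   ∎
    where
    open ≤-Reasoning
    lem : ∀ m n → suc m + n ≡ n + suc m
    lem = solve-∀
    l2 : ∀ m → m + m ≡ m * 2
    l2 = solve-∀
  go : ∀ o → ⟦ toOp o ⟧ x y ≤ 2 ^ (b + c)
  go plus = begin
    x + y          ≤⟨ +-mono-≤ p q ⟩
    2 ^ b + 2 ^ c  ≤⟨ sum≤prod (2≤ 1≤b) (2≤ 1≤c) ⟩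
    2 ^ b * 2 ^ c  ≡⟨ ^-distribˡ-+-* 2 b c ⟨
    2 ^ (b + c)    ∎
    where open ≤-Reasoning
  go minus = ≤-trans (m∸n≤m x y) x≤
  go times = ≤-trans (*-mono-≤ p q) (≤-reflexive (sym (^-distribˡ-+-* 2 b c)))
  go quot = ≤-trans (div-≤ x y) x≤
  go rem = ≤-trans (mod-≤ x y) x≤
  go less = ≤-trans (bit≤1 (x <ᵇ y)) (1≤2^ (b + c))
  go equal = ≤-trans (bit≤1 (x ≡ᵇ y)) (1≤2^ (b + c))
  go shiftr = ≤-trans (m/n≤m x (2 ^ y) {{m^n≢0 2 y}}) x≤

eval-width : ∀ B {n X} (e : Exp n) (ρ : Vec ℕ n) → 1 ≤ B → Small B ρ → Fits B X e ρ →
             eval e ρ ≤ 2 ^ (width e * B)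
eval-width B (var i) ρ 1≤B ρ≤ fits = ≤-trans (ρ≤ i) (2^-mono (m≤m+n B 0))
eval-width B (lit k) ρ 1≤B ρ≤ fits = ≤-trans fits (2^-mono (m≤m+n B 0))
eval-width B (arop o d e) ρ 1≤B ρ≤ (f , g) =
  ≤-trans (arop-width o (*-mono-≤ (1≤width d) 1≤B) (*-mono-≤ (1≤width e) 1≤B)
             (eval-width B d ρ 1≤B ρ≤ f) (eval-width B e ρ 1≤B ρ≤ g))
          (≤-reflexive (cong (2 ^_) (sym (*-distribʳ-+ B (width d) (width e)))))
eval-width B (pow2 i) ρ 1≤B ρ≤ fits = 2^-mono (≤-trans fits (m≤m+n B 0))
eval-width B (sum x e) ρ 1≤B ρ≤ (_ , f) = begin
  sumTo n (λ i → eval e (i ∷ ρ))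
    ≤⟨ sumTo-≤ n (λ i i<n → eval-width B e (i ∷ ρ) 1≤B (small-∷ B (≤-trans (<⇒≤ i<n) (ρ≤ x)) ρ≤) (f i i<n)) ⟩
  n * 2 ^ (width e * B)       ≤⟨ *-monoˡ-≤ _ (ρ≤ x) ⟩
  2 ^ B * 2 ^ (width e * B)   ≡⟨ ^-distribˡ-+-* 2 B (width e * B) ⟨
  2 ^ (B + width e * B)       ∎
  where
  open ≤-Reasoning
  n = lookup ρ x

-- The value ends up in register `d`, and only registers from `d` on are overwritten. There is no
-- copy instruction; a register is copied by adding one that holds 0. The index of a `sum` runs
-- downwards, so that the decremented counter of rounds is the index itself.
compile : ∀ {n} → Vec ℕ n → ℕ → Exp n → Cmd
compile locs d (var i) = const (1 + d) 0 ⨾ arith add d (lookup locs i) (1 + d)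
compile locs d (lit k) = const d k
compile locs d (arop o e f) =
  compile locs d e ⨾ compile locs (1 + d) f ⨾ arith (toOp o) d d (1 + d)
compile locs d (pow2 i) = const d 1 ⨾ arith shl d d (lookup locs i)
compile locs d (sum x e) =
  const d 0 ⨾ const (2 + d) 0 ⨾ arith add (1 + d) (lookup locs x) (2 + d) ⨾
  while (1 + d)
    (const (2 + d) 1 ⨾ arith sub (1 + d) (1 + d) (2 + d) ⨾
     compile (1 + d ∷ locs) (2 + d) e ⨾ arith add d d (2 + d))

Outside : (d k r : ℕ) → Set
Outside d k r = r < d ⊎ d + k ≤ r

record Agree (d k : ℕ) (s s′ : State) : Set where
  constructor agree
  field
    regs  : ∀ r → Outside d k r → reg s′ r ≡ reg s r
    mems  : ∀ a → mem s′ a ≡ mem s a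
    tapes : tape s′ ≡ tape s
open Agree

agree-trans : ∀ {d k s s′ s″} → Agree d k s s′ → Agree d k s′ s″ → Agree d k s s″
agree-trans p q = agree (λ r o → trans (regs q r o) (regs p r o))
                        (λ a → trans (mems q a) (mems p a)) (trans (tapes q) (tapes p))

agree-widen : ∀ {d k d′ k′ s s′} → d′ ≤ d → d + k ≤ d′ + k′ →
              Agree d k s s′ → Agree d′ k′ s s′
agree-widen {d} {k} {d′} {k′} p q a = agree (λ r o → regs a r (out o)) (mems a) (tapes a)
  where
  out : ∀ {r} → Outside d′ k′ r → Outside d k r
  out (inj₁ r<) = inj₁ (<-≤-trans r< p)
  out (inj₂ ≤r) = inj₂ (≤-trans q ≤r)

agree-setReg : ∀ {d k} s r v → d ≤ r → r < d + k → Agree d k s (setReg s r v)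
agree-setReg {d} {k} s r v p q = agree (λ x o → [f↦]-miss (reg s) r v (ne o)) (λ _ → refl) refl
  where
  ne : ∀ {x} → Outside d k x → x ≢ r
  ne (inj₁ x<) refl = <⇒≱ x< p
  ne (inj₂ ≤x) refl = <⇒≱ q ≤x

suc-log≤ : ∀ w .{{_ : NonZero w}} m → suc m ≤ w * suc (m / w)
suc-log≤ w m = begin
  suc m                    ≡⟨ cong suc (m≡m%n+[m/n]*n m w) ⟩
  suc (m % w) + m / w * w  ≤⟨ +-monoˡ-≤ (m / w * w) (m%n<n m w) ⟩
  w + m / w * w            ≡⟨ cong (w +_) (*-comm (m / w) w) ⟩
  w + w * (m / w)          ≡⟨ *-suc w (m / w) ⟨
  w * suc (m / w)          ∎
  where open ≤-Reasoning

log⊔ : ∀ m n → ⌊log₂ (m ⊔ n) ⌋ ≤ ⌊log₂ m ⌋ + ⌊log₂ n ⌋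
log⊔ m n with ⊔-sel m n
... | inj₁ p = subst (λ z → ⌊log₂ z ⌋ ≤ ⌊log₂ m ⌋ + ⌊log₂ n ⌋) (sym p) (m≤m+n _ _)
... | inj₂ p = subst (λ z → ⌊log₂ z ⌋ ≤ ⌊log₂ m ⌋ + ⌊log₂ n ⌋) (sym p) (m≤n+m _ _)

log≤id : ∀ n → ⌊log₂ n ⌋ ≤ n
log≤id n = ≤-trans (⌊log₂⌋-mono-≤ (<⇒≤ (n<2^n n))) (≤-reflexive (⌊log₂[2^n]⌋≡n n))


-- Commands of the host program and the embedding of the simulated one.

module Lifting (v k : ℕ) where

  note : ℕ → Cmd
  note zero    = arith lt v (1 + v) k
  note (suc r) = skip

  -- Only registers are renamed. Addresses stay as they are, since a shift of computed addresses
  -- would have to be carried out at run time. Hence the whole memory belongs to the simulated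
  -- program, and the host keeps its own data in registers.
  lift : Cmd → Cmd
  lift skip            = skip
  lift (const r c)     = const (k + r) c ⨾ note r
  lift (arith o r x y) = arith o (k + r) (k + x) (k + y) ⨾ note r
  lift (load r x)      = load (k + r) (k + x) ⨾ note r
  lift (store x r)     = store (k + x) (k + r)
  lift (flip r)        = flip (k + r) ⨾ note r
  lift (c ⨾ d)         = lift c ⨾ lift d
  lift (ifnz r c d)    = ifnz (k + r) (lift c) (lift d)
  lift (while r c)     = while (k + r) (lift c)

small-[]≔ : ∀ B {n} (ρ : Vec ℕ n) x {v} → v ≤ 2 ^ B → Small B ρ → Small B (ρ [ x ]≔ v)
small-[]≔ B ρ x {v} p ρ≤ i with i Fin.≟ x
... | yes refl = subst (_≤ 2 ^ B) (sym (Vecₚ.lookup∘updateAt i ρ)) p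
... | no i≢x   = subst (_≤ 2 ^ B) (sym (Vecₚ.lookup∘updateAt′ i x i≢x ρ)) (ρ≤ i)

-- nv registers of our own, then the flag and the threshold, then temporary
-- registers, and those of the simulated algorithm from `base` on.

module Commands (nv base : ℕ) where

  open Lifting nv base public

  Env : Set
  Env = Vec ℕ nv

  ids : Vec ℕ nv
  ids = Vec.tabulate toℕ

  d₀ : ℕ
  d₀ = 2 + nv

  infix 7 _:=_
  _:=_ : Fin nv → Exp nv → Cmd
  x := e = compile ids d₀ e ⨾ const (1 + d₀) 0 ⨾ arith add (toℕ x) d₀ (1 + d₀)

  setA : ℕ → Exp nv → Cmd
  setA r e = (compile ids d₀ e ⨾ const (1 + d₀) 0 ⨾ arith add (base + r) d₀ (1 + d₀)) ⨾ note r

  readFlag : Fin nv → Cmd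
  readFlag x = const d₀ 0 ⨾ arith add (toℕ x) nv d₀

  loadA : Fin nv → Exp nv → Cmd
  loadA x e = compile ids d₀ e ⨾ load (toℕ x) d₀

  storeA : Exp nv → Exp nv → Cmd
  storeA e f = compile ids d₀ e ⨾ compile ids (1 + d₀) f ⨾ store d₀ (1 + d₀)

  loop : Fin nv → Cmd → Cmd
  loop x body = while (toℕ x) (x := (var x ⊟ lit 1) ⨾ body)

-- Walks, distances and diameters.

module _ {n} {G : Graph n} where

  walk-trans : ∀ {u v x j k} → Walk G u v j → Walk G v x k → Walk G u x (j + k)
  walk-trans stop       q = q
  walk-trans (step e p) q = step e (walk-trans p q)

  walk-snoc : ∀ {u v x k} → Walk G u v k → adj G v x ≡ true → Walk G u x (suc k)
  walk-snoc stop       e = step e stop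
  walk-snoc (step d p) e = step d (walk-snoc p e)

  walk-sym : ∀ {u v k} → Walk G u v k → Walk G v u k
  walk-sym stop                   = stop
  walk-sym (step {u} {x = x} e p) = walk-snoc (walk-sym p) (trans (adj-sym G x u) e)

  walk? : ∀ u v k → Dec (Walk G u v k)
  walk? u v zero = map′ (λ where refl → stop) (λ where stop → refl) (u Fin.≟ v)
  walk? u v (suc k) = map′ (λ (x , e , p) → step e p) (λ where (step e p) → _ , e , p)
    (Finₚ.any? λ x → (adj G u x Data.Bool.≟ true) ×-dec walk? x v k)

Near : ∀ {n} → Graph n → Fin n → Fin n → ℕ → Set
Near G u v k = ∃[ j ] (j ≤ k × Walk G u v j)

module _ {n} {G : Graph n} where

  near-refl : ∀ {u k} → Near G u u k
  near-refl = 0 , z≤n , stop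

  near-edge : ∀ {u v} → adj G u v ≡ true → Near G u v 1
  near-edge e = 1 , ≤-refl , step e stop

  near-trans : ∀ {u v x j k} → Near G u v j → Near G v x k → Near G u x (j + k)
  near-trans (i , i≤ , p) (l , l≤ , q) = i + l , +-mono-≤ i≤ l≤ , walk-trans p q

  near-sym : ∀ {u v k} → Near G u v k → Near G v u k
  near-sym (i , i≤ , p) = i , i≤ , walk-sym p

  near-≤ : ∀ {u v j k} → j ≤ k → Near G u v j → Near G u v k
  near-≤ j≤k (i , i≤ , p) = i , ≤-trans i≤ j≤k , p

least : ∀ {P : ℕ → Set} → (∀ j → Dec (P j)) → ∀ k → P k → ∃[ j ] (P j × (∀ i → P i → j ≤ i))
least {P} P? k p with P? 0
... | yes p₀ = 0 , p₀ , λ _ _ → z≤n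
least {P} P? zero    p | no ¬p₀ = ⊥-elim (¬p₀ p)
least {P} P? (suc k) p | no ¬p₀ with least (λ j → P? (suc j)) k p
... | j , q , min = suc j , q , λ where
  zero    p₀ → ⊥-elim (¬p₀ p₀)
  (suc i) pᵢ → s≤s (min i pᵢ)

argmax : ∀ {n} (f : Fin (suc n) → ℕ) → ∃[ i ] (∀ j → f j ≤ f i)
argmax {zero}  f = zero , λ where zero → ≤-refl
argmax {suc n} f with argmax (λ i → f (suc i))
... | i , max with f zero ≤? f (suc i)
...   | yes le = suc i , λ where
  zero    → le
  (suc j) → max j
...   | no ¬le = zero , λ where
  zero    → ≤-refl
  (suc j) → ≤-trans (max j) (<⇒≤ (≰⇒> ¬le))

module _ {n} .{{_ : NonZero n}} (G : Graph n) where

  distance : ∀ {b u v} → Near G u v b → ∃ (IsDistance G u v)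
  distance {u = u} {v} (k , _ , p) = least (walk? u v) k p

  -- An answer is constrained only relative to a given diameter, so one has to be exhibited: walks
  -- of a given length are decidable, which yields shortest ones, and the maximum over finitely many
  -- pairs is attained.
  diameter-exists : ∀ {b} → (∀ u v → Near G u v b) → ∃ (IsDiameter G)
  diameter-exists near = go n refl
    where
    d : Fin n → Fin n → ℕ
    d u v = proj₁ (distance (near u v))
    go : ∀ m → m ≡ n → ∃ (IsDiameter G)
    go zero    refl = ⊥-elim (<⇒≱ (>-nonZero⁻¹ n) z≤n)
    go (suc m) refl =
      let row    = λ u → argmax (d u)
          u , mu = argmax (λ u → d u (proj₁ (row u)))
          v , _  = row u
      in d u v ,
         (λ x y → d x y , proj₂ (distance (near x y)) , ≤-trans (proj₂ (row x) y) (mu x)) ,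
         u , v , proj₂ (distance (near u v))

  diameter-≤ : ∀ {b D} → (∀ u v → Near G u v b) → IsDiameter G D → D ≤ b
  diameter-≤ near (_ , u , v , _ , min) with near u v
  ... | k , k≤b , p = ≤-trans (min k p) k≤b


  -- Lower bounds on distances are certified by a function that grows by at most one along every
  -- edge; no walk has to be analysed.
  lipschitz-walk : (Φ : Fin n → ℕ) → (∀ u v → adj G u v ≡ true → Φ v ≤ suc (Φ u)) →
                   ∀ {u v k} → Walk G u v k → Φ v ≤ k + Φ u
  lipschitz-walk Φ lip stop = ≤-refl
  lipschitz-walk Φ lip {u} {v} (step {x = x} {k} e p) = begin
    Φ v          ≤⟨ lipschitz-walk Φ lip p ⟩
    k + Φ x      ≤⟨ +-monoʳ-≤ k (lip u x e) ⟩
    k + suc (Φ u) ≡⟨ +-suc k (Φ u) ⟩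
    suc k + Φ u  ∎
    where open ≤-Reasoning

  lipschitz-diameter : (Φ : Fin n → ℕ) → (∀ u v → adj G u v ≡ true → Φ v ≤ suc (Φ u)) →
                       ∀ {D} u v → IsDiameter G D → Φ v ≤ D + Φ u
  lipschitz-diameter Φ lip u v (all , _) with all u v
  ... | k , (p , _) , k≤D = ≤-trans (lipschitz-walk Φ lip p) (+-monoˡ-≤ (Φ u) k≤D)


-- Pigeonhole principle. It bounds the number of edges by an explicit list of candidates, and the
-- number of distinct clauses by a list of all clauses.
unique-⊆-length : ∀ {A : Set} {xs ys : List A} → Unique xs → (∀ {x} → x ∈ xs → x ∈ ys) →
                  length xs ≤ length ys
unique-⊆-length {xs = []} _ _ = z≤n
unique-⊆-length {A} {xs = x ∷ xs} (x∉ ∷ uniq) incl with Memₚ.∈-∃++ (incl (here refl))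
... | as , bs , refl = begin
  suc (length xs)          ≤⟨ s≤s (unique-⊆-length uniq incl′) ⟩
  suc (length (as ++ bs))  ≡⟨ cong suc (Listₚ.length-++ as) ⟩
  suc (length as + length bs) ≡⟨ +-suc (length as) (length bs) ⟨
  length as + suc (length bs) ≡⟨ Listₚ.length-++ as ⟨
  length (as ++ x ∷ bs)    ∎
  where
  open ≤-Reasoning
  incl′ : ∀ {y} → y ∈ xs → y ∈ as ++ bs
  incl′ {y} y∈ with Memₚ.∈-++⁻ as (incl (there y∈))
  ... | inj₁ y∈as         = Memₚ.∈-++⁺ˡ y∈as
  ... | inj₂ (here refl)  = ⊥-elim (All.lookup x∉ y∈ refl)
  ... | inj₂ (there y∈bs) = Memₚ.∈-++⁺ʳ as y∈bs

length-concatMap : ∀ {A B : Set} (f : A → List B) k xs → (∀ x → length (f x) ≡ k) →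
                   length (concatMap f xs) ≡ length xs * k
length-concatMap f k []       len = refl
length-concatMap f k (x ∷ xs) len =
  trans (Listₚ.length-++ (f x)) (cong₂ _+_ (len x) (length-concatMap f k xs len))

divMod-unique : ∀ q i ℓ .{{_ : NonZero ℓ}} → i < ℓ → (q * ℓ + i) / ℓ ≡ q × (q * ℓ + i) % ℓ ≡ i
divMod-unique q i ℓ i<ℓ = quotient , remainder
  where
  remainder : (q * ℓ + i) % ℓ ≡ i
  remainder = trans (cong (_% ℓ) (+-comm (q * ℓ) i)) (trans ([m+kn]%n≡m%n i q ℓ) (m<n⇒m%n≡m i<ℓ))
  quotient : (q * ℓ + i) / ℓ ≡ q
  quotient = *-cancelʳ-≡ _ q ℓ (+-cancelˡ-≡ i _ _ (begin
    i + (q * ℓ + i) / ℓ * ℓ                ≡⟨ cong (_+ (q * ℓ + i) / ℓ * ℓ) remainder ⟨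
    (q * ℓ + i) % ℓ + (q * ℓ + i) / ℓ * ℓ  ≡⟨ m≡m%n+[m/n]*n (q * ℓ + i) ℓ ⟨
    q * ℓ + i                              ≡⟨ +-comm (q * ℓ) i ⟩
    i + q * ℓ                              ∎))
    where open ≡-Reasoning

-- The network of stars: numbering, distances, potentials, sparsity.

-- R stars and S shared vertices.  Star r has a centre and S legs of ℓ
-- vertices; the tip of leg s is joined to the shared vertex s if 0 < T r s
-- and is a dead end otherwise.

module Net (R S ℓ′ : ℕ) .{{_ : NonZero S}} (T : ℕ → ℕ → ℕ) where

  ℓ : ℕ
  ℓ = suc ℓ′

  order : ℕ
  order = S + R + R * S * ℓ

  instance
    order≢0 : NonZero order
    order≢0 = >-nonZero (≤-trans (>-nonZero⁻¹ S) (≤-trans (m≤m+n S R) (m≤m+n (S + R) _)))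

  center : ℕ → ℕ
  center r = S + r

  leg : ℕ → ℕ → ℕ → ℕ
  leg r s i = S + R + ((r * S + s) * ℓ + i)

  shared< : ∀ {s} → s < S → s < order
  shared< s< = ≤-trans s< (≤-trans (m≤m+n S R) (m≤m+n (S + R) _))

  center< : ∀ {r} → r < R → center r < order
  center< r< = ≤-trans (+-monoʳ-< S r<) (m≤m+n (S + R) _)

  mixed< : ∀ {a b A B} → a < A → b < B → a * B + b < A * B
  mixed< {a} {b} {A} {B} a< b< = begin-strict
    a * B + b   <⟨ +-monoʳ-< (a * B) b< ⟩
    a * B + B   ≡⟨ +-comm (a * B) B ⟩
    suc a * B   ≤⟨ *-monoˡ-≤ B a< ⟩
    A * B       ∎
    where open ≤-Reasoning

  leg< : ∀ {r s i} → r < R → s < S → i < ℓ → leg r s i < order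
  leg< r< s< i< = +-monoʳ-< (S + R) (mixed< (mixed< r< s<) i<)

  rest : ℕ → ℕ
  rest x = x ∸ (S + R)

  starOf legOf posOf : ℕ → ℕ
  starOf x = rest x / ℓ / S
  legOf x  = rest x / ℓ % S
  posOf x  = rest x % ℓ

  decode-leg : ∀ r s i → s < S → i < ℓ →
               starOf (leg r s i) ≡ r × legOf (leg r s i) ≡ s × posOf (leg r s i) ≡ i
  decode-leg r s i s< i< =
    trans (cong (_/ S) q) (proj₁ (divMod-unique r s S s<)) ,
    trans (cong (_% S) q) (proj₂ (divMod-unique r s S s<)) ,
    trans (cong (_% ℓ) rest≡) (proj₂ (divMod-unique (r * S + s) i ℓ i<))
    where
    rest≡ : rest (leg r s i) ≡ (r * S + s) * ℓ + i
    rest≡ = m+n∸m≡n (S + R) _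
    q : rest (leg r s i) / ℓ ≡ r * S + s
    q = trans (cong (_/ ℓ) rest≡) (proj₁ (divMod-unique (r * S + s) i ℓ i<))

  data Star (r : ℕ) : ℕ → Set where
    hub   : Star r (center r)
    inLeg : ∀ {s i} → s < S → i < ℓ → Star r (leg r s i)

  data View : ℕ → Set where
    shared : ∀ {s} → s < S → View s
    star   : ∀ {r x} → r < R → Star r x → View x

  view : ∀ x → x < order → View x
  view x x< with x <? S
  ... | yes x<S = shared x<S
  ... | no x≮S with x <? S + R
  ...   | yes x<SR = subst View (m+[n∸m]≡n (≮⇒≥ x≮S))
                       (star (+-cancelˡ-< S _ _ (subst (_< S + R) (sym (m+[n∸m]≡n (≮⇒≥ x≮S))) x<SR)) hub)
  ...   | no x≮SR = subst View x≡ (star r< (inLeg (m%n<n (rest x / ℓ) S) (m%n<n (rest x) ℓ)))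
    where
    rest< : rest x < R * S * ℓ
    rest< = +-cancelˡ-< (S + R) _ _ (subst (_< order) (sym (m+[n∸m]≡n (≮⇒≥ x≮SR))) x<)
    r< : starOf x < R
    r< = m<n*o⇒m/o<n (m<n*o⇒m/o<n {rest x} {R * S} {ℓ} rest<)
    rejoin : ∀ m k .{{_ : NonZero k}} → m / k * k + m % k ≡ m
    rejoin m k = trans (+-comm (m / k * k) (m % k)) (sym (m≡m%n+[m/n]*n m k))
    x≡ : leg (starOf x) (legOf x) (posOf x) ≡ x
    x≡ = trans (cong (λ z → S + R + (z * ℓ + posOf x)) (rejoin (rest x / ℓ) S))
          (trans (cong (S + R +_) (rejoin (rest x) ℓ)) (m+[n∸m]≡n (≮⇒≥ x≮SR)))

  -- Links are oriented from the smaller number to the larger one, see `link-<`; for tips this holds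
  -- because shared vertices come first in the numbering. So there are no loops, and an edge can be
  -- counted at its larger end. `Gate` is a parameter since gates are all that the updates change.
  data Link (Gate : ℕ → ℕ → Set) : ℕ → ℕ → Set where
    root : ∀ {r s} → r < R → s < S → Link Gate (center r) (leg r s 0)
    next : ∀ {r s i} → r < R → s < S → i < ℓ′ → Link Gate (leg r s i) (leg r s (suc i))
    tip  : ∀ {r s} → r < R → s < S → 0 < T r s → Link Gate s (leg r s ℓ′)
    gate : ∀ {s s′} → s < s′ → s′ < S → Gate s s′ → Link Gate s s′

  link-< : ∀ {Gate x y} → Link Gate x y → x < y
  link-< (root {r} {s} r< s<) = ≤-trans (+-monoʳ-< S r<) (m≤m+n (S + R) _)
  link-< (next {r} {s} {i} _ _ _) = +-monoʳ-< (S + R) (+-monoʳ-< ((r * S + s) * ℓ) (n<1+n i))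
  link-< (tip _ s< _) = ≤-trans s< (≤-trans (m≤m+n S R) (m≤m+n (S + R) _))
  link-< (gate p _ _) = p

  link-shift : ∀ {Gate Gate′ : ℕ → ℕ → Set} → (∀ {s s′} → Gate s s′ → Gate′ s s′) →
               ∀ {x y} → Link Gate x y → Link Gate′ x y
  link-shift f (root p q)   = root p q
  link-shift f (next p q r) = next p q r
  link-shift f (tip p q t)  = tip p q t
  link-shift f (gate p q g) = gate p q (f g)

  record Represents (G : Graph order) (Gate : ℕ → ℕ → Set) : Set where
    constructor represents
    field
      edges : ∀ u v → adj G u v ≡ true ⇔ (Link Gate (toℕ u) (toℕ v) ⊎ Link Gate (toℕ v) (toℕ u))
  open Represents public

  Common : (ℕ → ℕ → Set) → ℕ → ℕ → Set
  Common Gate r r′ = ∃[ s ] ∃[ s′ ]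
    (s < S × s′ < S × 0 < T r s × 0 < T r′ s′ × (s ≡ s′ ⊎ Link Gate s s′ ⊎ Link Gate s′ s))

  module Distances {G : Graph order} {Gate : ℕ → ℕ → Set} (rep : Represents G Gate)
                   {z : ℕ} (z< : z < R) (hub-T : ∀ s → s < S → 0 < T z s)
                   (attached : ∀ r → r < R → ∃[ s ] (s < S × 0 < T r s)) where

    Within : ℕ → ℕ → ℕ → Set
    Within x y k = (p : x < order) (q : y < order) → Near G (fromℕ< p) (fromℕ< q) k

    n-link : ∀ {x y} → Link Gate x y → Within x y 1
    n-link {x} {y} l p q = near-edge (Equivalence.from (edges rep (fromℕ< p) (fromℕ< q))
      (inj₁ (subst₂ (Link Gate) (sym (Finₚ.toℕ-fromℕ< p)) (sym (Finₚ.toℕ-fromℕ< q)) l)))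

    n-sym : ∀ {x y k} → Within x y k → Within y x k
    n-sym m p q = near-sym (m q p)

    n-trans : ∀ {x y v j k} → y < order → Within x y j → Within y v k → Within x v (j + k)
    n-trans y< m m′ p q = near-trans (m p y<) (m′ y< q)

    n-≤ : ∀ {x y j k} → j ≤ k → Within x y j → Within x y k
    n-≤ le m p q = near-≤ le (m p q)

    leg-center : ∀ {r s} i → r < R → s < S → i < ℓ → Within (center r) (leg r s i) (suc i)
    leg-center zero    r< s< i< = n-link (root r< s<)
    leg-center (suc i) r< s< i< =
      n-≤ (≤-reflexive (+-comm (suc i) 1))
        (n-trans (leg< r< s< (<⇒≤ i<)) (leg-center i r< s< (<⇒≤ i<)) (n-link (next r< s< (s≤s⁻¹ i<))))

    leg-tip : ∀ {r s} c i → i + c ≡ ℓ′ → r < R → s < S → 0 < T r s → Within (leg r s i) s (suc c)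
    leg-tip {r} {s} zero i i≡ r< s< t = subst (λ i → Within (leg r s i) s 1) (trans (sym i≡) (+-identityʳ i))
      (n-sym (n-link (tip r< s< t)))
    leg-tip (suc c) i i≡ r< s< t =
      n-trans (leg< r< s< (s≤s (subst (suc i ≤_) i≡ (≤-trans (m≤m+n (suc i) c) (≤-reflexive (sym (+-suc i c)))))))
        (n-link (next r< s< (subst (i <_) i≡ (m<m+n i z<s))))
        (leg-tip c (suc i) (trans (sym (+-suc i c)) i≡) r< s< t)

    center-shared : ∀ {r s} → r < R → s < S → 0 < T r s → Within (center r) s (suc ℓ)
    center-shared r< s< t = n-trans (leg< r< s< z<s) (n-link (root r< s<)) (leg-tip ℓ′ 0 refl r< s< t)

    star-center : ∀ {r x} → r < R → Star r x → Within x (center r) ℓ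
    star-center r< hub              = λ p q → near-refl
    star-center r< (inLeg s< i<) = n-≤ i< (n-sym (leg-center _ r< s< i<))

    star-shared : ∀ {r x s} → r < R → Star r x → s < S → 0 < T r s → Within x s (ℓ + suc ℓ)
    star-shared r< st s< t = n-trans (center< r<) (star-center r< st) (center-shared r< s< t)

    shared-hub : ∀ {s} → s < S → Within s (center z) (suc ℓ)
    shared-hub s< = n-sym (center-shared z< s< (hub-T _ s<))

    view-hub : ∀ {x} → View x → Within x (center z) (ℓ + suc ℓ + suc ℓ)
    view-hub (shared s<) = n-≤ (m≤n+m (suc ℓ) (ℓ + suc ℓ)) (shared-hub s<)
    view-hub (star r< st) with attached _ r<
    ... | s , s< , t = n-trans (shared< s<) (star-shared r< st s< t) (shared-hub s<)

    from-Within : ∀ {k} → (∀ x y → View x → View y → Within x y k) → ∀ u v → Near G u v k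
    from-Within f u v = subst₂ (λ u v → Near G u v _) (Finₚ.fromℕ<-toℕ u _) (Finₚ.fromℕ<-toℕ v _)
      (f (toℕ u) (toℕ v) (view _ (Finₚ.toℕ<n u)) (view _ (Finₚ.toℕ<n v)) (Finₚ.toℕ<n u) (Finₚ.toℕ<n v))

    -- Holds whatever gates are open. Any finite bound would do: it only ensures that the diameter
    -- exists.
    connected : ∀ u v → Near G u v (ℓ + suc ℓ + suc ℓ + (ℓ + suc ℓ + suc ℓ))
    connected = from-Within λ x y vx vy → n-trans (center< z<) (view-hub vx) (n-sym (view-hub vy))

    far : ℕ
    far = ℓ + suc ℓ + suc (ℓ + suc ℓ)

    -- A star is left by `ℓ` edges to the centre and `ℓ + 1` along a live leg to a shared vertex.
    -- Twice this and one gate make 4 ℓ + 3. From a shared vertex to a star the same number arises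
    -- by a detour through the hub, (ℓ + 1) + (ℓ + 1) + (2 ℓ + 1).
    near-upper : (∀ r r′ → r < R → r′ < R → Common Gate r r′) → ∀ u v → Near G u v far
    near-upper common = from-Within both
      where
      shared-star : ∀ {s r x} → s < S → r < R → Star r x → Within s x far
      shared-star s< r< st with attached _ r<
      ... | s₀ , s₀< , t = n-≤ (≤-reflexive (lem ℓ))
        (n-trans (center< z<) (shared-hub s<)
          (n-trans (shared< s₀<) (n-sym (shared-hub s₀<)) (n-sym (star-shared r< st s₀< t))))
        where
        lem : ∀ l → suc l + (suc l + (l + suc l)) ≡ l + suc l + suc (l + suc l)
        lem = solve-∀
      adjacent : ∀ {s s′} → s ≡ s′ ⊎ Link Gate s s′ ⊎ Link Gate s′ s → Within s s′ 1
      adjacent (inj₁ refl)     = λ p q → near-refl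
      adjacent (inj₂ (inj₁ l)) = n-link l
      adjacent (inj₂ (inj₂ l)) = n-sym (n-link l)
      both : ∀ x y → View x → View y → Within x y far
      both x y (shared s<) (shared s′<) =
        n-≤ (≤-trans (m≤m+n _ (ℓ + ℓ + 1)) (≤-reflexive (lem ℓ)))
          (n-trans (center< z<) (shared-hub s<) (n-sym (shared-hub s′<)))
        where
        lem : ∀ l → (suc l + suc l) + (l + l + 1) ≡ l + suc l + suc (l + suc l)
        lem = solve-∀
      both x y (shared s<) (star r< st) = shared-star s< r< st
      both x y (star r< st) (shared s<) = n-sym (shared-star s< r< st)
      both x y (star r< st) (star r′< st′) with common _ _ r< r′<
      ... | s , s′ , s< , s′< , t , t′ , c =
        n-trans (shared< s<) (star-shared r< st s< t)
          (n-trans (shared< s′<) (adjacent c) (n-sym (star-shared r′< st′ s′< t′)))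

  -- Potentials, given by their levels at the shared vertices, the centres
  -- and the ends of the legs, and interpolated linearly along the legs.

  module Potential (lev mu : ℕ → ℕ) (nu : ℕ → ℕ → ℕ) where

    Φ : ℕ → ℕ
    Φ x = if x <ᵇ S then suc ℓ * lev x
          else if x <ᵇ S + R then suc ℓ * mu (x ∸ S)
          else (ℓ ∸ posOf x) * mu (starOf x) + suc (posOf x) * nu (starOf x) (legOf x)

    Φ-shared : ∀ {s} → s < S → Φ s ≡ suc ℓ * lev s
    Φ-shared {s} s< rewrite true-<ᵇ s< = refl

    Φ-center : ∀ {r} → r < R → Φ (center r) ≡ suc ℓ * mu r
    Φ-center {r} r< rewrite false-<ᵇ (S + r) S (m≤m+n S r) | true-<ᵇ (+-monoʳ-< S r<) | m+n∸m≡n S r = refl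

    Φ-leg : ∀ {r s i} → s < S → i < ℓ → Φ (leg r s i) ≡ (ℓ ∸ i) * mu r + suc i * nu r s
    Φ-leg {r} {s} {i} s< i<
      rewrite false-<ᵇ (leg r s i) S (≤-trans (m≤m+n S R) (m≤m+n (S + R) _))
            | false-<ᵇ (leg r s i) (S + R) (m≤m+n (S + R) _)
      with starOf (leg r s i) | legOf (leg r s i) | posOf (leg r s i) | decode-leg r s i s< i<
    ... | _ | _ | _ | refl , refl , refl = refl

    Close : ℕ → ℕ → Set
    Close x y = x ≤ suc y × y ≤ suc x

    module _ {Gate : ℕ → ℕ → Set}
             (gate-lev : ∀ {s s′} → Gate s s′ → lev s ≡ lev s′)
             (tip-nu : ∀ {r s} → 0 < T r s → r < R → s < S → nu r s ≡ lev s)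
             (mu-nu : ∀ r s → r < R → s < S → Close (mu r) (nu r s)) where

      close-+ : ∀ {x y a b} c → x ≡ a + c → y ≡ b + c → Close a b → Close x y
      close-+ c refl refl (p , q) = +-monoˡ-≤ c p , +-monoˡ-≤ c q

      -- A leg has `ℓ + 1` edges from the centre to the shared vertex, and the levels at its ends
      -- are multiplied by `ℓ + 1`. So each edge changes `Φ` by the difference of the two levels,
      -- which is at most one. Gates join vertices of equal level.
      link-close : ∀ {x y} → Link Gate x y → Close (Φ x) (Φ y)
      link-close (root {r} {s} r< s<) =
        close-+ (ℓ * mu r) (Φ-center r<) (trans (Φ-leg s< z<s) (lem (ℓ * mu r) (nu r s))) (mu-nu r s r< s<)
        where
        lem : ∀ a b → a + 1 * b ≡ b + a
        lem = solve-∀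
      link-close (next {r} {s} {i} r< s< i<) =
        close-+ ((ℓ′ ∸ i) * mu r + suc i * nu r s)
          (trans (Φ-leg s< (m<n⇒m<1+n i<)) (trans (cong (λ d → d * mu r + suc i * nu r s) (+-∸-assoc 1 (<⇒≤ i<))) (+-assoc (mu r) _ _)))
          (trans (Φ-leg s< (s≤s i<)) (lem (ℓ′ ∸ i) (mu r) i (nu r s))) (mu-nu r s r< s<)
        where
        lem : ∀ d m i n → d * m + suc (suc i) * n ≡ n + (d * m + suc i * n)
        lem = solve-∀
      link-close (tip {r} {s} r< s< t) with mu-nu r s r< s<
      ... | p , q = close-+ (ℓ * nu r s)
        (trans (Φ-shared s<) (cong (suc ℓ *_) (sym (tip-nu t r< s<))))
        (trans (Φ-leg s< ≤-refl) (cong (_+ ℓ * nu r s) (trans (cong (_* mu r) one) (+-identityʳ (mu r))))) (q , p)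
        where
        one : ℓ ∸ ℓ′ ≡ 1
        one = m+n∸n≡m 1 ℓ′
      link-close (gate {s} {s′} s< s′< g) =
        close-+ 0 (trans (trans (Φ-shared (<-trans s< s′<)) (cong (suc ℓ *_) (gate-lev g))) (sym (+-identityʳ _)))
                  (trans (Φ-shared s′<) (sym (+-identityʳ _))) (n≤1+n _ , n≤1+n _)

      lipschitz : ∀ {G} → Represents G Gate → ∀ u v → adj G u v ≡ true → Φ (toℕ v) ≤ suc (Φ (toℕ u))
      lipschitz rep u v e with Equivalence.to (edges rep u v) e
      ... | inj₁ l = proj₂ (link-close l)
      ... | inj₂ l = proj₁ (link-close l)

  -- Made total by reduction modulo `order`, so that vertices can be named by numbers without
  -- carrying bounds.
  clip : ℕ → Fin order
  clip x = fromℕ< (m%n<n x order)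

  clip-toℕ : ∀ u → clip (toℕ u) ≡ u
  clip-toℕ u = Finₚ.toℕ-injective (trans (Finₚ.toℕ-fromℕ< _) (m<n⇒m%n≡m (Finₚ.toℕ<n u)))


  module _ (M : ℕ) where

    -- The possible smaller neighbours of `y`, one for each constructor of `Link`: centre of the
    -- star, predecessor in the leg, shared vertex of the leg, other end of the gate. Edges are
    -- charged to their larger ends, hence the 4 in `Sparse 4`, which does not depend on the lengths
    -- of the legs.
    candidates : ℕ → List ℕ
    candidates y = center (starOf y) ∷ pred y ∷ legOf y ∷ y ∸ M ∷ []

    link-candidate : ∀ {Gate : ℕ → ℕ → Set} → (∀ {s s′} → Gate s s′ → s′ ≡ M + s) →
                     ∀ {x y} → Link Gate x y → x ∈ candidates y
    link-candidate g (root {r} {s} r< s<) = here (cong center (sym (proj₁ (decode-leg r s 0 s< z<s))))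
    link-candidate g (next {r} {s} {i} _ _ _) = there (here (sym (cong pred (lem (S + R) ((r * S + s) * ℓ) i))))
      where
      lem : ∀ a b i → a + (b + suc i) ≡ suc (a + (b + i))
      lem = solve-∀
    link-candidate g (tip {r} {s} r< s< _) = there (there (here (sym (proj₁ (proj₂ (decode-leg r s ℓ′ s< ≤-refl))))))
    link-candidate g (gate {s} {s′} _ _ gt) =
      there (there (there (here (sym (trans (cong (_∸ M) (g gt)) (m+n∸m≡n M s))))))

    represents-sparse : ∀ {G Gate} → (∀ {s s′} → Gate s s′ → s′ ≡ M + s) → Represents G Gate → Sparse 4 G
    represents-sparse {G} {Gate} g rep = begin
      edgeCount G                    ≤⟨ unique-⊆-length unique incl ⟩
      length pairs                   ≡⟨ length-concatMap cells 4 (allFin order) (λ _ → refl) ⟩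
      length (allFin order) * 4      ≡⟨ cong (_* 4) (Listₚ.length-tabulate {n = order} id) ⟩
      order * 4                      ≡⟨ *-comm order 4 ⟩
      4 * order                      ≡⟨ cong (4 *_) (sym (*-identityʳ order)) ⟩
      4 * (order * 1)                ≤⟨ *-monoʳ-≤ 4 (*-monoʳ-≤ order (^-pos (bitLength order) 4 (s≤s z≤n))) ⟩
      4 * (order * bitLength order ^ 4) ∎
      where
      open ≤-Reasoning
      cells : Fin order → List (Fin order × Fin order)
      cells v = map (λ x → clip x , v) (candidates (toℕ v))
      pairs = concatMap cells (allFin order)
      upward : Fin order × Fin order → Bool
      upward (u , v) = (toℕ u <ᵇ toℕ v) ∧ adj G u v
      unique : Unique (filterᵇ upward (cartesianProduct (allFin order) (allFin order)))
      unique = Uniqueₚ.filter⁺ (Data.Bool.T? ∘ upward)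
                 (Uniqueₚ.cartesianProduct⁺ (Uniqueₚ.allFin⁺ order) (Uniqueₚ.allFin⁺ order))
      incl : ∀ {e} → e ∈ filterᵇ upward (cartesianProduct (allFin order) (allFin order)) → e ∈ pairs
      incl {u , v} e∈ with Memₚ.∈-filter⁻ (Data.Bool.T? ∘ upward) {xs = cartesianProduct (allFin order) (allFin order)} e∈
      ... | _ , t with Equivalence.to Data.Bool.Properties.T-∧ t
      ...   | u<v , e with Equivalence.to (edges rep u v) (Equivalence.to T-≡ e)
      ...     | inj₂ l = ⊥-elim (<-asym (link-< l) (<ᵇ⇒< _ _ u<v))
      ...     | inj₁ l = Memₚ.∈-concatMap⁺ cells (Any.map (λ where refl → found) (Memₚ.∈-allFin v))
        where
        found : (u , v) ∈ cells v
        found = subst (λ z → (z , v) ∈ cells v) (clip-toℕ u) (Memₚ.∈-map⁺ (λ x → clip x , v) (link-candidate g l))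

-- Gates and the sequence of operations.

isPair⁻ : ∀ {n} (u v x y : Fin n) → isPair u v x y ≡ true → (x ≡ u × y ≡ v) ⊎ (x ≡ v × y ≡ u)
isPair⁻ u v x y e with x Fin.≟ u | y Fin.≟ v | x Fin.≟ v | y Fin.≟ u
... | yes p | yes q | _     | _     = inj₁ (p , q)
... | yes _ | no _  | yes p | yes q = inj₂ (p , q)
... | no _  | _     | yes p | yes q = inj₂ (p , q)

isPair⁺ : ∀ {n} (u v x y : Fin n) → (x ≡ u × y ≡ v) ⊎ (x ≡ v × y ≡ u) → isPair u v x y ≡ true
isPair⁺ u v .u .v (inj₁ (refl , refl)) with u Fin.≟ u | v Fin.≟ v
... | yes _ | yes _ = refl
... | no ¬p | _     = ⊥-elim (¬p refl)
... | _     | no ¬p = ⊥-elim (¬p refl)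
isPair⁺ u v .v .u (inj₂ (refl , refl)) with u Fin.≟ u | v Fin.≟ v
... | yes _ | yes _ = ∨-zeroʳ _
... | no ¬p | _     = ⊥-elim (¬p refl)
... | _     | no ¬p = ⊥-elim (¬p refl)

admissible-⊆ : ∀ {𝒞 𝒟 : GraphClass} → (∀ {n} {G : Graph n} → 𝒞 G → 𝒟 G) →
               ∀ {n} {G : Graph n} {ops} → Admissible 𝒞 G ops → Admissible 𝒟 G ops
admissible-⊆ f (done c)       = done (f c)
admissible-⊆ f (insert c e p) = insert (f c) e (admissible-⊆ f p)
admissible-⊆ f (delete c e p) = delete (f c) e (admissible-⊆ f p)
admissible-⊆ f (query c p)    = query (f c) (admissible-⊆ f p)

∨-split : ∀ x {y} → x ∨ y ≡ true → x ≡ true ⊎ y ≡ true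
∨-split true  _ = inj₁ refl
∨-split false e = inj₂ e

anyAbove : ℕ → List ℕ → Bool
anyAbove thr []       = false
anyAbove thr (a ∷ as) = (thr <ᵇ a) ∨ anyAbove thr as

-- The shared vertices are u_j = j and w_j = M + j for j ≤ m; the edge
-- between u_j and w_j, j < m, is the gate of clause j.  In phase τ the gates
-- j with `opened τ j` are opened for the query and then closed again.

module Gates (R ℓ′ m : ℕ) (T : ℕ → ℕ → ℕ) where

  M S : ℕ
  M = suc m
  S = M + M

  open Net R S ℓ′ T public

  -- Written as arithmetic because the machine has to compute it. The shape is that of `linkExp`, so
  -- that the evaluation of the latter unfolds to it. Gates are missing, since all of them are
  -- closed in `G₀`.
  linkCount : ℕ → ℕ → ℕ
  linkCount u v = sumTo R λ r → sumTo S λ s →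
    bit (u ≡ᵇ center r) * bit (v ≡ᵇ leg r s 0)
    + (bit (u ≡ᵇ s) * bit (v ≡ᵇ leg r s ℓ′) * T r s
    + sumTo ℓ′ λ i → bit (u ≡ᵇ leg r s i) * bit (v ≡ᵇ leg r s (suc i)))

  record GateIf (P : ℕ → Set) (s s′ : ℕ) : Set where
    constructor gateIf
    field
      partner : s′ ≡ M + s
      clause  : s < m
      isOpen  : P s
  open GateIf

  gate-map : ∀ {P Q : ℕ → Set} → (∀ {x} → P x → Q x) → ∀ {s s′} → GateIf P s s′ → GateIf Q s s′
  gate-map f (gateIf e a<m p) = gateIf e a<m (f p)

  Never : ℕ → Set
  Never _ = ⊥

  count-link : ∀ u v → 0 < linkCount u v → Link (GateIf Never) u v
  count-link u v pos with sumTo-pos R pos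
  ... | r , r< , pos₁ with sumTo-pos S pos₁
  ...   | s , s< , pos₂ with pos-+ (bit (u ≡ᵇ center r) * bit (v ≡ᵇ leg r s 0)) pos₂
  ...     | inj₁ p with pos-* (bit (u ≡ᵇ center r)) p
  ...       | a , c = subst₂ (Link _) (sym (≡ᵇ-true u _ (pos-bit _ a))) (sym (≡ᵇ-true v _ (pos-bit _ c))) (root r< s<)
  count-link u v pos | r , r< , pos₁ | s , s< , pos₂ | inj₂ q with pos-+ (bit (u ≡ᵇ s) * bit (v ≡ᵇ leg r s ℓ′) * T r s) q
  ... | inj₁ p with pos-* (bit (u ≡ᵇ s) * bit (v ≡ᵇ leg r s ℓ′)) p
  ...   | a , t with pos-* (bit (u ≡ᵇ s)) a
  ...     | a₁ , a₂ = subst₂ (Link _) (sym (≡ᵇ-true u _ (pos-bit _ a₁))) (sym (≡ᵇ-true v _ (pos-bit _ a₂))) (tip r< s< t)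
  count-link u v pos | r , r< , pos₁ | s , s< , pos₂ | inj₂ q | inj₂ p with sumTo-pos ℓ′ p
  ... | i , i< , p′ with pos-* (bit (u ≡ᵇ leg r s i)) p′
  ...   | a , c = subst₂ (Link _) (sym (≡ᵇ-true u _ (pos-bit _ a))) (sym (≡ᵇ-true v _ (pos-bit _ c))) (next r< s< i<)

  self : ∀ x → 0 < bit (x ≡ᵇ x)
  self x = bit-pos (true-≡ᵇ x x refl)

  link-count : ∀ {u v} → Link (GateIf Never) u v → 0 < linkCount u v
  link-count (root {r} {s} r< s<) = pos-sumTo R r r< (pos-sumTo S s s<
    (≤-trans (*-pos (self (center r)) (self (leg r s 0))) (m≤m+n _ _)))
  link-count (tip {r} {s} r< s< t) = pos-sumTo R r r< (pos-sumTo S s s<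
    (≤-trans (≤-trans (*-pos (*-pos (self s) (self (leg r s ℓ′))) t) (m≤m+n _ _))
             (m≤n+m _ (bit (s ≡ᵇ center r) * bit (leg r s ℓ′ ≡ᵇ leg r s 0)))))
  link-count (next {r} {s} {i} r< s< i<) = pos-sumTo R r r< (pos-sumTo S s s<
    (≤-trans (≤-trans (pos-sumTo ℓ′ i i< (*-pos (self (leg r s i)) (self (leg r s (suc i)))))
                      (m≤n+m _ (bit (leg r s i ≡ᵇ s) * bit (leg r s (suc i) ≡ᵇ leg r s ℓ′) * T r s)))
             (m≤n+m _ (bit (leg r s i ≡ᵇ center r) * bit (leg r s (suc i) ≡ᵇ leg r s 0)))))

  G₀ : Graph order
  G₀ = record
    { adj     = λ u v → 0 <ᵇ linkCount (toℕ u) (toℕ v) + linkCount (toℕ v) (toℕ u)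
    ; adj-sym = λ u v → cong (0 <ᵇ_) (+-comm (linkCount (toℕ u) (toℕ v)) _)
    ; noLoop  = λ u → ¬-not λ e → case pos-+ (linkCount (toℕ u) (toℕ u)) (<ᵇ-true 0 _ e) of λ where
        (inj₁ p) → <-irrefl refl (link-< (count-link (toℕ u) (toℕ u) p))
        (inj₂ p) → <-irrefl refl (link-< (count-link (toℕ u) (toℕ u) p))
    }

  represents-G₀ : Represents G₀ (GateIf Never)
  represents-G₀ = represents λ u v → mk⇔
    (λ e → case pos-+ (linkCount (toℕ u) (toℕ v)) (<ᵇ-true 0 _ e) of λ where
      (inj₁ p) → inj₁ (count-link (toℕ u) (toℕ v) p)
      (inj₂ p) → inj₂ (count-link (toℕ v) (toℕ u) p))
    (λ where
      (inj₁ l) → true-<ᵇ (≤-trans (link-count l) (m≤m+n _ _))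
      (inj₂ l) → true-<ᵇ (≤-trans (link-count l) (m≤n+m _ (linkCount (toℕ u) (toℕ v)))))

  -- Both ends of a gate are shared vertices, while any other link has its larger end in a leg. So
  -- the edge between `u-node j` and `w-node j` tells the state of gate `j`.
  link-shared : ∀ {Gate x y} → Link Gate x y → y < S → Gate x y
  link-shared (root _ _)   y< = ⊥-elim (<⇒≱ y< (≤-trans (m≤m+n S R) (m≤m+n (S + R) _)))
  link-shared (next _ _ _) y< = ⊥-elim (<⇒≱ y< (≤-trans (m≤m+n S R) (m≤m+n (S + R) _)))
  link-shared (tip _ _ _)  y< = ⊥-elim (<⇒≱ y< (≤-trans (m≤m+n S R) (m≤m+n (S + R) _)))
  link-shared (gate _ _ g) y< = g

  u-node w-node : ℕ → Fin order
  u-node j = clip j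
  w-node j = clip (M + j)

  toℕ-clip : ∀ {s} → s < S → toℕ (clip s) ≡ s
  toℕ-clip s< = trans (Finₚ.toℕ-fromℕ< _) (m<n⇒m%n≡m (shared< s<))

  module _ {j : ℕ} (j<m : j < m) where

    u< : j < S
    u< = ≤-trans j<m (≤-trans (n≤1+n m) (m≤m+n M M))

    w< : M + j < S
    w< = +-monoʳ-< M (m<n⇒m<1+n j<m)

    toℕ-u : toℕ (u-node j) ≡ j
    toℕ-u = toℕ-clip u<

    toℕ-w : toℕ (w-node j) ≡ M + j
    toℕ-w = toℕ-clip w<

    u≢w : u-node j ≢ w-node j
    u≢w p = <⇒≢ (m<n+m j z<s) (trans (sym toℕ-u) (trans (cong toℕ p) toℕ-w))

    strip : ∀ {P Q : ℕ → Set} {a c} → (∀ {x} → Q x → x ≡ j ⊎ P x) → ¬ (a ≡ j × c ≡ M + j) →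
            Link (GateIf Q) a c → Link (GateIf P) a c
    strip f ne (root p q)   = root p q
    strip f ne (next p q r) = next p q r
    strip f ne (tip p q t)  = tip p q t
    strip f ne (gate p q (gateIf e a<m g)) with f g
    ... | inj₁ refl = ⊥-elim (ne (refl , e))
    ... | inj₂ h    = gate p q (gateIf e a<m h)

    module _ {G : Graph order} {P : ℕ → Set} (rep : Represents G (GateIf P)) where

      adj-gate : adj G (u-node j) (w-node j) ≡ true → P j
      adj-gate e with Equivalence.to (edges rep _ _) e
      ... | inj₁ l = let p = isOpen (link-shared l (subst (_< S) (sym toℕ-w) w<)) in subst P toℕ-u p
      ... | inj₂ l = ⊥-elim (<-asym (link-< l) (subst₂ _<_ (sym toℕ-u) (sym toℕ-w) (m<n+m j z<s)))

      gate-adj : P j → adj G (u-node j) (w-node j) ≡ true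
      gate-adj p = Equivalence.from (edges rep _ _) (inj₁ (subst₂ (Link _) (sym toℕ-u) (sym toℕ-w)
        (gate (m<n+m j z<s) w< (gateIf refl j<m p))))

      pair-of : ∀ {x y} → toℕ x ≡ j → toℕ y ≡ M + j → x ≡ u-node j × y ≡ w-node j
      pair-of p q = Finₚ.toℕ-injective (trans p (sym toℕ-u)) , Finₚ.toℕ-injective (trans q (sym toℕ-w))

      no-pair : ∀ {x y} → isPair (u-node j) (w-node j) x y ≡ false →
                ¬ (toℕ x ≡ j × toℕ y ≡ M + j) × ¬ (toℕ y ≡ j × toℕ x ≡ M + j)
      no-pair {x} {y} pr =
        (λ (p , q) → case trans (sym pr) (isPair⁺ _ _ x y (inj₁ (pair-of p q))) of λ ()) ,
        (λ (p , q) → let a , c = pair-of p q in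
          case trans (sym pr) (isPair⁺ _ _ x y (inj₂ (c , a))) of λ ())

      represents-insert : ∀ {Q : ℕ → Set} → (∀ {x} → P x → Q x) → Q j → (∀ {x} → Q x → x ≡ j ⊎ P x) →
                          Represents (setEdge true G (u-node j) (w-node j) u≢w) (GateIf Q)
      represents-insert {Q} P⇒Q qj Q⇒ = represents insert-edges
        where
        insert-edges : ∀ x y → adj (setEdge true G (u-node j) (w-node j) u≢w) x y ≡ true ⇔
                       (Link (GateIf Q) (toℕ x) (toℕ y) ⊎ Link (GateIf Q) (toℕ y) (toℕ x))
        insert-edges x y with isPair (u-node j) (w-node j) x y in pr
        ... | true = mk⇔ (λ _ → case isPair⁻ _ _ x y pr of λ where
                (inj₁ (refl , refl)) → inj₁ new
                (inj₂ (refl , refl)) → inj₂ new) (λ _ → refl)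
          where
          new : Link (GateIf Q) (toℕ (u-node j)) (toℕ (w-node j))
          new = subst₂ (Link _) (sym toℕ-u) (sym toℕ-w) (gate (m<n+m j z<s) w< (gateIf refl j<m qj))
        ... | false = mk⇔
                (λ e → case Equivalence.to (edges rep x y) e of λ where
                  (inj₁ l) → inj₁ (link-shift (gate-map P⇒Q) l)
                  (inj₂ l) → inj₂ (link-shift (gate-map P⇒Q) l))
                (λ where
                  (inj₁ l) → Equivalence.from (edges rep x y) (inj₁ (strip Q⇒ (proj₁ (no-pair pr)) l))
                  (inj₂ l) → Equivalence.from (edges rep x y) (inj₂ (strip Q⇒ (proj₂ (no-pair pr)) l)))

      represents-delete : ∀ {Q : ℕ → Set} → (∀ {x} → Q x → P x) → ¬ Q j → (∀ {x} → P x → x ≡ j ⊎ Q x) →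
                          Represents (setEdge false G (u-node j) (w-node j) u≢w) (GateIf Q)
      represents-delete {Q} Q⇒P ¬qj P⇒ = represents delete-edges
        where
        delete-edges : ∀ x y → adj (setEdge false G (u-node j) (w-node j) u≢w) x y ≡ true ⇔
                       (Link (GateIf Q) (toℕ x) (toℕ y) ⊎ Link (GateIf Q) (toℕ y) (toℕ x))
        delete-edges x y with isPair (u-node j) (w-node j) x y in pr
        ... | true = mk⇔ (λ ()) (λ l → ⊥-elim (case isPair⁻ _ _ x y pr of λ where
                (inj₁ (refl , refl)) → closed l
                (inj₂ (refl , refl)) → closed (Data.Sum.swap l)))
          where
          closed : ¬ (Link (GateIf Q) (toℕ (u-node j)) (toℕ (w-node j)) ⊎ Link (GateIf Q) (toℕ (w-node j)) (toℕ (u-node j)))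
          closed (inj₁ l) = let q = isOpen (link-shared l (subst (_< S) (sym toℕ-w) w<)) in ¬qj (subst Q toℕ-u q)
          closed (inj₂ l) = <-asym (link-< l) (subst₂ _<_ (sym toℕ-u) (sym toℕ-w) (m<n+m j z<s))
        ... | false = mk⇔
                (λ e → case Equivalence.to (edges rep x y) e of λ where
                  (inj₁ l) → inj₁ (strip P⇒ (proj₁ (no-pair pr)) l)
                  (inj₂ l) → inj₂ (strip P⇒ (proj₂ (no-pair pr)) l))
                (λ where
                  (inj₁ l) → Equivalence.from (edges rep x y) (inj₁ (link-shift (gate-map Q⇒P) l))
                  (inj₂ l) → Equivalence.from (edges rep x y) (inj₂ (link-shift (gate-map Q⇒P) l)))

  -- Gates exist only below `m`, so the predicates have to agree only there. This identifies the
  -- stage at which one loop ends with that at which the next one begins.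
  represents-cong : ∀ {G} {P Q : ℕ → Set} → (∀ {x} → x < m → P x → Q x) → (∀ {x} → x < m → Q x → P x) →
                    Represents G (GateIf P) → Represents G (GateIf Q)
  represents-cong f g rep = represents λ x y → mk⇔ (λ e → Data.Sum.map (there′ f) (there′ f) (Equivalence.to (edges rep x y) e))
                                    (λ l → Equivalence.from (edges rep x y) (Data.Sum.map (there′ g) (there′ g) l))
    where
    there′ : ∀ {P Q : ℕ → Set} → (∀ {x} → x < m → P x → Q x) → ∀ {x y} → Link (GateIf P) x y → Link (GateIf Q) x y
    there′ h = link-shift λ (gateIf a x<m p) → gateIf a x<m (h x<m p)

  module Phases (opened : ℕ → ℕ → Bool) where

    openOps closeOps : (τ c : ℕ) → c ≤ m → List (Operation order) → List (Operation order)
    openOps τ zero    _ ops = ops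
    openOps τ (suc c) p ops =
      if opened τ c then insert (u-node c) (w-node c) (u≢w p) ∷ openOps τ c (<⇒≤ p) ops
      else openOps τ c (<⇒≤ p) ops
    closeOps τ zero    _ ops = ops
    closeOps τ (suc c) p ops =
      if opened τ c then delete (u-node c) (w-node c) (u≢w p) ∷ closeOps τ c (<⇒≤ p) ops
      else closeOps τ c (<⇒≤ p) ops

    phaseOps : ℕ → List (Operation order)
    phaseOps zero    = []
    phaseOps (suc τ) = openOps τ m ≤-refl (query ∷ closeOps τ m ≤-refl (phaseOps τ))


    -- The open gates while the clauses below `c` are still to be treated. Both loops run downwards:
    -- opening has treated the clauses from `c` on, and closing has left open those below `c`.
    Opening Closing : (τ c : ℕ) → ℕ → Set
    Opening τ c x = c ≤ x × opened τ x ≡ true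
    Closing τ c x = x < c × opened τ x ≡ true

    All-open : ℕ → ℕ → Set
    All-open τ x = opened τ x ≡ true

    opening-step : ∀ {τ c G} (p : c < m) → opened τ c ≡ true → Represents G (GateIf (Opening τ (suc c))) →
                   Represents (setEdge true G (u-node c) (w-node c) (u≢w p)) (GateIf (Opening τ c))
    opening-step {τ} {c} p o rep = represents-insert p rep
      (λ (le , q) → <⇒≤ le , q) (≤-refl , o) λ {x} (le , q) → case c ≟ x of λ where
        (yes refl) → inj₁ refl
        (no c≢x)   → inj₂ (≤∧≢⇒< le c≢x , q)

    opening-skip : ∀ {τ c G} → opened τ c ≡ false → Represents G (GateIf (Opening τ (suc c))) →
                   Represents G (GateIf (Opening τ c))
    opening-skip {τ} {c} o = represents-cong (λ _ (le , q) → <⇒≤ le , q)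
      λ {x} _ (le , q) → case c ≟ x of λ where
        (yes refl) → case trans (sym o) q of λ ()
        (no c≢x)   → ≤∧≢⇒< le c≢x , q

    closing-step : ∀ {τ c G} (p : c < m) → Represents G (GateIf (Closing τ (suc c))) →
                   Represents (setEdge false G (u-node c) (w-node c) (u≢w p)) (GateIf (Closing τ c))
    closing-step {τ} {c} p rep = represents-delete p rep
      (λ (lth , q) → m<n⇒m<1+n lth , q) (λ (lth , _) → <-irrefl refl lth) λ {x} (lth , q) → case x ≟ c of λ where
        (yes x≡c) → inj₁ x≡c
        (no x≢c)  → inj₂ (≤∧≢⇒< (s≤s⁻¹ lth) x≢c , q)

    closing-skip : ∀ {τ c G} → opened τ c ≡ false → Represents G (GateIf (Closing τ (suc c))) →
                   Represents G (GateIf (Closing τ c))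
    closing-skip {τ} {c} o = represents-cong
      (λ {x} _ (lth , q) → case x ≟ c of λ where
        (yes refl) → case trans (sym o) q of λ ()
        (no x≢c)   → ≤∧≢⇒< (s≤s⁻¹ lth) x≢c , q)
      λ _ (lth , q) → m<n⇒m<1+n lth , q

    never-opening : ∀ {τ G} → Represents G (GateIf Never) → Represents G (GateIf (Opening τ m))
    never-opening = represents-cong (λ _ ()) λ x<m (le , _) → <⇒≱ x<m le

    opening-all : ∀ {τ G} → Represents G (GateIf (Opening τ 0)) → Represents G (GateIf (All-open τ))
    opening-all = represents-cong (λ _ (_ , q) → q) λ _ q → z≤n , q

    opening-closing : ∀ {τ G} → Represents G (GateIf (Opening τ 0)) → Represents G (GateIf (Closing τ m))
    opening-closing = represents-cong (λ x<m (_ , q) → x<m , q) λ _ (_ , q) → z≤n , q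

    closing-never : ∀ {τ G} → Represents G (GateIf (Closing τ 0)) → Represents G (GateIf Never)
    closing-never = represents-cong (λ _ ()) λ _ ()

    sparse : ∀ {G P} → Represents G (GateIf P) → Sparse 4 G
    sparse = represents-sparse M partner

    admissible-open : ∀ τ c p {ops G} → Represents G (GateIf (Opening τ c)) →
      (∀ {G′} → Represents G′ (GateIf (Opening τ 0)) → Admissible (Sparse 4) G′ ops) →
      Admissible (Sparse 4) G (openOps τ c p ops)
    admissible-open τ zero    p rep k = k rep
    admissible-open τ (suc c) p rep k with opened τ c in o
    ... | true  = insert (sparse rep) (¬-not λ e → <-irrefl refl (proj₁ (adj-gate p rep e)))
                    (admissible-open τ c (<⇒≤ p) (opening-step p o rep) k)
    ... | false = admissible-open τ c (<⇒≤ p) (opening-skip o rep) k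

    admissible-close : ∀ τ c p {ops G} → Represents G (GateIf (Closing τ c)) →
      (∀ {G′} → Represents G′ (GateIf (Closing τ 0)) → Admissible (Sparse 4) G′ ops) →
      Admissible (Sparse 4) G (closeOps τ c p ops)
    admissible-close τ zero    p rep k = k rep
    admissible-close τ (suc c) p rep k with opened τ c in o
    ... | true  = delete (sparse rep) (gate-adj p rep (≤-refl , o))
                    (admissible-close τ c (<⇒≤ p) (closing-step p rep) k)
    ... | false = admissible-close τ c (<⇒≤ p) (closing-skip o rep) k

    admissible : ∀ t {G} → Represents G (GateIf Never) → Admissible (Sparse 4) G (phaseOps t)
    admissible zero    rep = done (sparse rep)
    admissible (suc τ) rep = admissible-open τ m ≤-refl (never-opening rep) λ rep₁ →
      query (sparse rep₁) (admissible-close τ m ≤-refl (opening-closing rep₁) λ rep₂ →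
        admissible τ (closing-never rep₂))

    correct-open : ∀ {α} τ c p {ops G as} → Represents G (GateIf (Opening τ c)) →
      AnswersCorrect α G (openOps τ c p ops) as →
      ∃[ G′ ] (Represents G′ (GateIf (Opening τ 0)) × AnswersCorrect α G′ ops as)
    correct-open τ zero    p rep a = _ , rep , a
    correct-open τ (suc c) p rep a with opened τ c in o
    correct-open τ (suc c) p rep (insert a) | true = correct-open τ c (<⇒≤ p) (opening-step p o rep) a
    correct-open τ (suc c) p rep a | false = correct-open τ c (<⇒≤ p) (opening-skip o rep) a

    correct-close : ∀ {α} τ c p {ops G as} → Represents G (GateIf (Closing τ c)) →
      AnswersCorrect α G (closeOps τ c p ops) as →
      ∃[ G′ ] (Represents G′ (GateIf (Closing τ 0)) × AnswersCorrect α G′ ops as)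
    correct-close τ zero    p rep a = _ , rep , a
    correct-close τ (suc c) p rep a with opened τ c in o
    correct-close τ (suc c) p rep (delete a) | true = correct-close τ c (<⇒≤ p) (closing-step p rep) a
    correct-close τ (suc c) p rep a | false = correct-close τ c (<⇒≤ p) (closing-skip o rep) a

    -- Each phase begins and ends with all gates closed, so the induction continues with the graph
    -- that the phase leaves. The hypothesis speaks of an arbitrary graph, since `Represents` is all
    -- that is tracked through the updates.
    correct-answers : ∀ {α} thr (Good : ℕ → Set) t →
      (∀ τ G a → τ < t → Represents G (GateIf (All-open τ)) → (∀ D → IsDiameter G D → Approximates α D a) →
        (thr <ᵇ a) ≡ true ⇔ Good τ) →
      ∀ {G as} → Represents G (GateIf Never) → AnswersCorrect α G (phaseOps t) as →
      anyAbove thr as ≡ true ⇔ (∃[ τ ] (τ < t × Good τ))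
    correct-answers thr Good zero    h rep done = mk⇔ (λ ()) λ where (_ , () , _)
    correct-answers thr Good (suc τ) h rep ac with correct-open τ m ≤-refl (never-opening rep) ac
    ... | G₁ , rep₁ , query {a = a} {as} q ac₁ with correct-close τ m ≤-refl (opening-closing rep₁) ac₁
    ...   | G₂ , rep₂ , ac₂ with h τ G₁ a ≤-refl (opening-all rep₁) q
                              | correct-answers thr Good τ (λ σ G a σ< → h σ G a (m<n⇒m<1+n σ<)) (closing-never rep₂) ac₂
    ...     | now | later = mk⇔ to from
      where
      to : (thr <ᵇ a) ∨ anyAbove thr as ≡ true → ∃[ σ ] (σ < suc τ × Good σ)
      to e with ∨-split (thr <ᵇ a) e
      ... | inj₁ t = τ , ≤-refl , Equivalence.to now t
      ... | inj₂ t = let σ , σ< , g = Equivalence.to later t in σ , m<n⇒m<1+n σ< , g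
      from : ∃[ σ ] (σ < suc τ × Good σ) → (thr <ᵇ a) ∨ anyAbove thr as ≡ true
      from (σ , σ< , g) with σ ≟ τ
      ... | yes refl = cong (_∨ anyAbove thr as) (Equivalence.from now g)
      ... | no σ≢τ   = trans (cong ((thr <ᵇ a) ∨_) (Equivalence.from later (σ , ≤∧≢⇒< (s≤s⁻¹ σ<) σ≢τ , g))) (∨-zeroʳ _)

    updates-open : ∀ τ c p ops → updates (openOps τ c p ops) ≤ c + updates ops × queries (openOps τ c p ops) ≡ queries ops
    updates-open τ zero    p ops = ≤-refl , refl
    updates-open τ (suc c) p ops with opened τ c | updates-open τ c (<⇒≤ p) ops
    ... | true  | le , q = s≤s le , q
    ... | false | le , q = m≤n⇒m≤1+n le , q

    updates-close : ∀ τ c p ops → updates (closeOps τ c p ops) ≤ c + updates ops × queries (closeOps τ c p ops) ≡ queries ops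
    updates-close τ zero    p ops = ≤-refl , refl
    updates-close τ (suc c) p ops with opened τ c | updates-close τ c (<⇒≤ p) ops
    ... | true  | le , q = s≤s le , q
    ... | false | le , q = m≤n⇒m≤1+n le , q

    updates-phases : ∀ t → updates (phaseOps t) ≤ t * (m + m) × queries (phaseOps t) ≡ t
    updates-phases zero = ≤-refl , refl
    updates-phases (suc τ)
      with updates-open τ m ≤-refl (query ∷ closeOps τ m ≤-refl (phaseOps τ))
         | updates-close τ m ≤-refl (phaseOps τ) | updates-phases τ
    ... | u₁ , q₁ | u₂ , q₂ | u₃ , q₃ =
      ≤-trans u₁ (≤-trans (+-monoʳ-≤ m (≤-trans u₂ (+-monoʳ-≤ m u₃))) (≤-reflexive (sym (+-assoc m m _)))) ,
      trans q₁ (cong suc (trans q₂ q₃))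

-- The gap between the diameters of good and bad phases.

-- The stars r < H stand for the candidates a of the first block, the stars
-- H + r for the candidates b of the second block, and the star H + H is
-- joined to all shared vertices.  The shared vertices m and M + m are joined
-- to all candidates of the first and of the second block.

module Reduction (H ℓ′ m : ℕ) (fa fb : ℕ → ℕ → Bool) where

  R : ℕ
  R = suc (H + H)

  -- The shape is that of `tipExp`, with negation as a comparison to 0. The three summands are the
  -- three kinds of stars. Candidates of the first block have live legs only to the u side, those of
  -- the second only to the w side.
  T : ℕ → ℕ → ℕ
  T r s = bit (r <ᵇ H) * (bit (s <ᵇ suc m) * (bit (s ≡ᵇ m) + bit (fa r s)))
        + (bit (bit (r <ᵇ H) ≡ᵇ 0) * (bit (r <ᵇ H + H) *
             (bit (bit (s <ᵇ suc m) ≡ᵇ 0) * (bit (s ∸ suc m ≡ᵇ m) + bit (fb (r ∸ H) (s ∸ suc m)))))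
        + bit (r ≡ᵇ H + H))

  open Gates R ℓ′ m T public

  <⇒≢ᵇ : ∀ {x y} → x < y → (x ≡ᵇ y) ≡ false
  <⇒≢ᵇ {x} {y} p = ¬-not λ e → <⇒≢ p (≡ᵇ-true x y e)

  pos-or : ∀ x n b → 0 < bit (x ≡ᵇ n) + bit b → x ≡ n ⊎ b ≡ true
  pos-or x n b p with pos-+ (bit (x ≡ᵇ n)) p
  ... | inj₁ q = inj₁ (≡ᵇ-true x n (pos-bit _ q))
  ... | inj₂ q = inj₂ (pos-bit b q)

  or-pos : ∀ x n b → x ≡ n ⊎ b ≡ true → 0 < bit (x ≡ᵇ n) + bit b
  or-pos x n b (inj₁ e) = ≤-trans (bit-pos (true-≡ᵇ x n e)) (m≤m+n _ (bit b))
  or-pos x n b (inj₂ e) = ≤-trans (bit-pos e) (m≤n+m _ (bit (x ≡ᵇ n)))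

  T-A : ∀ {r s} → r < H → 0 < T r s ⇔ (s < M × (s ≡ m ⊎ fa r s ≡ true))
  T-A {r} {s} r< rewrite true-<ᵇ r< | <⇒≢ᵇ (≤-trans r< (m≤m+n H H)) | +-identityʳ (bit (s <ᵇ suc m) * (bit (s ≡ᵇ m) + bit (fa r s)))
                       | +-identityʳ (bit (s <ᵇ suc m) * (bit (s ≡ᵇ m) + bit (fa r s))) =
    mk⇔ (λ p → let x , y = pos-* (bit (s <ᵇ suc m)) p in <ᵇ-true s M (pos-bit _ x) , pos-or s m (fa r s) y)
        (λ (x , y) → *-pos (bit-pos (true-<ᵇ x)) (or-pos s m (fa r s) y))

  T-B : ∀ {r s} → H ≤ r → r < H + H → 0 < T r s ⇔ (M ≤ s × (s ∸ M ≡ m ⊎ fb (r ∸ H) (s ∸ M) ≡ true))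
  T-B {r} {s} H≤r r< rewrite false-<ᵇ r H H≤r | true-<ᵇ r< | <⇒≢ᵇ r<
    with s <ᵇ suc m in e
  ... | true = mk⇔ (λ ()) λ (x , _) → ⊥-elim (<⇒≱ (<ᵇ-true s M e) x)
  ... | false rewrite +-identityʳ (bit (s ∸ suc m ≡ᵇ m) + bit (fb (r ∸ H) (s ∸ suc m)))
                    | +-identityʳ (bit (s ∸ suc m ≡ᵇ m) + bit (fb (r ∸ H) (s ∸ suc m)))
                    | +-identityʳ (bit (s ∸ suc m ≡ᵇ m) + bit (fb (r ∸ H) (s ∸ suc m)))
                    | +-identityʳ (bit (s ∸ suc m ≡ᵇ m) + bit (fb (r ∸ H) (s ∸ suc m))) =
    mk⇔ (λ p → <ᵇ-false s M e , pos-or (s ∸ M) m _ p) λ (_ , y) → or-pos (s ∸ M) m _ y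

  T-Z : ∀ s → 0 < T (H + H) s
  T-Z s = ≤-trans (bit-pos (true-≡ᵇ (H + H) (H + H) refl))
    (≤-trans (m≤n+m _ (bit (bit (H + H <ᵇ H) ≡ᵇ 0) * (bit (H + H <ᵇ H + H) *
                (bit (bit (s <ᵇ suc m) ≡ᵇ 0) * (bit (s ∸ suc m ≡ᵇ m) + bit (fb (H + H ∸ H) (s ∸ suc m)))))))
             (m≤n+m _ (bit (H + H <ᵇ H) * (bit (s <ᵇ suc m) * (bit (s ≡ᵇ m) + bit (fa (H + H) s))))))

  data Class (r : ℕ) : Set where
    first  : r < H → Class r
    second : H ≤ r → r < H + H → Class r
    hubStar : r ≡ H + H → Class r

  class : ∀ {r} → r < R → Class r
  class {r} r< with r <? H | r <? H + H
  ... | yes p | _     = first p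
  ... | no ¬p | yes q = second (≮⇒≥ ¬p) q
  ... | no _  | no ¬q = hubStar (≤-antisym (s≤s⁻¹ r<) (≮⇒≥ ¬q))

  m<S : m < S
  m<S = m≤m+n M M

  M+m<S : M + m < S
  M+m<S = +-monoʳ-< M ≤-refl

  T-A-hub : ∀ {r} → r < H → 0 < T r m
  T-A-hub r< = Equivalence.from (T-A r<) (≤-refl , inj₁ refl)

  T-B-hub : ∀ {r} → H ≤ r → r < H + H → 0 < T r (M + m)
  T-B-hub p q = Equivalence.from (T-B p q) (m≤m+n M m , inj₁ (m+n∸m≡n M m))

  attached : ∀ r → r < R → ∃[ s ] (s < S × 0 < T r s)
  attached r r< with class r<
  ... | first p    = m , m<S , T-A-hub p
  ... | second p q = M + m , M+m<S , T-B-hub p q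
  ... | hubStar refl = 0 , z<s , T-Z 0

  module _ (opened : ℕ → Bool) where

    Conflict : ℕ → ℕ → ℕ → Set
    Conflict a b j = fa a j ≡ true × fb b j ≡ true × opened j ≡ true

    Good : Set
    Good = ∃[ a ] (a < H × ∃[ b ] (b < H × (∀ {j} → j < m → ¬ Conflict a b j)))

    conflict? : ∀ a b j → Dec (Conflict a b j)
    conflict? a b j = (fa a j Data.Bool.≟ true) ×-dec ((fb b j Data.Bool.≟ true) ×-dec (opened j Data.Bool.≟ true))

    good? : Dec Good
    good? = anyUpTo? (λ a → anyUpTo? (λ b → allUpTo? (λ j → ¬? (conflict? a b j)) m) H) H

    Gate : ℕ → ℕ → Set
    Gate = GateIf (λ j → opened j ≡ true)

    module _ {G : Graph order} (rep : Represents G Gate) where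

      open Distances rep {H + H} ≤-refl (λ s _ → T-Z s) attached public

      -- The purpose of the extra shared vertices and of the hub: two stars of the same block meet
      -- in `m` or in `M + m`, and the hub meets any star in whatever that star is attached to. Only
      -- a pair from different blocks needs an open gate, which a bad phase provides as a conflict.
      bad-near : ¬ Good → ∀ u v → Near G u v far
      bad-near bad = near-upper λ r r′ r< r′< → common r< r′< (class r<) (class r′<)
        where
        across : ∀ {r r′} → r < H → H ≤ r′ → r′ < H + H → ∃[ j ] (j < m × Conflict r (r′ ∸ H) j)
        across {r} {r′} p q q′ with anyUpTo? (conflict? r (r′ ∸ H)) m
        ... | yes c = c
        ... | no ¬c = ⊥-elim (bad (r , p , r′ ∸ H ,
                +-cancelˡ-< H _ _ (subst (_< H + H) (sym (m+[n∸m]≡n q)) q′) ,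
                λ j< c → ¬c (_ , j< , c)))
        cross : ∀ {r r′} → r < H → H ≤ r′ → r′ < H + H → Common Gate r r′
        cross {r} {r′} p q q′ with across p q q′
        ... | j , j< , x , y , o =
          j , M + j , u< j< , w< j< , Equivalence.from (T-A p) (m<n⇒m<1+n j< , inj₂ x) ,
          Equivalence.from (T-B q q′) (m≤m+n M j , inj₂ (subst (λ i → fb (r′ ∸ H) i ≡ true) (sym (m+n∸m≡n M j)) y)) ,
          inj₂ (inj₁ (gate (m<n+m j z<s) (w< j<) (gateIf refl j< o)))
        common : ∀ {r r′} → r < R → r′ < R → Class r → Class r′ → Common Gate r r′
        common r< r′< (first p)    (first q)    = m , m , m<S , m<S , T-A-hub p , T-A-hub q , inj₁ refl
        common r< r′< (second p p′) (second q q′) = M + m , M + m , M+m<S , M+m<S , T-B-hub p p′ , T-B-hub q q′ , inj₁ refl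
        common r< r′< (first p)    (second q q′) = cross p q q′
        common r< r′< (second q q′) (first p)    = let s , s′ , s< , s′< , t , t′ , c = cross p q q′ in
          s′ , s , s′< , s< , t′ , t , (case c of λ where
            (inj₁ e)        → inj₁ (sym e)
            (inj₂ (inj₁ l)) → inj₂ (inj₂ l)
            (inj₂ (inj₂ l)) → inj₂ (inj₁ l))
        common r< r′< (hubStar refl) c′       = let s , s< , t = attached _ r′< in s , s , s< , s< , T-Z s , t , inj₁ refl
        common r< r′< c        (hubStar refl) = let s , s< , t = attached _ r< in s , s , s< , s< , t , T-Z s , inj₁ refl

      module _ {a b : ℕ} (a< : a < H) (b< : b < H) (ok : ∀ {j} → j < m → ¬ Conflict a b j) where

        -- Levels 0 to 6, from the dead ends of star `a` to those of star `H + b`, with the two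
        -- centres at 1 and 5. A shared vertex has level 2 if star `a` reaches it by a live leg, or
        -- by a live leg and an open gate, and level 4 otherwise. All other stars, the hub included,
        -- have level 3, which is compatible with both.
        mu lev dead : ℕ → ℕ
        nu : ℕ → ℕ → ℕ
        mu r = if r ≡ᵇ a then 1 else if r ≡ᵇ H + b then 5 else 3
        dead r = if r ≡ᵇ a then 0 else if r ≡ᵇ H + b then 6 else 3
        lev s = if s <ᵇ M then (if (s ≡ᵇ m) ∨ fa a s then 2 else 4)
                else (if (s ∸ M <ᵇ m) ∧ (opened (s ∸ M) ∧ fa a (s ∸ M)) then 2 else 4)
        nu r s = if 0 <ᵇ T r s then lev s else dead r

        open Potential lev mu nu

        lev-u : ∀ {s} → s < M → lev s ≡ (if (s ≡ᵇ m) ∨ fa a s then 2 else 4)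
        lev-u s< rewrite true-<ᵇ s< = refl

        lev-w : ∀ {s} → M ≤ s → lev s ≡ (if (s ∸ M <ᵇ m) ∧ (opened (s ∸ M) ∧ fa a (s ∸ M)) then 2 else 4)
        lev-w {s} s≥ rewrite false-<ᵇ s M s≥ = refl

        lev-2-or-4 : ∀ s → lev s ≡ 2 ⊎ lev s ≡ 4
        lev-2-or-4 s with s <ᵇ M
        lev-2-or-4 s | true with (s ≡ᵇ m) ∨ fa a s
        ... | true  = inj₁ refl
        ... | false = inj₂ refl
        lev-2-or-4 s | false with (s ∸ M <ᵇ m) ∧ (opened (s ∸ M) ∧ fa a (s ∸ M))
        ... | true  = inj₁ refl
        ... | false = inj₂ refl

        gate-lev : ∀ {s s′} → Gate s s′ → lev s ≡ lev s′
        gate-lev {s} (gateIf refl s<m o)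
          rewrite lev-u (m<n⇒m<1+n s<m) | lev-w (m≤m+n M s) | m+n∸m≡n M s | true-<ᵇ s<m | o | <⇒≢ᵇ s<m = refl

        mu-a : mu a ≡ 1
        mu-a rewrite true-≡ᵇ a a refl = refl

        dead-a : dead a ≡ 0
        dead-a rewrite true-≡ᵇ a a refl = refl

        Hb≢a : (H + b ≡ᵇ a) ≡ false
        Hb≢a = ¬-not λ e → <⇒≱ a< (subst (H ≤_) (≡ᵇ-true (H + b) a e) (m≤m+n H b))

        mu-b : mu (H + b) ≡ 5
        mu-b rewrite Hb≢a | true-≡ᵇ (H + b) (H + b) refl = refl

        dead-b : dead (H + b) ≡ 6
        dead-b rewrite Hb≢a | true-≡ᵇ (H + b) (H + b) refl = refl

        nu-tip : ∀ {r s} → 0 < T r s → nu r s ≡ lev s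
        nu-tip t rewrite true-<ᵇ t = refl

        nu-dead : ∀ {r s} → ¬ (0 < T r s) → nu r s ≡ dead r
        nu-dead {r} {s} ¬t rewrite ¬-not (¬t ∘ <ᵇ-true 0 (T r s)) = refl

        close : ∀ {x y x′ y′} → x ≡ x′ → y ≡ y′ → Close x′ y′ → Close x y
        close refl refl c = c

        lev-A : ∀ {s} → 0 < T a s → lev s ≡ 2
        lev-A {s} t with Equivalence.to (T-A {a} {s} a<) t
        ... | s< , inj₁ refl rewrite lev-u s< | true-≡ᵇ m m refl = refl
        ... | s< , inj₂ f rewrite lev-u s< | f | ∨-zeroʳ (s ≡ᵇ m) = refl

        Hb< : H + b < H + H
        Hb< = +-monoʳ-< H b<

        -- Here the absence of conflicts enters: a live leg of star `H + b` to a vertex of level 2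
        -- would belong to a clause with an open gate that `a` does not satisfy either. The vertex
        -- `M + m`, to which the star is always attached, has no gate.
        lev-B : ∀ {s} → 0 < T (H + b) s → lev s ≡ 4
        lev-B {s} t with Equivalence.to (T-B {H + b} {s} (m≤m+n H b) Hb<) t
        ... | s≥ , c = trans (lev-w s≥) (cong (λ z → if z then 2 else 4) (¬-not (λ e → no-conflict (split e) c)))
          where
          split : (s ∸ M <ᵇ m) ∧ (opened (s ∸ M) ∧ fa a (s ∸ M)) ≡ true →
                  s ∸ M < m × opened (s ∸ M) ≡ true × fa a (s ∸ M) ≡ true
          split e with Equivalence.to Data.Bool.Properties.T-∧ (Equivalence.from T-≡ e)
          ... | x , y with Equivalence.to (Data.Bool.Properties.T-∧ {opened (s ∸ M)}) y
          ...   | y₁ , y₂ = <ᵇ⇒< _ _ x , Equivalence.to T-≡ y₁ , Equivalence.to T-≡ y₂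
          no-conflict : s ∸ M < m × opened (s ∸ M) ≡ true × fa a (s ∸ M) ≡ true →
                        ¬ (s ∸ M ≡ m ⊎ fb (H + b ∸ H) (s ∸ M) ≡ true)
          no-conflict (lth , o , x) (inj₁ e) = <-irrefl e lth
          no-conflict (lth , o , x) (inj₂ y) =
            ok lth (x , subst (λ i → fb i (s ∸ M) ≡ true) (m+n∸m≡n H b) y , o)

        mu-else : ∀ {r} → r ≢ a → r ≢ H + b → mu r ≡ 3
        mu-else {r} ¬a ¬b rewrite ¬-not (¬a ∘ ≡ᵇ-true r a) | ¬-not (¬b ∘ ≡ᵇ-true r (H + b)) = refl

        dead-else : ∀ {r} → r ≢ a → r ≢ H + b → dead r ≡ 3
        dead-else {r} ¬a ¬b rewrite ¬-not (¬a ∘ ≡ᵇ-true r a) | ¬-not (¬b ∘ ≡ᵇ-true r (H + b)) = refl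

        mu-nu : ∀ r s → r < R → s < S → Close (mu r) (nu r s)
        mu-nu r s r< s< with 0 <? T r s | r ≟ a | r ≟ H + b
        ... | yes t | yes refl | _ = close mu-a (trans (nu-tip {r} {s} t) (lev-A {s} t)) (m≤m+n 1 2 , ≤-refl)
        ... | no ¬t | yes refl | _ = close mu-a (trans (nu-dead {r} {s} ¬t) dead-a) (≤-refl , z≤n)
        ... | yes t | no _ | yes refl = close mu-b (trans (nu-tip {r} {s} t) (lev-B {s} t)) (≤-refl , m≤m+n 4 2)
        ... | no ¬t | no _ | yes refl = close mu-b (trans (nu-dead {r} {s} ¬t) dead-b) (m≤m+n 5 2 , ≤-refl)
        ... | no ¬t | no ¬a | no ¬b = close (mu-else ¬a ¬b) (trans (nu-dead {r} {s} ¬t) (dead-else ¬a ¬b)) (n≤1+n _ , n≤1+n _)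
        ... | yes t | no ¬a | no ¬b with lev-2-or-4 s
        ...   | inj₁ e = close (mu-else ¬a ¬b) (trans (nu-tip {r} {s} t) e) (≤-refl , m≤m+n 2 2)
        ...   | inj₂ e = close (mu-else ¬a ¬b) (trans (nu-tip {r} {s} t) e) (m≤m+n 3 2 , ≤-refl)

        -- Since the first block never attaches to the w side nor the second to the u side, both
        -- candidates have a dead end whatever the formula. These are the ends between which the
        -- distance is measured.
        dead-end-a : ¬ (0 < T a (M + m))
        dead-end-a t = <⇒≱ (proj₁ (Equivalence.to (T-A {a} {M + m} a<) t)) (m≤m+n M m)

        dead-end-b : ¬ (0 < T (H + b) 0)
        dead-end-b t = <⇒≱ z<s (proj₁ (Equivalence.to (T-B {H + b} {0} (m≤m+n H b) Hb<) t))

        -- The ends of the two dead legs have potentials `1 * 5 + ℓ * 6` and `1 * 1 + ℓ * 0`, as a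
        -- leg stops one edge short of its outer level. They differ by 6 ℓ + 4; the 3 that is
        -- dropped is slack.
        good-diameter : ∀ {D} → IsDiameter G D → 6 * ℓ < D
        good-diameter {D} dia = +-cancelʳ-≤ 1 _ _ (begin
          suc (6 * ℓ) + 1          ≤⟨ m≤m+n _ 3 ⟩
          suc (6 * ℓ) + 1 + 3      ≡⟨ lem ℓ ⟩
          1 * 5 + ℓ * 6            ≡⟨ cong₂ (λ x y → x * 5 + ℓ * y) one (trans (nu-dead {H + b} {0} dead-end-b) dead-b) ⟨
          (ℓ ∸ ℓ′) * 5 + ℓ * nu (H + b) 0 ≡⟨ cong (λ x → (ℓ ∸ ℓ′) * x + ℓ * nu (H + b) 0) mu-b ⟨
          (ℓ ∸ ℓ′) * mu (H + b) + ℓ * nu (H + b) 0 ≡⟨ Φ-leg {H + b} {0} z<s ≤-refl ⟨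
          Φ (leg (H + b) 0 ℓ′)     ≡⟨ cong Φ (Finₚ.toℕ-fromℕ< end<) ⟨
          Φ (toℕ (fromℕ< end<))    ≤⟨ lipschitz-diameter G (λ u → Φ (toℕ u))
                                        (lipschitz gate-lev (λ {r} {s} t _ _ → nu-tip {r} {s} t) mu-nu rep)
                                        (fromℕ< beg<) (fromℕ< end<) dia ⟩
          D + Φ (toℕ (fromℕ< beg<)) ≡⟨ cong (λ z → D + Φ z) (Finₚ.toℕ-fromℕ< beg<) ⟩
          D + Φ (leg a (M + m) ℓ′) ≡⟨ cong (D +_) (Φ-leg {a} {M + m} M+m<S ≤-refl) ⟩
          D + ((ℓ ∸ ℓ′) * mu a + ℓ * nu a (M + m)) ≡⟨ cong₂ (λ x y → D + (x * mu a + ℓ * y)) one (trans (nu-dead {a} {M + m} dead-end-a) dead-a) ⟩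
          D + (1 * mu a + ℓ * 0)   ≡⟨ cong₂ (λ x y → D + (1 * x + y)) mu-a (*-zeroʳ ℓ) ⟩
          D + 1                    ∎)
          where
          open ≤-Reasoning
          end< : leg (H + b) 0 ℓ′ < order
          end< = leg< (m<n⇒m<1+n Hb<) z<s ≤-refl
          beg< : leg a (M + m) ℓ′ < order
          beg< = leg< (m<n⇒m<1+n (≤-trans a< (m≤m+n H H))) M+m<S ≤-refl
          one : ℓ ∸ ℓ′ ≡ 1
          one = m+n∸n≡m 1 ℓ′
          lem : ∀ l → suc (6 * l) + 1 + 3 ≡ 1 * 5 + l * 6
          lem = solve-∀

      -- In the bad case the diameter is at most 4ℓ + 3, in the good case it
      -- exceeds 6ℓ; α is assumed to tell them apart.

      decides : ∀ {α} → (∀ D D̂ → Approximates α D D̂ → D ≤ far → D̂ ≤ 6 * ℓ) →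
                ∀ a → (∀ D → IsDiameter G D → Approximates α D a) → (6 * ℓ <ᵇ a) ≡ true ⇔ Good
      decides gap a apx = mk⇔ to from
        where
        diam = diameter-exists G connected
        to : (6 * ℓ <ᵇ a) ≡ true → Good
        to e with good?
        ... | yes g = g
        ... | no ¬g = ⊥-elim (<⇒≱ (<ᵇ-true (6 * ℓ) a e)
                (gap _ a (apx _ (proj₂ diam)) (diameter-≤ G (bad-near ¬g) (proj₂ diam))))
        from : Good → (6 * ℓ <ᵇ a) ≡ true
        from (_ , a< , _ , b< , ok) =
          true-<ᵇ (≤-trans (good-diameter a< b< ok (proj₂ diam)) (proj₁ (apx _ (proj₂ diam))))


-- Formulas and assignments as numbers.

horner : (ℕ → ℕ) → (W c k : ℕ) → ℕ
horner f W c zero    = 0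
horner f W c (suc k) = f c + W * horner f W (suc c) k

horner-< : ∀ f W c k → (∀ i → i < c + k → f i < W) → horner f W c k < W ^ k
horner-< f W c zero    f< = z<s
horner-< f W c (suc k) f< = begin-strict
  f c + W * horner f W (suc c) k  <⟨ +-monoˡ-< _ (f< c (m<m+n c z<s)) ⟩
  W + W * horner f W (suc c) k    ≡⟨ *-suc W _ ⟨
  W * suc (horner f W (suc c) k)  ≤⟨ *-monoʳ-≤ W (horner-< f W (suc c) k λ i i< → f< i (subst (i <_) (sym (+-suc c k)) i<)) ⟩
  W * W ^ k                       ∎
  where open ≤-Reasoning

horner-digit : ∀ f W .{{_ : NonZero W}} c k i → (∀ i → i < c + k → f i < W) → i < k →
               (_/_ (horner f W c k) (W ^ i) {{m^n≢0 W i}}) % W ≡ f (c + i)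
horner-digit f W c (suc k) zero f< i< = begin
  (f c + W * horner f W (suc c) k) / 1 % W  ≡⟨ cong (_% W) (n/1≡n _) ⟩
  (f c + W * horner f W (suc c) k) % W      ≡⟨ cong (λ z → (f c + z) % W) (*-comm W _) ⟩
  (f c + horner f W (suc c) k * W) % W      ≡⟨ [m+kn]%n≡m%n (f c) (horner f W (suc c) k) W ⟩
  f c % W                                   ≡⟨ m<n⇒m%n≡m (f< c (m<m+n c z<s)) ⟩
  f c                                       ≡⟨ cong f (sym (+-identityʳ c)) ⟩
  f (c + 0)                                 ∎
  where open ≡-Reasoning
horner-digit f W c (suc k) (suc i) f< i< = begin
  X / (W * W ^ i) % W     ≡⟨ cong (_% W) (m/n/o≡m/[n*o] X W (W ^ i)) ⟨
  X / W / W ^ i % W       ≡⟨ cong (λ z → z / W ^ i % W) X/W ⟩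
  Y / W ^ i % W           ≡⟨ horner-digit f W (suc c) k i (λ i i< → f< i (subst (i <_) (sym (+-suc c k)) i<)) (s≤s⁻¹ i<) ⟩
  f (suc c + i)           ≡⟨ cong f (+-suc c i) ⟨
  f (c + suc i)           ∎
  where
  open ≡-Reasoning
  instance
    _ = m^n≢0 W i
    _ = m^n≢0 W (suc i)
  Y = horner f W (suc c) k
  X = f c + W * Y
  X/W : X / W ≡ Y
  X/W = trans (cong (_/ W) (trans (+-comm (f c) _) (cong (_+ f c) (*-comm W Y))))
              (proj₁ (divMod-unique Y (f c) W (f< c (m<m+n c z<s))))

mod-% : ∀ x y .{{_ : NonZero y}} → ⟦ mod ⟧ x y ≡ x % y
mod-% x (suc y) = refl

contents-++ˡ : ∀ xs {ys i} → i < length xs → contents (xs ++ ys) i ≡ contents xs i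
contents-++ˡ (x ∷ xs) {i = zero}  _  = refl
contents-++ˡ (x ∷ xs) {i = suc i} i< = contents-++ˡ xs (s≤s⁻¹ i<)

contents-++ʳ : ∀ xs {ys} i → contents (xs ++ ys) (length xs + i) ≡ contents ys i
contents-++ʳ []       i = refl
contents-++ʳ (x ∷ xs) i = contents-++ʳ xs i

contents-toList : ∀ {A : Set} (f : A → ℕ) {K} (C : Vec A K) l →
                  contents (map f (toList C)) (toℕ l) ≡ f (lookup C l)
contents-toList f (x ∷ C) zero    = refl
contents-toList f (x ∷ C) (suc l) = contents-toList f C l

contents-< : ∀ {b} → 0 < b → ∀ xs → All (_< b) xs → ∀ i → contents xs i < b
contents-< 0<b []       _          i       = 0<b
contents-< 0<b (x ∷ xs) (p ∷ _)  zero    = p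
contents-< 0<b (x ∷ xs) (_ ∷ ps) (suc i) = contents-< 0<b xs ps i

double≤2^ : ∀ n .{{_ : NonZero n}} → 2 * n ≤ 2 ^ n
double≤2^ (suc n) = *-monoʳ-≤ 2 (n<2^n n)

code-/ : ∀ {N} (l : Literal N) → literalCode l / 2 ≡ toℕ (proj₁ l)
code-/ (x , b) = trans (cong (λ z → (z + bit b) / 2) (*-comm 2 (toℕ x))) (proj₁ (divMod-unique (toℕ x) (bit b) 2 (s≤s (bit≤1 b))))

code-% : ∀ {N} (l : Literal N) → literalCode l % 2 ≡ bit (proj₂ l)
code-% (x , b) = trans (cong (λ z → (z + bit b) % 2) (*-comm 2 (toℕ x))) (proj₂ (divMod-unique (toℕ x) (bit b) 2 (s≤s (bit≤1 b))))

code-< : ∀ {N} (l : Literal N) → literalCode l < 2 * N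
code-< {N} (x , b) = begin-strict
  2 * toℕ x + bit b   ≤⟨ +-monoʳ-≤ (2 * toℕ x) (bit≤1 b) ⟩
  2 * toℕ x + 1       <⟨ +-monoʳ-< (2 * toℕ x) ≤-refl ⟩
  2 * toℕ x + 2       ≡⟨ +-comm (2 * toℕ x) 2 ⟩
  2 + 2 * toℕ x       ≡⟨ *-suc 2 (toℕ x) ⟨
  2 * suc (toℕ x)     ≤⟨ *-monoʳ-≤ 2 (Finₚ.toℕ<n x) ⟩
  2 * N               ∎
  where open ≤-Reasoning

bit-injective : ∀ {x y} → bit x ≡ bit y → x ≡ y
bit-injective {true}  {true}  _ = refl
bit-injective {false} {false} _ = refl

codes : ∀ {K N} → List (Clause K N) → List ℕ
codes = concatMap (λ C → map literalCode (toList C))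

length-codes : ∀ {K N} (φ : List (Clause K N)) → length (codes φ) ≡ length φ * K
length-codes {K} φ = length-concatMap _ K φ λ C → trans (Listₚ.length-map literalCode (toList C)) (Vecₚ.length-toList C)

codes-< : ∀ {K N} (φ : List (Clause K N)) → All (_< 2 * N) (codes φ)
codes-< []      = []
codes-< (C ∷ φ) = Allₚ.++⁺ (Allₚ.map⁺ (All.universal code-< (toList C))) (codes-< φ)

AtIndex : ∀ {K N} → List (Clause K N) → ℕ → Clause K N → Set
AtIndex {K} φ j C = ∀ (l : Fin K) → contents (codes φ) (j * K + toℕ l) ≡ literalCode (lookup C l)

at-zero : ∀ {K N} (C : Clause K N) φ → AtIndex (C ∷ φ) 0 C
at-zero {K} C φ l = trans
  (contents-++ˡ (map literalCode (toList C)) (subst (toℕ l <_) (sym len) (Finₚ.toℕ<n l)))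
  (contents-toList literalCode C l)
  where
  len : length (map literalCode (toList C)) ≡ K
  len = trans (Listₚ.length-map literalCode (toList C)) (Vecₚ.length-toList C)

at-suc : ∀ {K N} (C D : Clause K N) φ j → AtIndex φ j D → AtIndex (C ∷ φ) (suc j) D
at-suc {K} C D φ j at l = trans
  (cong (contents (codes (C ∷ φ))) (trans (+-assoc K (j * K) (toℕ l)) (cong (_+ (j * K + toℕ l)) (sym len))))
  (trans (contents-++ʳ (map literalCode (toList C)) (j * K + toℕ l)) (at l))
  where
  len : length (map literalCode (toList C)) ≡ K
  len = trans (Listₚ.length-map literalCode (toList C)) (Vecₚ.length-toList C)

clause-at : ∀ {K N} (φ : List (Clause K N)) j → j < length φ → ∃[ C ] (C ∈ φ × AtIndex φ j C)
clause-at (C ∷ φ) zero    _  = C , here refl , at-zero C φ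
clause-at (C ∷ φ) (suc j) j< with clause-at φ j (s≤s⁻¹ j<)
... | D , D∈ , at = D , there D∈ , at-suc C D φ j at

index-of : ∀ {K N} (φ : List (Clause K N)) {C} → C ∈ φ → ∃[ j ] (j < length φ × AtIndex φ j C)
index-of (C ∷ φ) (here refl) = 0 , z<s , at-zero C φ
index-of (C ∷ φ) {D} (there D∈) with index-of φ D∈
... | j , j< , at = suc j , s≤s j< , at-suc C D φ j at

-- In the number F, made of digits in base 2 ^ N, the digit j K + l is the
-- code of literal l of clause j.

codeAt : (F N i : ℕ) → ℕ
codeAt F N i = ⟦ mod ⟧ (⟦ shr ⟧ F (N * i)) (2 ^ N)

-- Does x, read as an assignment to the variables lo, …, hi − 1, satisfy the
-- literal with code c?

hit : (x lo hi c : ℕ) → ℕ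
hit x lo hi c = bit (bit (c / 2 <ᵇ lo) ≡ᵇ 0) * (bit (c / 2 <ᵇ hi) *
                bit ((⟦ shr ⟧ x (c / 2 ∸ lo)) % 2 ≡ᵇ c % 2))

falsified : (F N K x lo hi j : ℕ) → Bool
falsified F N K x lo hi j = sumTo K (λ l → hit x lo hi (codeAt F N (j * K + l))) ≡ᵇ 0

module Formula {K N : ℕ} .{{_ : NonZero N}} (φ : List (Clause K N)) where

  F m : ℕ
  m = length φ
  F = horner (contents (codes φ)) (2 ^ N) 0 (m * K)

  -- Codes are below `2 * N`, hence below `2 ^ N`. With this wasteful base a digit is extracted by a
  -- shift and a remainder, and `F` still has at most `N * (m * K)` bits.
  contents<W : ∀ i → contents (codes φ) i < 2 ^ N
  contents<W i = ≤-trans (contents-< (≤-trans (>-nonZero⁻¹ N) (m≤m+n N _)) (codes φ) (codes-< φ) i) (double≤2^ N)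

  codeAt-F : ∀ i → i < m * K → codeAt F N i ≡ contents (codes φ) i
  codeAt-F i i< = begin
    ⟦ mod ⟧ (F / 2 ^ (N * i)) (2 ^ N)  ≡⟨ mod-% (F / 2 ^ (N * i)) (2 ^ N) ⟩
    (F / 2 ^ (N * i)) % 2 ^ N          ≡⟨ cong (_% 2 ^ N) (/-congʳ {m = F} (sym (^-*-assoc 2 N i))) ⟩
    (F / (2 ^ N) ^ i) % 2 ^ N          ≡⟨ horner-digit (contents (codes φ)) (2 ^ N) 0 (m * K) i (λ i _ → contents<W i) i< ⟩
    contents (codes φ) i               ∎
    where
    open ≡-Reasoning
    instance
      _ = m^n≢0 2 N
      _ = m^n≢0 2 (N * i)
      _ = m^n≢0 (2 ^ N) i

  Encodes : (x lo hi : ℕ) → (Fin N → Bool) → Set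
  Encodes x lo hi σ = ∀ v → lo ≤ toℕ v → toℕ v < hi → (⟦ shr ⟧ x (toℕ v ∸ lo)) % 2 ≡ bit (σ v)

  module _ {x lo hi σ} (enc : Encodes x lo hi σ) {j C} (j< : j < m) (at : AtIndex φ j C) where

    code≡ : ∀ l → codeAt F N (j * K + toℕ l) ≡ literalCode (lookup C l)
    code≡ l = trans (codeAt-F _ (index< (Finₚ.toℕ<n l))) (at l)
      where
      index< : ∀ {l} → l < K → j * K + l < m * K
      index< l< = ≤-trans (+-monoʳ-< (j * K) l<) (≤-trans (≤-reflexive (+-comm (j * K) K)) (*-monoˡ-≤ K j<))

    hit-true : ∀ l → 0 < hit x lo hi (literalCode (lookup C l)) → σ (proj₁ (lookup C l)) ≡ proj₂ (lookup C l)
    hit-true l p with lookup C l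
    ... | ltr rewrite code-/ ltr | code-% ltr with pos-* (bit (bit (toℕ (proj₁ ltr) <ᵇ lo) ≡ᵇ 0)) p
    ...   | p₁ , q with pos-* (bit (toℕ (proj₁ ltr) <ᵇ hi)) q
    ...     | p₂ , p₃ = bit-injective (trans (sym (enc (proj₁ ltr) lo≤ (<ᵇ-true _ hi (pos-bit _ p₂)))) (≡ᵇ-true _ _ (pos-bit _ p₃)))
      where
      bit-zero : ∀ b → bit b ≡ 0 → b ≡ false
      bit-zero false _ = refl
      lo≤ : lo ≤ toℕ (proj₁ ltr)
      lo≤ = <ᵇ-false (toℕ (proj₁ ltr)) lo (bit-zero _ (≡ᵇ-true (bit (toℕ (proj₁ ltr) <ᵇ lo)) 0 (pos-bit _ p₁)))

    true-hit : ∀ l → lo ≤ toℕ (proj₁ (lookup C l)) → toℕ (proj₁ (lookup C l)) < hi →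
               σ (proj₁ (lookup C l)) ≡ proj₂ (lookup C l) → 0 < hit x lo hi (literalCode (lookup C l))
    true-hit l lo≤ <hi e with lookup C l
    ... | ltr rewrite code-/ ltr | code-% ltr | false-<ᵇ (toℕ (proj₁ ltr)) lo lo≤ | true-<ᵇ <hi | enc (proj₁ ltr) lo≤ <hi | e =
      *-pos {1} z<s (*-pos {1} z<s (bit-pos (true-≡ᵇ (bit (proj₂ ltr)) _ refl)))

    falsified-false : falsified F N K x lo hi j ≡ false → Satisfies σ C
    falsified-false e with sumTo-pos K {λ l → hit x lo hi (codeAt F N (j * K + l))} (n≢0⇒n>0 λ z → case trans (sym e) (true-≡ᵇ _ 0 z) of λ ())
    ... | l , l< , p = VAny.map id (fromLookup C l′ (hit-true l′ (subst (λ c → 0 < hit x lo hi c) (trans (cong (λ z → codeAt F N (j * K + z)) (sym (Finₚ.toℕ-fromℕ< l<))) (code≡ l′)) p)))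
      where
      l′ = fromℕ< l<
      fromLookup : ∀ {n} (D : Vec (Literal N) n) i → σ (proj₁ (lookup D i)) ≡ proj₂ (lookup D i) →
                   VAny.Any (λ l → σ (proj₁ l) ≡ proj₂ l) D
      fromLookup (_ ∷ D) zero    q = VAny.here q
      fromLookup (_ ∷ D) (suc i) q = VAny.there (fromLookup D i q)

    not-falsified : ∀ l → lo ≤ toℕ (proj₁ (lookup C l)) → toℕ (proj₁ (lookup C l)) < hi →
                    σ (proj₁ (lookup C l)) ≡ proj₂ (lookup C l) → falsified F N K x lo hi j ≡ false
    not-falsified l lo≤ <hi e = ¬-not λ f → <⇒≢ pos (sym (≡ᵇ-true _ 0 f))
      where
      pos : 0 < sumTo K (λ l → hit x lo hi (codeAt F N (j * K + l)))
      pos = pos-sumTo K (toℕ l) (Finₚ.toℕ<n l) (subst (λ c → 0 < hit x lo hi c) (sym (code≡ l)) (true-hit l lo≤ <hi e))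

  -- The variables are split into the blocks [0, h), [h, 2h) and [2h, N).

  module Blocks (h : ℕ) (2h≤N : h + h ≤ N) where

    Q : ℕ
    Q = N ∸ (h + h)

    inBlockA inBlockB inBlockC : ℕ → ℕ → Bool
    inBlockA a j = falsified F N K a 0 h j
    inBlockB b j = falsified F N K b h (h + h) j
    inBlockC τ j = falsified F N K τ (h + h) N j

    GoodPhase : ℕ → Set
    GoodPhase τ = ∃[ a ] (a < 2 ^ h × ∃[ b ] (b < 2 ^ h × (∀ {j} → j < m →
      ¬ (inBlockA a j ≡ true × inBlockB b j ≡ true × inBlockC τ j ≡ true))))

    %2-bit : ∀ x → x % 2 ≡ bit (x % 2 ≡ᵇ 1)
    %2-bit x with x % 2 | m%n<n x 2
    ... | zero        | _ = refl
    ... | suc zero    | _ = refl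
    ... | suc (suc _) | s≤s (s≤s ())

    module _ (a b τ : ℕ) where

      σ : Fin N → Bool
      σ v = if toℕ v <ᵇ h then (⟦ shr ⟧ a (toℕ v ∸ 0)) % 2 ≡ᵇ 1
            else if toℕ v <ᵇ h + h then (⟦ shr ⟧ b (toℕ v ∸ h)) % 2 ≡ᵇ 1
            else (⟦ shr ⟧ τ (toℕ v ∸ (h + h))) % 2 ≡ᵇ 1

      σ-A : Encodes a 0 h σ
      σ-A v _ <h rewrite true-<ᵇ <h = %2-bit (⟦ shr ⟧ a (toℕ v))

      σ-B : Encodes b h (h + h) σ
      σ-B v ≥h <2h rewrite false-<ᵇ (toℕ v) h ≥h | true-<ᵇ <2h = %2-bit (⟦ shr ⟧ b (toℕ v ∸ h))

      σ-C : Encodes τ (h + h) N σ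
      σ-C v ≥2h _ rewrite false-<ᵇ (toℕ v) h (≤-trans (m≤m+n h h) ≥2h) | false-<ᵇ (toℕ v) (h + h) ≥2h =
        %2-bit (⟦ shr ⟧ τ (toℕ v ∸ (h + h)))

      assembled : (∀ {j} → j < m → ¬ (inBlockA a j ≡ true × inBlockB b j ≡ true × inBlockC τ j ≡ true)) →
                  ∀ {C} → C ∈ φ → Satisfies σ C
      assembled ok {C} C∈ with index-of φ C∈
      ... | j , j< , at with inBlockA a j in ea | inBlockB b j in eb | inBlockC τ j in ec
      ...   | false | _     | _     = falsified-false σ-A j< at ea
      ...   | true  | false | _     = falsified-false σ-B j< at eb
      ...   | true  | true  | false = falsified-false σ-C j< at ec
      ...   | true  | true  | true  = ⊥-elim (ok j< (ea , eb , ec))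

    module _ (σ : Fin N → Bool) where

      value : ℕ → ℕ
      value v with v <? N
      ... | yes v< = bit (σ (fromℕ< v<))
      ... | no _   = 0

      value-toℕ : ∀ v → value (toℕ v) ≡ bit (σ v)
      value-toℕ v with toℕ v <? N
      ... | yes v< = cong (bit ∘ σ) (Finₚ.fromℕ<-toℕ v v<)
      ... | no ¬v< = ⊥-elim (¬v< (Finₚ.toℕ<n v))

      value< : ∀ i → value i < 2
      value< i with i <? N
      ... | yes i< = s≤s (bit≤1 _)
      ... | no _   = z<s

      part : ℕ → ℕ → ℕ
      part lo k = horner value 2 lo k

      part-< : ∀ lo k → part lo k < 2 ^ k
      part-< lo k = horner-< value 2 lo k λ i _ → value< i

      part-encodes : ∀ lo k → Encodes (part lo k) lo (lo + k) σ
      part-encodes lo k v lo≤ <hi = trans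
        (horner-digit value 2 lo k (toℕ v ∸ lo) (λ i _ → value< i)
          (+-cancelˡ-< lo _ _ (subst (_< lo + k) (sym (m+[n∸m]≡n lo≤)) <hi)))
        (trans (cong value (m+[n∸m]≡n lo≤)) (value-toℕ v))

      toLookup : ∀ {n} {D : Vec (Literal N) n} → VAny.Any (λ l → σ (proj₁ l) ≡ proj₂ l) D →
                 ∃[ i ] (σ (proj₁ (lookup D i)) ≡ proj₂ (lookup D i))
      toLookup (VAny.here p)  = zero , p
      toLookup (VAny.there p) = let i , q = toLookup p in suc i , q

      C-encodes : Encodes (part (h + h) Q) (h + h) N σ
      C-encodes v p q = part-encodes (h + h) Q v p (subst (toℕ v <_) (sym (m+[n∸m]≡n 2h≤N)) q)

      split-ok : All (Satisfies {N = N} σ) φ → ∀ {j} → j < m →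
                 ¬ (inBlockA (part 0 h) j ≡ true × inBlockB (part h h) j ≡ true × inBlockC (part (h + h) Q) j ≡ true)
      split-ok sat {j} j< (ea , eb , ec) with clause-at φ j j<
      ... | C , C∈ , at with toLookup (All.lookup sat C∈)
      ...   | l , e with toℕ (proj₁ (lookup C l)) <? h | toℕ (proj₁ (lookup C l)) <? h + h
      ...     | yes p | _ = case trans (sym ea) (not-falsified (part-encodes 0 h) {C = C} j< at l z≤n p e) of λ ()
      ...     | no ¬p | yes q = case trans (sym eb) (not-falsified (part-encodes h h) {C = C} j< at l (≮⇒≥ ¬p) q e) of λ ()
      ...     | no _  | no ¬q = case trans (sym ec) (not-falsified C-encodes {C = C} j< at l (≮⇒≥ ¬q) (Finₚ.toℕ<n (proj₁ (lookup C l))) e) of λ ()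

    satisfiable⇔good : (∃[ τ ] (τ < 2 ^ Q × GoodPhase τ)) ⇔ Satisfiable φ
    satisfiable⇔good = mk⇔
      (λ (τ , _ , a , _ , b , _ , ok) → σ a b τ , All.tabulate (assembled a b τ ok))
      (λ (σ , sat) → part σ (h + h) Q , part-< σ (h + h) Q ,
         part σ 0 h , part-< σ 0 h , part σ h h , part-< σ h h , split-ok σ sat)

-- The program that solves K-SAT.

-- The registers of the solver for K-SAT.  d is the reciprocal of the
-- relative block length, ℓ = suc ℓ′ the length of the legs.

nVars tempEnd maxW : ℕ
nVars   = 22
tempEnd = 100
maxW    = 1000

-- Abstract, because terms such as firstA + r should not be unfolded.

abstract

  firstA : ℕ
  firstA = tempEnd

  tempEnd≤firstA : tempEnd ≤ firstA
  tempEnd≤firstA = ≤-refl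

pattern x0 = zero
pattern x1 = suc x0
pattern x2 = suc x1
pattern x3 = suc x2
pattern x4 = suc x3
pattern x5 = suc x4
pattern x6 = suc x5
pattern x7 = suc x6
pattern x8 = suc x7
pattern x9 = suc x8
pattern x10 = suc x9
pattern x11 = suc x10
pattern x12 = suc x11
pattern x13 = suc x12
pattern x14 = suc x13
pattern x15 = suc x14
pattern x16 = suc x15
pattern x17 = suc x16
pattern x18 = suc x17
pattern x19 = suc x18
pattern x20 = suc x19
pattern x21 = suc x20

vN vm vK vL vL′ vCnt vF vTmp vh v2h vH vM vS vR vn vCell vu vv vτ vj vBit vRes : Fin nVars
vN    = x0
vm    = x1
vK    = x2
vL    = x3
vL′   = x4
vCnt  = x5
vF    = x6
vTmp  = x7
vh    = x8
v2h   = x9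
vH    = x10
vM    = x11
vS    = x12
vR    = x13
vn    = x14
vCell = x15
vu    = x16
vv    = x17
vτ    = x18
vj    = x19
vBit  = x20
vRes  = x21

module Source where


  at : ∀ k → Fin nVars → Exp (k + nVars)
  at k x = var (k Fin.↑ʳ x)

  codeExp : ∀ k → Exp (k + nVars) → Exp (k + nVars)
  codeExp k i = arop rem (arop shiftr (at k vF) (at k vN ⊠ i)) (pow2 (k Fin.↑ʳ vN))

  hitExp : ∀ {n} → (x lo hi c : Exp n) → Exp n
  hitExp x lo hi c = (arop quot c (lit 2) ≺ lo ≐ lit 0) ⊠ ((arop quot c (lit 2) ≺ hi) ⊠
    (arop rem (arop shiftr x (arop quot c (lit 2) ⊟ lo)) (lit 2) ≐ arop rem c (lit 2)))

  -- The arguments live below the variable bound by the sum.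

  falsifiedExp : ∀ k → (x lo hi j : Exp (suc k + nVars)) → Exp (k + nVars)
  falsifiedExp k x lo hi j =
    sum (k Fin.↑ʳ vK) (hitExp x lo hi (codeExp (suc k) (j ⊠ at (suc k) vK ⊞ var zero))) ≐ lit 0

  -- Variable 0 is s, variable 1 is r.

  tipExp : Exp (2 + nVars)
  tipExp =
    (r ≺ H) ⊠ ((s ≺ M) ⊠ ((s ≐ at 2 vm) ⊞ falsifiedExp 2 (var x2) (lit 0) (at 3 vh) (var x1)))
    ⊞ ((r ≺ H ≐ lit 0) ⊠ ((r ≺ H ⊞ H) ⊠
        ((s ≺ M ≐ lit 0) ⊠ ((s ⊟ M ≐ at 2 vm) ⊞
          falsifiedExp 2 (var x2 ⊟ at 3 vH) (at 3 vh) (at 3 v2h) (var x1 ⊟ at 3 vM))))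
    ⊞ (r ≐ H ⊞ H))
    where
    r = var x1
    s = var x0
    H = at 2 vH
    M = at 2 vM

  legExp : ∀ k → (r s i : Exp (k + nVars)) → Exp (k + nVars)
  legExp k r s i = at k vS ⊞ at k vR ⊞ ((r ⊠ at k vS ⊞ s) ⊠ at k vL ⊞ i)

  linkExp : (u v : Fin nVars) → Exp nVars
  linkExp u v = sum vR (sum (1 Fin.↑ʳ vS) (
    (at 2 u ≐ at 2 vS ⊞ var x1) ⊠ (at 2 v ≐ legExp 2 (var x1) (var x0) (lit 0))
    ⊞ ((at 2 u ≐ var x0) ⊠ (at 2 v ≐ legExp 2 (var x1) (var x0) (at 2 vL′)) ⊠ tipExp
    ⊞ sum (2 Fin.↑ʳ vL′)
        ((at 3 u ≐ legExp 3 (var x2) (var x1) (var x0)) ⊠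
         (at 3 v ≐ legExp 3 (var x2) (var x1) (lit 1 ⊞ var x0))))))

  cellExp : Exp nVars
  cellExp = lit 0 ≺ linkExp vu vv ⊞ linkExp vv vu

  openExp : Exp nVars
  openExp = falsifiedExp 0 (at 1 vτ) (at 1 v2h) (at 1 vN) (at 1 vj)

  open Commands nVars firstA public

  -- Absorbs the input into one number and wipes it from the memory. Afterwards the memory is zero
  -- everywhere, and the adjacency matrix can be written where `preprocess` expects it. Cells are
  -- read from the last to the first, as Horner's scheme requires.
  readFormula : Cmd
  readFormula = loop vCnt
    (loadA vTmp (var vCnt) ⨾
     vF := (var vF ⊠ pow2 vN ⊞ var vTmp) ⨾
     storeA (var vCnt) (lit 0))

  writeMatrix : Exp nVars → Cmd
  writeMatrix cell = loop vCell
    ((vu := arop quot (var vCell) (var vn) ⨾ vv := arop rem (var vCell) (var vn)) ⨾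
     storeA (var vCell) cell)

  toggle : Exp nVars → Cmd → Cmd
  toggle cond c = loop vj
    (vBit := cond ⨾
     ifnz (toℕ vBit) (setA 0 (var vj) ⨾ setA 1 (var vM ⊞ var vj) ⨾ lift c) skip)

  -- Both passes test the same condition for the same `vτ`, so exactly the opened gates are closed
  -- again. The flag is saved in between, because the second pass overwrites register 0 of the
  -- algorithm.
  phase : Exp nVars → DynamicAlgorithm → Cmd
  phase cond A = vj := var vm ⨾ toggle cond (insertion A) ⨾ lift (answer A) ⨾ readFlag vBit ⨾
                 (vRes := (lit 0 ≺ var vRes ⊞ var vBit) ⨾ vj := var vm) ⨾ toggle cond (deletion A)

  module _ (K d ℓ′ : ℕ) where

    initialise : Cmd
    initialise = vK := lit K ⨾ vL := lit (suc ℓ′) ⨾ vL′ := lit ℓ′ ⨾ vCnt := (var vm ⊠ var vK)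

    setParameters : Cmd
    setParameters =
      vh := arop quot (var vN) (lit d) ⨾
      v2h := (var vh ⊞ var vh) ⨾
      vH := pow2 vh ⨾
      vM := (lit 1 ⊞ var vm) ⨾
      vS := (var vM ⊞ var vM) ⨾
      vR := (lit 1 ⊞ (var vH ⊞ var vH)) ⨾
      vn := (var vS ⊞ var vR ⊞ var vR ⊠ var vS ⊠ var vL) ⨾
      vCell := (var vn ⊠ var vn)

    body : (cell cond : Exp nVars) → DynamicAlgorithm → Cmd
    body cell cond A = initialise ⨾ readFormula ⨾ setParameters ⨾ writeMatrix cell ⨾
      setA 0 (var vn) ⨾ lift (preprocess A) ⨾
      -- Powers of two are available for variables only, so `vCell`, left at 0 by the matrix loop,
      -- serves as a temporary. The result goes to `vN` because this is register 0, the output.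
      (vCell := (var vN ⊟ var v2h) ⨾ vτ := pow2 vCell) ⨾ loop vτ (phase cond A) ⨾ vN := var vRes

    -- Abstract, because normalising the program is expensive.

    abstract

      solver : DynamicAlgorithm → Cmd
      solver A = const (1 + nVars) (6 * suc ℓ′) ⨾ body cellExp openExp A

      solver≡ : ∀ A → solver A ≡ const (1 + nVars) (6 * suc ℓ′) ⨾ body cellExp openExp A
      solver≡ A = refl


-- Side conditions by evaluation, matrix cells, time bounds.

plain : (ℕ → Bool) → ∀ {n} → ℕ → Exp n → Bool
plain loopVar k (var i)      = true
plain loopVar k (lit c)      = c <ᵇ 3
plain loopVar k (arop o d e) = plain loopVar k d ∧ plain loopVar k e
plain loopVar k (pow2 i)     = toℕ i ≡ᵇ k
plain loopVar k (sum x e)    = (not (toℕ x <ᵇ k) ∧ loopVar (toℕ x ∸ k)) ∧ plain loopVar (suc k) e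

∧-true : ∀ x {y} → x ∧ y ≡ true → x ≡ true × y ≡ true
∧-true true e = refl , e

-- As `plain` is computed, the side conditions of the large expressions are settled by `refl`. It
-- admits literals up to 2, powers of two only of the outer variable 0, and as loop bounds only
-- outer variables selected by `loopVar`; `k` is the number of enclosing sums.
plain-fits : ∀ {B X n} loopVar k (e : Exp n) (ρ : Vec ℕ n) → 1 ≤ B →
             (∀ i → toℕ i ≡ k → lookup ρ i ≤ B) →
             (∀ i → k ≤ toℕ i → loopVar (toℕ i ∸ k) ≡ true → lookup ρ i ≤ X) →
             plain loopVar k e ≡ true → Fits B X e ρ
plain-fits lv k (var i) ρ 1≤B pw lp e = tt
plain-fits lv k (lit c) ρ 1≤B pw lp e = ≤-trans (s≤s⁻¹ (<ᵇ-true c 3 e)) (2^-mono 1≤B)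
plain-fits lv k (arop o d e) ρ 1≤B pw lp eqn with ∧-true (plain lv k d) eqn
... | p , q = plain-fits lv k d ρ 1≤B pw lp p , plain-fits lv k e ρ 1≤B pw lp q
plain-fits lv k (pow2 i) ρ 1≤B pw lp e = pw i (≡ᵇ-true _ k e)
plain-fits {B} {X} lv k (sum x e) ρ 1≤B pw lp eqn with ∧-true (not (toℕ x <ᵇ k) ∧ lv (toℕ x ∸ k)) eqn
... | p , q with ∧-true (not (toℕ x <ᵇ k)) p
...   | p₁ , p₂ = lp x (<ᵇ-false _ k (not-true p₁)) p₂ , λ c c< → plain-fits lv (suc k) e (c ∷ ρ) 1≤B
        (λ where (suc i) e′ → pw i (suc-injective e′))
        (λ where (suc i) le → lp i (s≤s⁻¹ le)) q
  where
  not-true : ∀ {b} → not b ≡ true → b ≡ false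
  not-true {false} _ = refl

matrixCell-≥ : ∀ {n} (G : Graph n) a → n * n ≤ a → matrixCell G a ≡ 0
matrixCell-≥ {n} G a le with a <? n * n
... | yes p = ⊥-elim (<⇒≱ p le)
... | no _  = refl

matrixCell-< : ∀ {n} .{{_ : NonZero n}} (G : Graph n) a → a < n * n →
  ∃[ u ] ∃[ v ] (toℕ u ≡ a / n × toℕ v ≡ a % n × matrixCell G a ≡ bit (adj G u v))
matrixCell-< {n} G a a< with a <? n * n
... | no ¬p = ⊥-elim (¬p a<)
... | yes p = u , v , sym (trans (cong (_/ n) a≡) (proj₁ uniq)) , sym (trans (cong (_% n) a≡) (proj₂ uniq)) , refl
  where
  u = proj₁ (remQuot {n} n (fromℕ< p))
  v = proj₂ (remQuot {n} n (fromℕ< p))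
  uniq = divMod-unique (toℕ u) (toℕ v) n (Finₚ.toℕ<n v)
  a≡ : a ≡ toℕ u * n + toℕ v
  a≡ = trans (sym (Finₚ.toℕ-fromℕ< p)) (trans (cong toℕ (sym (Finₚ.combine-remQuot {n} n (fromℕ< p))))
         (trans (Finₚ.toℕ-combine u v) (cong (_+ toℕ v) (*-comm n (toℕ u)))))

-- The bookkeeping of a round: time spent, reserve for the remaining rounds and credit never exceed
-- `bound` together. A round may use its reserve `C` and the part `Wt` of the credit.
bounded-time : ∀ {t X T c C Wt bound} → t + (C + c * C + (Wt + X)) ≤ bound → T ≤ C + Wt →
               t + T + c * C + X ≤ bound
bounded-time {t} {X} {T} {c} {C} {Wt} {bound} le T≤ = begin
  t + T + c * C + X           ≤⟨ +-monoˡ-≤ X (+-monoˡ-≤ (c * C) (+-monoʳ-≤ t T≤)) ⟩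
  t + (C + Wt) + c * C + X    ≡⟨ lem t C Wt (c * C) X ⟩
  t + (C + c * C + (Wt + X))  ≤⟨ le ⟩
  bound                       ∎
  where
  open ≤-Reasoning
  lem : ∀ t C W c X → t + (C + W) + c + X ≡ t + (C + c + (W + X))
  lem = solve-∀

lookup-at : ∀ {n} {P : ℕ → Set} (ρ : Vec ℕ n) i j → toℕ i ≡ toℕ j → P (lookup ρ j) → P (lookup ρ i)
lookup-at {P = P} ρ i j i≡j p = subst (λ i → P (lookup ρ i)) (sym (Finₚ.toℕ-injective i≡j)) p


-- `κ` bounds the cost of one instruction and `s` the steps for a matrix entry. A straight-line
-- assignment is charged 32 instructions; 15 of them lie outside the loops, two more are in the 74
-- for each cell and one in the 46 for each literal. The rest is loop control, loads and stores.
overheadTime : (κ n cnt s : ℕ) → ℕ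
overheadTime κ n cnt s = n * n * ((74 + s) * κ) + (cnt * (46 * κ) + (9 * κ + 15 * (32 * κ)))

-- 105 is composed of 7 for the loop, 2 for reading the flag and three assignments of 32 each. The
-- doubled term stands for the two passes over the clauses.
phaseTime : (κ m s : ℕ) → ℕ
phaseTime κ m s = 105 * κ + 2 * (m * ((7 + (2 + s) + 1 + 5 + 8) * κ) + κ)

-- The slowdown in the simulation of A, which has words of wA bits.

slowdown : (thr wA : ℕ) → ℕ
slowdown thr wA = 2 * (suc thr * wA) ^ 2

-- The operations of A, as relations: what remains when τ phases, or the
-- clauses below c of the opening or closing part of phase τ, are left.

record Operations (wA : ℕ) .{{_ : NonZero wA}} (m M : ℕ) (Alg : DynamicAlgorithm) (opened : ℕ → ℕ → Bool) : Set₁ where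
  open Machine wA
  field
    Phases          : ℕ → State → List ℕ → ℕ → Set
    Opening Closing : ℕ → ℕ → State → List ℕ → ℕ → Set
    finished   : ∀ {g as T} → Phases 0 g as T → as ≡ []
    begin-open : ∀ {τ g as T} → Phases (suc τ) g as T → Opening τ m g as T
    open-step  : ∀ {τ as} c {g T} → c < m → Opening τ (suc c) g as T → opened τ c ≡ true →
      ∃[ g′ ] ∃[ t ] ∃[ T′ ] (⟨ insertion Alg , setReg (setReg g 0 c) 1 (M + c) ⟩⇓⟨ g′ , t ⟩ × Opening τ c g′ as T′ × T ≡ t + T′)
    open-skip  : ∀ {τ as} c {g T} → c < m → Opening τ (suc c) g as T → opened τ c ≡ false → Opening τ c g as T
    ask        : ∀ {τ g as T} → Opening τ 0 g as T →
      ∃[ g′ ] ∃[ t ] ∃[ as′ ] ∃[ T′ ] (⟨ answer Alg , g ⟩⇓⟨ g′ , t ⟩ × as ≡ reg g′ 0 ∷ as′ × Closing τ m g′ as′ T′ × T ≡ t + T′)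
    close-step : ∀ {τ as} c {g T} → c < m → Closing τ (suc c) g as T → opened τ c ≡ true →
      ∃[ g′ ] ∃[ t ] ∃[ T′ ] (⟨ deletion Alg , setReg (setReg g 0 c) 1 (M + c) ⟩⇓⟨ g′ , t ⟩ × Closing τ c g′ as T′ × T ≡ t + T′)
    close-skip : ∀ {τ as} c {g T} → c < m → Closing τ (suc c) g as T → opened τ c ≡ false → Closing τ c g as T
    end-close  : ∀ {τ g as T} → Closing τ 0 g as T → Phases τ g as T

-- Execution of the solver on the word-RAM.

-- b bounds the lengths of all numbers in our own computations, whose
-- variables are below 2 ^ B.  Register r of the algorithm A is kept in
-- register firstA + r.  Whenever A writes to its register 0, register nVars
-- is updated to tell whether the value exceeds the threshold kept in register
-- 1 + nVars.  Thus answers of A, which may be huge, are only touched when A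
-- has just paid for touching them.

module Runs (w : ℕ) .{{_ : NonZero w}} (B b : ℕ) (1≤B : 1 ≤ B) (b≥ : maxW * B ≤ b)
            (wA : ℕ) .{{_ : NonZero wA}} (thr : ℕ) (thr≤ : thr ≤ 2 ^ b) where

  open Machine w
  open Agree
  module MA = Machine wA
  open Source

  nv≤ : 6 + nVars ≤ firstA
  nv≤ = ≤-trans (from-yes (6 + nVars ≤? tempEnd)) tempEnd≤firstA

  -- Both limits are generous, and for each concrete expression the inequalities are decided by
  -- evaluation. The offset `4 + nVars` covers every register at which an evaluation starts.
  Ok : Exp nVars → Set
  Ok e = width e ≤ maxW × (4 + nVars) + size e ≤ tempEnd

  2+v≤k : 2 + nVars ≤ firstA
  2+v≤k = ≤-trans (m≤n+m (2 + nVars) 4) nv≤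

  1≤mw : 1 ≤ maxW
  1≤mw = from-yes (1 ≤? maxW)


  Exec : Cmd → State → ℕ → (State → Set) → Set
  Exec c s T Q = ∃[ s′ ] ∃[ t ] (⟨ c , s ⟩⇓⟨ s′ , t ⟩ × t ≤ T × Q s′)

  exec-seq : ∀ {c d s T U Q R} → Exec c s T Q → (∀ s′ → Q s′ → Exec d s′ U R) →
             Exec (c ⨾ d) s (T + U) R
  exec-seq (s′ , t , p , t≤ , q) k with k s′ q
  ... | s″ , u , p′ , u≤ , r = s″ , t + u , ⇓seq p p′ , +-mono-≤ t≤ u≤ , r

  exec-weaken : ∀ {c s T U Q R} → T ≤ U → (∀ s′ → Q s′ → R s′) → Exec c s T Q → Exec c s U R
  exec-weaken le f (s′ , t , p , t≤ , q) = s′ , t , p , ≤-trans t≤ le , f s′ q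

  log≤ : ∀ {v} → v ≤ 2 ^ b → ⌊log₂ v ⌋ ≤ b
  log≤ {v} p = ≤-trans (⌊log₂⌋-mono-≤ p) (≤-reflexive (⌊log₂[2^n]⌋≡n b))

  abstract
    -- A number up to `2 ^ b` occupies at most `b + 1` words whatever the word length, so one bound
    -- serves all instructions of the host.
    κ : ℕ
    κ = suc b ^ 2

    κ≡ : κ ≡ suc b ^ 2
    κ≡ = refl

    cost≤ : ∀ {v} → v ≤ 2 ^ b → cost v ≤ κ
    cost≤ {v} p = ^-monoˡ-≤ 2 (s≤s (≤-trans (m/n≤m ⌊log₂ v ⌋ w) (log≤ p)))

    1≤κ : 1 ≤ κ
    1≤κ = ^-pos (suc b) 2 (s≤s z≤n)

  exec-const : ∀ {s r k} → k ≤ 2 ^ b → Exec (const r k) s (κ) (_≡ setReg s r k)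
  exec-const p = _ , _ , ⇓const , cost≤ p , refl

  exec-arith : ∀ {s o r x y} → reg s x ≤ 2 ^ b → reg s y ≤ 2 ^ b →
               ⟦ o ⟧ (reg s x) (reg s y) ≤ 2 ^ b →
               Exec (arith o r x y) s (κ) (_≡ setReg s r (⟦ o ⟧ (reg s x) (reg s y)))
  exec-arith p q r = _ , _ , ⇓arith , cost≤ (⊔-lub (⊔-lub p q) r) , refl

  record Computes (d k v : ℕ) (s s′ : State) : Set where
    constructor computes
    field
      result : reg s′ d ≡ v
      frame  : Agree d k s s′

  open Computes

  private
    reg-hit : ∀ s r v → reg (setReg s r v) r ≡ v
    reg-hit s r v = [f↦]-hit (reg s) r v

    reg-miss : ∀ s r v {j} → j ≢ r → reg (setReg s r v) j ≡ reg s j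
    reg-miss s r v = [f↦]-miss (reg s) r v

    suc≢ : ∀ n → suc n ≢ n
    suc≢ n p = 1+n≢n p

  compile-exec :
    ∀ B {n X} (e : Exp n) (locs : Vec ℕ n) d (ρ : Vec ℕ n) s →
    1 ≤ B → width e * B ≤ b →
    (∀ i → lookup locs i < d) → (∀ i → reg s (lookup locs i) ≡ lookup ρ i) →
    Small B ρ → Fits B X e ρ →
    Exec (compile locs d e) s (steps e X * κ) (Computes d (size e) (eval e ρ) s)
  compile-exec B (var i) locs d ρ s 1≤B wb l< l≡ ρ≤ fits =
    exec-weaken (≤-reflexive (cong (κ +_) (sym (+-identityʳ (κ)))))
      (λ where
        s₂ refl → computes
          (trans (reg-hit s₁ d _) val)
          (agree-trans (agree-setReg s (suc d) 0 (n≤1+n d) (≤-reflexive (+-comm 2 d)))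
                       (agree-setReg s₁ d _ ≤-refl (m<m+n d z<s))))
      (exec-seq {R = _≡ setReg s₁ d (reg s₁ (lookup locs i) + reg s₁ (suc d))} (exec-const z≤n) λ where
        _ refl → exec-arith
          (subst (_≤ 2 ^ b) (sym x≡) x≤)
          (subst (_≤ 2 ^ b) (sym (reg-hit s (suc d) 0)) z≤n)
          (subst (_≤ 2 ^ b) (sym val) x≤))
    where
    s₁ = setReg s (suc d) 0
    x≡ : reg s₁ (lookup locs i) ≡ lookup ρ i
    x≡ = trans (reg-miss s (suc d) 0 (<⇒≢ (m<n⇒m<1+n (l< i)))) (l≡ i)
    val : reg s₁ (lookup locs i) + reg s₁ (suc d) ≡ lookup ρ i
    val = trans (cong₂ _+_ x≡ (reg-hit s (suc d) 0)) (+-identityʳ _)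
    x≤ : lookup ρ i ≤ 2 ^ b
    x≤ = ≤-trans (ρ≤ i) (2^-mono (≤-trans (m≤m+n B 0) wb))
  compile-exec B (lit k) locs d ρ s 1≤B wb l< l≡ ρ≤ fits =
    exec-weaken (≤-reflexive (sym (+-identityʳ (κ))))
      (λ where
        _ refl → computes (reg-hit s d k) (agree-setReg s d k ≤-refl (m<m+n d z<s)))
      (exec-const (≤-trans fits (2^-mono (≤-trans (m≤m+n B 0) wb))))
  compile-exec B {X = X} (arop o e f) locs d ρ s 1≤B wb l< l≡ ρ≤ (fe , ff) =
    exec-weaken (≤-reflexive (lem (steps e X) (steps f X) (κ))) (λ _ c → c)
      (exec-seq (compile-exec B e locs d ρ s 1≤B (≤-trans (*-monoˡ-≤ B (m≤m+n (width e) _)) wb) l< l≡ ρ≤ fe)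
        λ s₁ c₁ → exec-seq (compile-exec B f locs (suc d) ρ s₁ 1≤B
                              (≤-trans (*-monoˡ-≤ B (m≤n+m (width f) (width e))) wb)
                              (λ i → m<n⇒m<1+n (l< i))
                              (λ i → trans (regs (frame c₁) _ (inj₁ (l< i))) (l≡ i)) ρ≤ ff)
        λ s₂ c₂ →
          let x≡ : reg s₂ d ≡ eval e ρ
              x≡ = trans (regs (frame c₂) d (inj₁ ≤-refl)) (result c₁)
              y≡ = result c₂
              v≡ = cong₂ ⟦ toOp o ⟧ x≡ y≡
              big = ≤-trans (eval-width B (arop o e f) ρ 1≤B ρ≤ (fe , ff)) (2^-mono wb)
              xb = ≤-trans (eval-width B e ρ 1≤B ρ≤ fe) (2^-mono (≤-trans (*-monoˡ-≤ B (m≤m+n (width e) _)) wb))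
              yb = ≤-trans (eval-width B f ρ 1≤B ρ≤ ff) (2^-mono (≤-trans (*-monoˡ-≤ B (m≤n+m (width f) (width e))) wb))
          in exec-weaken ≤-refl
               (λ where
                 _ refl → computes (trans (reg-hit s₂ d _) v≡)
                   (agree-trans (agree-widen ≤-refl (+-monoʳ-≤ d (m≤m⊔n _ _)) (frame c₁))
                     (agree-trans (agree-widen (n≤1+n d) (≤-trans (≤-reflexive (sym (+-suc d _))) (+-monoʳ-≤ d (m≤n⊔m (size e) _))) (frame c₂))
                       (agree-setReg s₂ d _ ≤-refl (m<m+n d (1≤size (arop o e f)))))))
               (exec-arith {o = toOp o} (subst (_≤ 2 ^ b) (sym x≡) xb) (subst (_≤ 2 ^ b) (sym y≡) yb)
                           (subst (_≤ 2 ^ b) (sym v≡) big)))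
    where
    lem : ∀ x y k → x * k + (y * k + k) ≡ (x + (y + 1)) * k
    lem = solve-∀
  compile-exec B (pow2 i) locs d ρ s 1≤B wb l< l≡ ρ≤ fits =
    exec-weaken (≤-reflexive (cong (κ +_) (sym (+-identityʳ (κ)))))
      (λ where
        _ refl → computes (trans (reg-hit s₁ d _) val)
          (agree-trans (agree-setReg s d 1 ≤-refl (m<m+n d z<s))
                       (agree-setReg s₁ d _ ≤-refl (m<m+n d z<s))))
      (exec-seq {R = _≡ setReg s₁ d (⟦ shl ⟧ (reg s₁ d) (reg s₁ (lookup locs i)))} (exec-const (1≤2^ b)) λ where
        _ refl → exec-arith
          (subst (_≤ 2 ^ b) (sym (reg-hit s d 1)) (1≤2^ b))
          (subst (_≤ 2 ^ b) (sym x≡) (≤-trans (ρ≤ i) (2^-mono B≤b)))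
          (subst (_≤ 2 ^ b) (sym val) (2^-mono (≤-trans fits B≤b))))
    where
    s₁ = setReg s d 1
    B≤b : B ≤ b
    B≤b = ≤-trans (m≤m+n B 0) wb
    x≡ : reg s₁ (lookup locs i) ≡ lookup ρ i
    x≡ = trans (reg-miss s d 1 (<⇒≢ (l< i))) (l≡ i)
    val : ⟦ shl ⟧ (reg s₁ d) (reg s₁ (lookup locs i)) ≡ 2 ^ lookup ρ i
    val = trans (cong₂ (λ x y → x * 2 ^ y) (reg-hit s d 1) x≡) (*-identityˡ _)
  compile-exec B {X = X} (sum x e) locs d ρ s 1≤B wb l< l≡ ρ≤ (nX , fe) =
    exec-weaken total (λ _ c → c)
      (exec-seq {R = Computes d (size (sum x e)) (eval (sum x e) ρ) s} (exec-const z≤n) λ where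
        _ refl → exec-seq {Q = _≡ s₂} (exec-const z≤n) λ where
          _ refl → exec-seq {Q = _≡ s₃} copy-step λ where
            _ refl → sum-loop n s₃ ≤-refl s₃-acc s₃-ctr s₃-frame)
    where
    open ≤-Reasoning
    n = lookup ρ x
    k = 2 + (size e ⊔ 1)
    f : ℕ → ℕ
    f i = eval e (i ∷ ρ)
    we≤ : width e * B ≤ b
    we≤ = ≤-trans (m≤n+m _ B) wb
    B≤b : B ≤ b
    B≤b = ≤-trans (m≤m+n B _) wb
    n≤ : n ≤ 2 ^ b
    n≤ = ≤-trans (ρ≤ x) (2^-mono B≤b)
    Σ≤ : sumTo n f ≤ 2 ^ b
    Σ≤ = ≤-trans (eval-width B (sum x e) ρ 1≤B ρ≤ (nX , fe)) (2^-mono wb)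
    s₁ = setReg s d 0
    s₂ = setReg s₁ (2 + d) 0
    lx≡ : reg s₂ (lookup locs x) ≡ n
    lx≡ = trans (reg-miss s₁ (2 + d) 0 (<⇒≢ (m<n⇒m<1+n (m<n⇒m<1+n (l< x)))))
                (trans (reg-miss s d 0 (<⇒≢ (l< x))) (l≡ x))
    s₃ = setReg s₂ (1 + d) (reg s₂ (lookup locs x) + reg s₂ (2 + d))
    ctr : reg s₂ (lookup locs x) + reg s₂ (2 + d) ≡ n
    ctr = trans (cong₂ _+_ lx≡ (reg-hit s₁ (2 + d) 0)) (+-identityʳ _)
    copy-step : Exec (arith add (1 + d) (lookup locs x) (2 + d)) s₂ (κ) (_≡ s₃)
    copy-step = exec-arith (subst (_≤ 2 ^ b) (sym lx≡) n≤) (subst (_≤ 2 ^ b) (sym (reg-hit s₁ (2 + d) 0)) z≤n)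
                       (subst (_≤ 2 ^ b) (sym ctr) n≤)
    d<d+k : d < d + k
    d<d+k = m<m+n d z<s
    1+d<d+k : 1 + d < d + k
    1+d<d+k = ≤-trans (≤-reflexive (+-comm 2 d)) (+-monoʳ-≤ d (s≤s (s≤s z≤n)))
    2+d<d+k : 2 + d < d + k
    2+d<d+k = ≤-trans (≤-reflexive (+-comm 3 d)) (+-monoʳ-≤ d (s≤s (s≤s (m≤n⊔m (size e) 1))))
    s₃-ctr : reg s₃ (1 + d) ≡ n
    s₃-ctr = trans (reg-hit s₂ (1 + d) _) ctr
    s₃-acc : reg s₃ d + sumTo n f ≡ sumTo n f
    s₃-acc = cong (_+ sumTo n f)
      (trans (reg-miss s₂ (1 + d) _ (<⇒≢ ≤-refl)) (trans (reg-miss s₁ (2 + d) 0 (<⇒≢ (m<n⇒m<1+n ≤-refl))) (reg-hit s d 0)))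
    s₃-frame : Agree d k s s₃
    s₃-frame = agree-trans (agree-setReg s d 0 ≤-refl d<d+k)
      (agree-trans (agree-setReg s₁ (2 + d) 0 (m≤n+m d 2) 2+d<d+k)
                   (agree-setReg s₂ (1 + d) _ (n≤1+n d) 1+d<d+k))
    it = 4 + steps e X
    round = const (2 + d) 1 ⨾ arith sub (1 + d) (1 + d) (2 + d) ⨾
           compile (1 + d ∷ locs) (2 + d) e ⨾ arith add d d (2 + d)
    total : κ + (κ + (κ + (n * (it * κ) + κ))) ≤ (4 + X * it) * κ
    total = begin
      κ + (κ + (κ + (n * (it * κ) + κ)))
        ≤⟨ +-monoʳ-≤ (κ) (+-monoʳ-≤ (κ) (+-monoʳ-≤ (κ) (+-monoˡ-≤ (κ) (*-monoˡ-≤ (it * κ) nX)))) ⟩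
      κ + (κ + (κ + (X * (it * κ) + κ)))
        ≡⟨ lem (κ) X it ⟩
      (4 + X * it) * κ ∎
      where
      lem : ∀ c x i → c + (c + (c + (x * (i * c) + c))) ≡ (4 + x * i) * c
      lem = solve-∀
    -- What has been collected and the terms still to come make up the whole sum. So every partial
    -- sum is bounded by the final value, and intermediate results need no bound of their own.
    sum-loop : ∀ c s′ → c ≤ n → reg s′ d + sumTo c f ≡ sumTo n f → reg s′ (1 + d) ≡ c →
           Agree d k s s′ →
           Exec (while (1 + d) round) s′ (c * (it * κ) + κ) (Computes d k (sumTo n f) s)
    sum-loop zero s′ _ acc ctr fr =
      s′ , _ , ⇓exit ctr , cost≤ (subst (_≤ 2 ^ b) (sym ctr) z≤n) ,
      computes (trans (sym (+-identityʳ _)) acc) fr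
    sum-loop (suc c) s′ c<n acc ctr fr with
      exec-seq {R = λ t → reg t d + sumTo c f ≡ sumTo n f × reg t (1 + d) ≡ c × Agree d k s t}
        (exec-const (1≤2^ b)) (λ where
        _ refl → exec-seq {Q = _≡ t₂} sub-step (λ where
          _ refl → exec-seq
            (compile-exec B e (1 + d ∷ locs) (2 + d) (c ∷ ρ) t₂ 1≤B we≤ locs< locs≡
               (small-∷ B (≤-trans (<⇒≤ c<n) (ρ≤ x)) ρ≤) (fe c c<n))
            λ t₃ c₃ → exec-weaken ≤-refl (λ where _ refl → finish t₃ c₃) (add-step t₃ c₃)))
      where
      t₁ = setReg s′ (2 + d) 1
      t₂ = setReg t₁ (1 + d) (reg t₁ (1 + d) ∸ reg t₁ (2 + d))
      ctr₁ : reg t₁ (1 + d) ≡ suc c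
      ctr₁ = trans (reg-miss s′ (2 + d) 1 (<⇒≢ ≤-refl)) ctr
      sub≡ : reg t₁ (1 + d) ∸ reg t₁ (2 + d) ≡ c
      sub≡ = cong₂ _∸_ ctr₁ (reg-hit s′ (2 + d) 1)
      sub-step : Exec (arith sub (1 + d) (1 + d) (2 + d)) t₁ (κ) (_≡ t₂)
      sub-step = exec-arith {o = sub} (subst (_≤ 2 ^ b) (sym ctr₁) (≤-trans c<n n≤))
        (subst (_≤ 2 ^ b) (sym (reg-hit s′ (2 + d) 1)) (1≤2^ b))
        (subst (_≤ 2 ^ b) (sym sub≡) (≤-trans (<⇒≤ c<n) n≤))
      ctr₂ : reg t₂ (1 + d) ≡ c
      ctr₂ = trans (reg-hit t₁ (1 + d) _) sub≡
      fr₂ : Agree d k s t₂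
      fr₂ = agree-trans fr (agree-trans (agree-setReg s′ (2 + d) 1 (m≤n+m d 2) 2+d<d+k)
                                        (agree-setReg t₁ (1 + d) _ (n≤1+n d) 1+d<d+k))
      acc₂ : reg t₂ d ≡ reg s′ d
      acc₂ = trans (reg-miss t₁ (1 + d) _ (<⇒≢ ≤-refl)) (reg-miss s′ (2 + d) 1 (<⇒≢ (m<n⇒m<1+n ≤-refl)))
      locs< : ∀ i → lookup (1 + d ∷ locs) i < 2 + d
      locs< zero    = ≤-refl
      locs< (suc i) = m<n⇒m<1+n (m<n⇒m<1+n (l< i))
      locs≡ : ∀ i → reg t₂ (lookup (1 + d ∷ locs) i) ≡ lookup (c ∷ ρ) i
      locs≡ zero    = ctr₂
      locs≡ (suc i) = trans (regs fr₂ _ (inj₁ (l< i))) (l≡ i)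
      module _ (t₃ : State) (c₃ : Computes (2 + d) (size e) (f c) t₂ t₃) where
        d₃ : reg t₃ d ≡ reg s′ d
        d₃ = trans (regs (frame c₃) d (inj₁ (m<n⇒m<1+n ≤-refl))) acc₂
        sum≡ : reg t₃ d + reg t₃ (2 + d) ≡ reg s′ d + f c
        sum≡ = cong₂ _+_ d₃ (result c₃)
        acc′ : (reg s′ d + f c) + sumTo c f ≡ sumTo n f
        acc′ = trans (trans (+-assoc (reg s′ d) (f c) _) (cong (reg s′ d +_) (+-comm (f c) _))) acc
        part≤ : reg s′ d + f c ≤ 2 ^ b
        part≤ = ≤-trans (m+n≤o⇒m≤o _ (≤-reflexive acc′)) Σ≤
        add-step : Exec (arith add d d (2 + d)) t₃ (κ) (_≡ setReg t₃ d (reg t₃ d + reg t₃ (2 + d)))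
        add-step = exec-arith {o = add}
          (≤-trans (m+n≤o⇒m≤o _ (≤-reflexive sum≡)) part≤)
          (≤-trans (m+n≤o⇒n≤o (reg t₃ d) (≤-reflexive sum≡)) part≤)
          (subst (_≤ 2 ^ b) (sym sum≡) part≤)
        finish : let t = setReg t₃ d (reg t₃ d + reg t₃ (2 + d)) in
                 reg t d + sumTo c f ≡ sumTo n f × reg t (1 + d) ≡ c × Agree d k s t
        finish =
          trans (cong (_+ sumTo c f) (trans (reg-hit t₃ d _) sum≡)) acc′ ,
          trans (reg-miss t₃ d _ (suc≢ d)) (trans (regs (frame c₃) _ (inj₁ ≤-refl)) ctr₂) ,
          agree-trans fr₂ (agree-trans
            (agree-widen (m≤n+m d 2) (≤-trans (≤-reflexive (lem d (size e))) (+-monoʳ-≤ d (s≤s (s≤s (m≤m⊔n _ 1))))) (frame c₃))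
            (agree-setReg t₃ d _ ≤-refl d<d+k))
          where
          lem : ∀ d z → 2 + d + z ≡ d + (2 + z)
          lem = solve-∀
    ... | t , u , p , u≤ , acc′ , ctr′ , fr′ with sum-loop c t (<⇒≤ c<n) acc′ ctr′ fr′
    ...   | t′ , u′ , p′ , u′≤ , q =
      t′ , _ , ⇓loop (λ z → 0≢1+n (trans (sym z) ctr)) p p′ , time , q
      where
      time : cost (reg s′ (1 + d)) + (u + u′) ≤ suc c * (it * κ) + κ
      time = begin
        cost (reg s′ (1 + d)) + (u + u′)
          ≤⟨ +-mono-≤ (cost≤ (subst (_≤ 2 ^ b) (sym ctr) (≤-trans c<n n≤))) (+-mono-≤ u≤ u′≤) ⟩
        κ + (κ + (κ + (steps e X * κ + κ)) + (c * (it * κ) + κ))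
          ≡⟨ lem (κ) (steps e X) (c * (it * κ)) ⟩
        suc c * (it * κ) + κ ∎
        where
        lem : ∀ k x y → k + (k + (k + (x * k + k)) + (y + k)) ≡ ((4 + x) * k + y) + k
        lem = solve-∀

  record Sim (g s : State) : Set where
    constructor sim
    field
      regA  : ∀ r → reg s (firstA + r) ≡ reg g r
      memA  : ∀ a → mem s a ≡ mem g a
      tapeA : tape s ≡ tape g
      flagA : reg s nVars ≡ bit (thr <ᵇ reg g 0)
      thrA  : reg s (1 + nVars) ≡ thr
  open Sim public


  -- `Sim` at the moment between a write to register `r` and the `note` that follows: the flag may
  -- be out of date, but only if `r` is 0.
  record Written (r : ℕ) (g s : State) : Set where
    constructor written
    field
      regW  : ∀ r → reg s (firstA + r) ≡ reg g r
      memW  : ∀ a → mem s a ≡ mem g a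
      tapeW : tape s ≡ tape g
      flagW : r ≢ 0 → reg s nVars ≡ bit (thr <ᵇ reg g 0)
      thrW  : reg s (1 + nVars) ≡ thr
  open Written

  SameOwn : State → State → Set
  SameOwn s s′ = ∀ r → r < nVars → reg s′ r ≡ reg s r

  D W : ℕ
  D = (suc thr * wA) ^ 2
  W = 2 * D

  -- A word of the host has at least one bit and a word of the algorithm has `wA`, which explains
  -- the factor `wA`. The threshold adds at most `thr` bits, and the factor `suc thr` absorbs them.
  words≤ : ∀ x y → x ≤ y → words (thr ⊔ x ⊔ bit (thr <ᵇ x)) ≤ (suc thr * wA) * MA.words y
  words≤ x y x≤y = begin
    suc (⌊log₂ z ⌋ / w)                    ≤⟨ s≤s (m/n≤m ⌊log₂ z ⌋ w) ⟩
    suc ⌊log₂ z ⌋                          ≤⟨ s≤s log-z ⟩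
    suc (thr + ⌊log₂ y ⌋)                  ≤⟨ s≤s (+-monoʳ-≤ thr (m≤m+n _ (thr * ⌊log₂ y ⌋))) ⟩
    suc (thr + (⌊log₂ y ⌋ + thr * ⌊log₂ y ⌋)) ≡⟨ lem thr ⌊log₂ y ⌋ ⟩
    suc thr * suc ⌊log₂ y ⌋                ≤⟨ *-monoʳ-≤ (suc thr) (suc-log≤ wA ⌊log₂ y ⌋) ⟩
    suc thr * (wA * MA.words y)            ≡⟨ *-assoc (suc thr) wA _ ⟨
    suc thr * wA * MA.words y              ∎
    where
    open ≤-Reasoning
    z = thr ⊔ x ⊔ bit (thr <ᵇ x)
    lem : ∀ t l → suc (t + (l + t * l)) ≡ suc t * suc l
    lem = solve-∀
    log-bit : ∀ c → ⌊log₂ bit c ⌋ ≤ 0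
    log-bit true  = z≤n
    log-bit false = z≤n
    log-z : ⌊log₂ z ⌋ ≤ thr + ⌊log₂ y ⌋
    log-z = ≤-trans (log⊔ (thr ⊔ x) _)
      (≤-trans (+-mono-≤ (≤-trans (log⊔ thr x) (+-mono-≤ (log≤id thr) (⌊log₂⌋-mono-≤ x≤y))) (log-bit (thr <ᵇ x)))
               (≤-reflexive (+-identityʳ _)))

  note-cost : ∀ {x y} → x ≤ y → cost (thr ⊔ x ⊔ bit (thr <ᵇ x)) ≤ D * MA.cost y
  note-cost {x} {y} p = ≤-trans (^-monoˡ-≤ 2 (words≤ x y p)) (≤-reflexive (^-distribʳ-* 2 (suc thr * wA) _))

  cost-mono : ∀ {x y} → x ≤ y → cost x ≤ cost y
  cost-mono p = ^-monoˡ-≤ 2 (s≤s (/-monoˡ-≤ w (⌊log₂⌋-mono-≤ p)))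

  instr-cost : ∀ y → cost y ≤ D * MA.cost y
  instr-cost y = ≤-trans (cost-mono (≤-trans (m≤n⊔m thr y) (m≤m⊔n (thr ⊔ y) _))) (note-cost ≤-refl)

  1≤wA : 1 ≤ wA
  1≤wA = >-nonZero⁻¹ wA

  1≤D : 1 ≤ D
  1≤D = ^-pos (suc thr * wA) 2 (*-mono-≤ {1} {suc thr} (s≤s z≤n) 1≤wA)

  1≤D*cost : ∀ y → 1 ≤ D * MA.cost y
  1≤D*cost y = *-mono-≤ 1≤D (^-pos (MA.words y) 2 (s≤s z≤n))

  double : ∀ {x y z} → x ≤ D * z → y ≤ D * z → x + y ≤ W * z
  double {z = z} p q = ≤-trans (+-mono-≤ p q) (≤-reflexive (lem D z))
    where
    lem : ∀ d z → d * z + d * z ≡ 2 * d * z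
    lem = solve-∀

  single : ∀ {x z} → x ≤ D * z → x ≤ W * z
  single {z = z} p = ≤-trans (≤-trans p (m≤m+n _ 0)) (double {z = z} ≤-refl z≤n)

  v<k : nVars < firstA
  v<k = ≤-trans (n≤1+n (suc nVars)) 2+v≤k

  k+≢ : ∀ {x r} → x < firstA → x ≢ firstA + r
  k+≢ x<k refl = <⇒≱ x<k (m≤m+n _ _)

  -- `y` stands for the largest number touched by the instruction that wrote the register. The
  -- comparison is charged to what the algorithm has just paid for it, so no bound on the value
  -- itself is needed.
  noted : ∀ r {g s} → Written r g s → ∀ y → reg g r ≤ y →
          Exec (note r) s (D * MA.cost y) λ s′ → Sim g s′ × SameOwn s s′
  noted zero {g} {s} (written rg mm tp _ th) y le =
    _ , _ , ⇓arith , time , sim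
      (λ r → trans ([f↦]-miss (reg s) nVars _ (≢-sym (k+≢ v<k))) (rg r)) mm tp
      (trans ([f↦]-hit (reg s) nVars _) (cong₂ (λ x y → bit (x <ᵇ y)) th a≡))
      th ,
    λ r r<v → [f↦]-miss (reg s) nVars _ (<⇒≢ r<v)
    where
    a≡ : reg s firstA ≡ reg g 0
    a≡ = trans (cong (reg s) (sym (+-identityʳ firstA))) (rg 0)
    time : cost (reg s (1 + nVars) ⊔ reg s firstA ⊔ bit (reg s (1 + nVars) <ᵇ reg s firstA)) ≤ D * MA.cost y
    time = subst₂ (λ x z → cost (x ⊔ z ⊔ bit (x <ᵇ z)) ≤ D * MA.cost y) (sym th) (sym a≡) (note-cost le)
  noted (suc r) (written rg mm tp fl th) y le =
    _ , _ , ⇓skip , 1≤D*cost y , sim rg mm tp (fl λ ()) th , λ _ _ → refl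

  setA-written : ∀ {g s} r x → Sim g s → Written r (setReg g r x) (setReg s (firstA + r) x)
  setA-written {g} {s} r x (sim rg mm tp fl th) = written shift mm tp
    (λ r≢0 → trans ([f↦]-miss (reg s) (firstA + r) x (k+≢ v<k))
              (trans fl (cong (λ z → bit (thr <ᵇ z)) (sym ([f↦]-miss (reg g) r x (≢-sym r≢0))))))
    (trans ([f↦]-miss (reg s) (firstA + r) x (k+≢ 2+v≤k)) th)
    where
    shift : ∀ r′ → reg (setReg s (firstA + r) x) (firstA + r′) ≡ reg (setReg g r x) r′
    shift r′ with r′ ≟ r
    ... | yes refl = trans ([f↦]-hit (reg s) (firstA + r) x) (sym ([f↦]-hit (reg g) r x))
    ... | no r′≢r = trans ([f↦]-miss (reg s) (firstA + r) x (r′≢r ∘ +-cancelˡ-≡ firstA r′ r))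
                         (trans (rg r′) (sym ([f↦]-miss (reg g) r x r′≢r)))

  setA-own : ∀ s r x → SameOwn s (setReg s (firstA + r) x)
  setA-own s r x r′ r′<nVars = [f↦]-miss (reg s) (firstA + r) x (k+≢ (<-trans r′<nVars v<k))

  own-trans : ∀ s s′ s″ → SameOwn s s′ → SameOwn s′ s″ → SameOwn s s″
  own-trans s s′ s″ p q r r<v = trans (q r r<v) (p r r<v)

  -- The factor 2 in `W` consists of one `D` for the instruction and one for its `note`.
  write-then-note : ∀ {c g s T} r x y → Sim g s → T ≤ D * MA.cost y →
    ⟨ c , s ⟩⇓⟨ setReg s (firstA + r) x , T ⟩ → x ≤ y →
    Exec (c ⨾ note r) s (W * MA.cost y) λ s′ → Sim (setReg g r x) s′ × SameOwn s s′
  write-then-note {g = g} {s} r x y sm T≤ p x≤y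
    with noted r (setA-written r x sm) y (subst (_≤ y) (sym ([f↦]-hit (reg g) r x)) x≤y)
  ... | s′ , u , q , u≤ , sm′ , o =
    s′ , _ , ⇓seq p q , double {z = MA.cost y} T≤ u≤ , sm′ , own-trans s (setReg s (firstA + r) x) s′ (setA-own s r x) o

  simulate : ∀ {c g g′ t} → MA.⟨ c , g ⟩⇓⟨ g′ , t ⟩ → ∀ {s} → Sim g s →
             Exec (lift c) s (W * t) λ s′ → Sim g′ s′ × SameOwn s s′
  simulate MA.⇓skip sm = _ , _ , ⇓skip , single {z = 1} (≤-trans 1≤D (≤-reflexive (sym (*-identityʳ D)))) , sm , λ _ _ → refl
  simulate (MA.⇓const {r = r} {c}) sm = write-then-note r c c sm (instr-cost c) ⇓const ≤-refl
  simulate {g = g} (MA.⇓arith {o = o} {r} {x} {y}) {s} sm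
    with ⇓arith {s = s} {o = o} {r = firstA + r} {a = firstA + x} {b = firstA + y}
  ... | p rewrite regA sm x | regA sm y =
    write-then-note r _ (reg g x ⊔ reg g y ⊔ ⟦ o ⟧ (reg g x) (reg g y)) sm (instr-cost (reg g x ⊔ reg g y ⊔ ⟦ o ⟧ (reg g x) (reg g y))) p (m≤n⊔m (reg g x ⊔ reg g y) _)
  simulate {g = g} (MA.⇓load {r = r} {x}) {s} sm
    with ⇓load {s = s} {r = firstA + r} {a = firstA + x}
  ... | p rewrite regA sm x | memA sm (reg g x) =
    write-then-note r _ (reg g x ⊔ mem g (reg g x)) sm (instr-cost (reg g x ⊔ mem g (reg g x))) p (m≤n⊔m (reg g x) _)
  simulate {g = g} (MA.⇓store {a = x} {r}) {s} sm
    with ⇓store {s = s} {a = firstA + x} {r = firstA + r}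
  ... | p rewrite regA sm x | regA sm r =
    _ , _ , p , single {z = MA.cost (reg g x ⊔ reg g r)} (instr-cost (reg g x ⊔ reg g r)) ,
    sim (regA sm) cells (tapeA sm) (flagA sm) (thrA sm) , λ _ _ → refl
    where
    cells : ∀ a → (mem s [ reg g x ↦ reg g r ]) a ≡ (mem g [ reg g x ↦ reg g r ]) a
    cells a with a ≡ᵇ reg g x
    ... | true  = refl
    ... | false = memA sm a
  simulate {g = g} (MA.⇓flip {f} {m} {c} {bs} {r}) {⟪ f′ , m′ , .(c ∷ bs) ⟫} (sim rg mm refl fl th)
    with noted r (setA-written r (bit c) (sim {g = ⟪ f , m , bs ⟫} {s = ⟪ f′ , m′ , bs ⟫} rg mm refl fl th))
               (bit c) (≤-reflexive ([f↦]-hit f r (bit c)))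
  ... | s′ , u , q , u≤ , sm′ , o =
    s′ , _ , ⇓seq ⇓flip q , ≤-trans (double {z = MA.cost (bit c)} (1≤D*cost (bit c)) u≤) (≤-reflexive (cong (W *_) (one c))) ,
    sm′ , own-trans ⟪ f′ , m′ , bs ⟫ (setReg ⟪ f′ , m′ , bs ⟫ (firstA + r) (bit c)) s′ (setA-own ⟪ f′ , m′ , bs ⟫ r (bit c)) o
    where
    one : ∀ c → MA.cost (bit c) ≡ 1
    one true  = cong (λ z → suc z ^ 2) (0/n≡0 wA)
    one false = cong (λ z → suc z ^ 2) (0/n≡0 wA)
  simulate (MA.⇓seq {t = t} {u} p q) {s} sm with simulate p sm
  ... | s₁ , t₁ , p₁ , t₁≤ , sm₁ , o₁ with simulate q sm₁
  ...   | s₂ , t₂ , p₂ , t₂≤ , sm₂ , o₂ =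
    s₂ , _ , ⇓seq p₁ p₂ , ≤-trans (+-mono-≤ t₁≤ t₂≤) (≤-reflexive (sym (*-distribˡ-+ W t u))) ,
    sm₂ , own-trans s s₁ s₂ o₁ o₂
  simulate (MA.⇓then {r = r} {t = t} r≢0 p) sm with simulate p sm
  ... | s₁ , t₁ , p₁ , t₁≤ , sm₁ , o₁ =
    s₁ , _ , ⇓then (λ z → r≢0 (trans (sym (regA sm r)) z)) p₁ , guard-time r t sm t₁≤ , sm₁ , o₁
    where
    guard-time : ∀ r t {g s t₁} → Sim g s → t₁ ≤ W * t → cost (reg s (firstA + r)) + t₁ ≤ W * (MA.cost (reg g r) + t)
    guard-time r t {g} sm le rewrite regA sm r =
      ≤-trans (+-mono-≤ (single {z = MA.cost (reg g r)} (instr-cost (reg g r))) le) (≤-reflexive (sym (*-distribˡ-+ W _ t)))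
  simulate {g = g} (MA.⇓else {r = r} {t = t} r≡0 p) {s} sm with simulate p sm
  ... | s₁ , t₁ , p₁ , t₁≤ , sm₁ , o₁ =
    s₁ , _ , ⇓else (trans (regA sm r) r≡0) p₁ , time , sm₁ , o₁
    where
    time : cost (reg s (firstA + r)) + t₁ ≤ W * (MA.cost (reg g r) + t)
    time rewrite regA sm r =
      ≤-trans (+-mono-≤ (single {z = MA.cost (reg g r)} (instr-cost (reg g r))) t₁≤) (≤-reflexive (sym (*-distribˡ-+ W _ t)))
  simulate {g = g} (MA.⇓loop {r = r} {t = t} {u} r≢0 p q) {s} sm with simulate p sm
  ... | s₁ , t₁ , p₁ , t₁≤ , sm₁ , o₁ with simulate q sm₁
  ...   | s₂ , t₂ , p₂ , t₂≤ , sm₂ , o₂ =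
    s₂ , _ , ⇓loop (λ z → r≢0 (trans (sym (regA sm r)) z)) p₁ p₂ , time , sm₂ , own-trans s s₁ s₂ o₁ o₂
    where
    time : cost (reg s (firstA + r)) + (t₁ + t₂) ≤ W * (MA.cost (reg g r) + (t + u))
    time rewrite regA sm r =
      ≤-trans (+-mono-≤ (single {z = MA.cost (reg g r)} (instr-cost (reg g r)))
                (≤-trans (+-mono-≤ t₁≤ t₂≤) (≤-reflexive (sym (*-distribˡ-+ W t u)))))
        (≤-reflexive (sym (*-distribˡ-+ W _ (t + u))))
  simulate {g = g} (MA.⇓exit {r = r} r≡0) {s} sm =
    s , _ , ⇓exit (trans (regA sm r) r≡0) , time , sm , λ _ _ → refl
    where
    time : cost (reg s (firstA + r)) ≤ W * MA.cost (reg g r)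
    time rewrite regA sm r = single {z = MA.cost (reg g r)} (instr-cost (reg g r))

  record Match (ρ : Env) (g s : State) : Set where
    constructor match
    field
      own : ∀ i → reg s (toℕ i) ≡ lookup ρ i
      sms : Sim g s
  open Match public


  -- A Hoare triple on what matters: the variables of the host and the state of the simulated
  -- algorithm, with all temporaries hidden. The postcondition sees an upper bound `T` of the time
  -- instead of the time itself, so exact costs never have to be known.
  Run : Cmd → Env → State → (Env → State → ℕ → Set) → Set
  Run c ρ g Q = ∀ s → Match ρ g s →
    ∃[ ρ′ ] ∃[ g′ ] ∃[ s′ ] ∃[ t ] ∃[ T ]
      (⟨ c , s ⟩⇓⟨ s′ , t ⟩ × t ≤ T × Match ρ′ g′ s′ × Q ρ′ g′ T)

  run-seq : ∀ {c d ρ g} Q {R} → Run c ρ g Q →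
            (∀ ρ′ g′ T → Q ρ′ g′ T → Run d ρ′ g′ (λ ρ″ g″ U → R ρ″ g″ (T + U))) →
            Run (c ⨾ d) ρ g R
  run-seq Q p k s mt with p s mt
  ... | ρ₁ , g₁ , s₁ , t₁ , T₁ , e₁ , t₁≤ , mt₁ , q with k ρ₁ g₁ T₁ q s₁ mt₁
  ...   | ρ₂ , g₂ , s₂ , t₂ , T₂ , e₂ , t₂≤ , mt₂ , r =
    ρ₂ , g₂ , s₂ , t₁ + t₂ , T₁ + T₂ , ⇓seq e₁ e₂ , +-mono-≤ t₁≤ t₂≤ , mt₂ , r

  run-weaken : ∀ {c ρ g Q R} → (∀ ρ′ g′ T → Q ρ′ g′ T → R ρ′ g′ T) → Run c ρ g Q → Run c ρ g R
  run-weaken f p s mt with p s mt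
  ... | ρ₁ , g₁ , s₁ , t₁ , T₁ , e₁ , t₁≤ , mt₁ , q =
    ρ₁ , g₁ , s₁ , t₁ , T₁ , e₁ , t₁≤ , mt₁ , f ρ₁ g₁ T₁ q

  is : Env → State → ℕ → (Env → State → ℕ → Set)
  is ρ g T ρ′ g′ T′ = ρ′ ≡ ρ × g′ ≡ g × T′ ≡ T

  private
    tmp≢ : ∀ j (i : Fin nVars) → toℕ i ≢ j + nVars
    tmp≢ j i p = <⇒≱ (Finₚ.toℕ<n i) (subst (nVars ≤_) (sym p) (m≤n+m nVars j))

    big≢ : ∀ {j} r → j < firstA → firstA + r ≢ j
    big≢ r j< refl = <⇒≱ j< (m≤m+n firstA r)

  eval-step : ∀ {X} d (e : Exp nVars) ρ g s → Match ρ g s → Ok e → d₀ ≤ d → d ≤ 4 + nVars → Small B ρ → Fits B X e ρ →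
              Exec (compile ids d e) s (steps e X * κ) λ s′ →
                Computes d (size e) (eval e ρ) s s′ × Match ρ g s′
  eval-step d e ρ g s mt (we , se) d₀≤d d≤ ρ≤ fits =
    exec-weaken ≤-refl (λ s′ c → c , keep s′ c)
      (compile-exec B e ids d ρ s 1≤B (≤-trans (*-monoˡ-≤ B we) b≥) ids< ids≡ ρ≤ fits)
    where
    id≡ : ∀ i → lookup ids i ≡ toℕ i
    id≡ i = Vecₚ.lookup∘tabulate toℕ i
    ids< : ∀ i → lookup ids i < d
    ids< i = subst (_< d) (sym (id≡ i)) (≤-trans (Finₚ.toℕ<n i) (≤-trans (m≤n+m nVars 2) d₀≤d))
    ids≡ : ∀ i → reg s (lookup ids i) ≡ lookup ρ i
    ids≡ i = trans (cong (reg s) (id≡ i)) (own mt i)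
    keep : ∀ s′ → Computes d (size e) (eval e ρ) s s′ → Match ρ g s′
    keep s′ (computes _ (agree rg mm tp)) = match
      (λ i → trans (rg (toℕ i) (inj₁ (≤-trans (Finₚ.toℕ<n i) (≤-trans (m≤n+m nVars 2) d₀≤d)))) (own mt i))
      (sim (λ r → trans (rg (firstA + r) (inj₂ (≤-trans (≤-trans (≤-trans (+-monoˡ-≤ (size e) d≤) se) tempEnd≤firstA) (m≤m+n firstA r)))) (regA (sms mt) r))
           (λ a → trans (mm a) (memA (sms mt) a)) (trans tp (tapeA (sms mt)))
           (trans (rg nVars (inj₁ (≤-trans (n≤1+n _) d₀≤d))) (flagA (sms mt)))
           (trans (rg (suc nVars) (inj₁ d₀≤d)) (thrA (sms mt))))

  eval≤ : ∀ {X} (e : Exp nVars) ρ → Ok e → Small B ρ → Fits B X e ρ → eval e ρ ≤ 2 ^ b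
  eval≤ e ρ (we , _) ρ≤ fits = ≤-trans (eval-width B e ρ 1≤B ρ≤ fits) (2^-mono (≤-trans (*-monoˡ-≤ B we) b≥))

  setTmp-match : ∀ {ρ g s} d v → d₀ ≤ d → d < firstA → Match ρ g s → Match ρ g (setReg s d v)
  setTmp-match {s = s} d v d₀≤d d<k (match o (sim rg mm tp fl th)) = match
    (λ i → trans ([f↦]-miss (reg s) d v (<⇒≢ (≤-trans (Finₚ.toℕ<n i) (≤-trans (m≤n+m nVars 2) d₀≤d)))) (o i))
    (sim (λ r → trans ([f↦]-miss (reg s) d v (big≢ r d<k)) (rg r)) mm tp
         (trans ([f↦]-miss (reg s) d v (<⇒≢ (≤-trans (n≤1+n _) d₀≤d))) fl)
         (trans ([f↦]-miss (reg s) d v (<⇒≢ d₀≤d)) th))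

  setOwn-match : ∀ {ρ g s} x v → Match ρ g s → Match (ρ [ x ]≔ v) g (setReg s (toℕ x) v)
  setOwn-match {ρ} {s = s} x v (match o (sim rg mm tp fl th)) = match own′
    (sim (λ r → trans ([f↦]-miss (reg s) (toℕ x) v (big≢ r x<k)) (rg r)) mm tp
         (trans ([f↦]-miss (reg s) (toℕ x) v (≢-sym (tmp≢ 0 x))) fl)
         (trans ([f↦]-miss (reg s) (toℕ x) v (≢-sym (tmp≢ 1 x))) th))
    where
    x<k : toℕ x < firstA
    x<k = ≤-trans (Finₚ.toℕ<n x) (≤-trans (m≤n+m nVars 6) nv≤)
    own′ : ∀ i → reg (setReg s (toℕ x) v) (toℕ i) ≡ lookup (ρ [ x ]≔ v) i
    own′ i with i Fin.≟ x
    ... | yes refl = trans ([f↦]-hit (reg s) (toℕ i) v) (sym (Vecₚ.lookup∘updateAt i ρ))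
    ... | no i≢x   = trans ([f↦]-miss (reg s) (toℕ x) v (i≢x ∘ Finₚ.toℕ-injective))
                      (trans (o i) (sym (Vecₚ.lookup∘updateAt′ i x i≢x ρ)))

  tmp₁< : 1 + d₀ < firstA
  tmp₁< = ≤-trans (m≤n+m _ 2) nv≤

  copy-step : ∀ r {s v} → reg s d₀ ≡ v → v ≤ 2 ^ b →
              Exec (const (1 + d₀) 0 ⨾ arith add r d₀ (1 + d₀)) s (κ + κ)
                   (_≡ setReg (setReg s (1 + d₀) 0) r v)
  copy-step r {s} {v} refl v≤ = exec-seq {Q = _≡ s₁} (exec-const z≤n) λ where
      _ refl → exec-weaken ≤-refl (λ where _ refl → cong (setReg s₁ r) v≡)
                 (exec-arith {o = add} (subst (_≤ 2 ^ b) (sym x≡) v≤)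
                    (subst (_≤ 2 ^ b) (sym z≡) z≤n) (subst (_≤ 2 ^ b) (sym v≡) v≤))
    where
    s₁ = setReg s (1 + d₀) 0
    x≡ : reg s₁ d₀ ≡ v
    x≡ = [f↦]-miss (reg s) (1 + d₀) 0 (≢-sym 1+n≢n)
    z≡ : reg s₁ (1 + d₀) ≡ 0
    z≡ = [f↦]-hit (reg s) (1 + d₀) 0
    v≡ : reg s₁ d₀ + reg s₁ (1 + d₀) ≡ v
    v≡ = trans (cong₂ _+_ x≡ z≡) (+-identityʳ v)

  from-exec : ∀ {c ρ g} T (Q : Env → State → ℕ → Set) →
              (∀ s → Match ρ g s → Exec c s T λ s′ → ∃[ ρ′ ] ∃[ g′ ] (Match ρ′ g′ s′ × Q ρ′ g′ T)) → Run c ρ g Q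
  from-exec T Q p s mt with p s mt
  ... | s′ , t , e , t≤ , ρ′ , g′ , mt′ , q = ρ′ , g′ , s′ , t , T , e , t≤ , mt′ , q

  d₀≤4+nVars : d₀ ≤ 4 + nVars
  d₀≤4+nVars = m≤n+m d₀ 2

  run-:= : ∀ X x e ρ g → Ok e → Small B ρ → Fits B X e ρ →
           Run (x := e) ρ g (is (ρ [ x ]≔ eval e ρ) g (steps e X * κ + (κ + κ)))
  run-:= X x e ρ g ok ρ≤ fits = from-exec _ _ λ s mt →
    exec-seq (eval-step d₀ e ρ g s mt ok ≤-refl d₀≤4+nVars ρ≤ fits) λ s₁ (c , mt₁) →
    exec-weaken ≤-refl
      (λ where _ refl → _ , _ , setOwn-match x _ (setTmp-match (1 + d₀) 0 (n≤1+n _) tmp₁< mt₁) , refl , refl , refl)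
      (copy-step (toℕ x) (Computes.result c) (eval≤ e ρ ok ρ≤ fits))

  note-exec : ∀ r {g s} → Written r g s → reg g r ≤ 2 ^ b →
              Exec (note r) s κ λ s′ → Sim g s′ × SameOwn s s′
  note-exec r {g} {s} wr le with noted r wr (reg g r) ≤-refl
  note-exec (suc r) wr le | _ , _ , ⇓skip , _ , q = _ , _ , ⇓skip , 1≤κ , q
  note-exec zero {g} {s} wr le | _ , _ , ⇓arith , _ , q =
    _ , _ , ⇓arith , cost≤ bound , q
    where
    a≡ : reg s firstA ≡ reg g 0
    a≡ = trans (cong (reg s) (sym (+-identityʳ firstA))) (Written.regW wr 0)
    bound : reg s (1 + nVars) ⊔ reg s firstA ⊔ bit (reg s (1 + nVars) <ᵇ reg s firstA) ≤ 2 ^ b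
    bound = ⊔-lub (⊔-lub (subst (_≤ 2 ^ b) (sym (Written.thrW wr)) thr≤) (subst (_≤ 2 ^ b) (sym a≡) le))
                  (≤-trans (bit≤1 (reg s (1 + nVars) <ᵇ reg s firstA)) (1≤2^ b))

  match-trans : ∀ {ρ g g′ s s′} → Match ρ g s → SameOwn s s′ → Sim g′ s′ → Match ρ g′ s′
  match-trans mt so sm = match (λ i → trans (so (toℕ i) (Finₚ.toℕ<n i)) (own mt i)) sm

  run-setA : ∀ X r e ρ g → Ok e → Small B ρ → Fits B X e ρ →
             Run (setA r e) ρ g (is ρ (setReg g r (eval e ρ)) (steps e X * κ + (κ + κ) + κ))
  run-setA X r e ρ g ok ρ≤ fits = from-exec _ _ λ s mt →
    exec-seq {Q = λ s₁ → Written r (setReg g r (eval e ρ)) s₁ × (∀ i → reg s₁ (toℕ i) ≡ lookup ρ i)}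
      (exec-seq (eval-step d₀ e ρ g s mt ok ≤-refl d₀≤4+nVars ρ≤ fits) λ s₁ (c , mt₁) →
        exec-weaken ≤-refl
          (λ where
            _ refl → let mt₂ = setTmp-match (1 + d₀) 0 (n≤1+n _) tmp₁< mt₁ in
                     setA-written r _ (sms mt₂) ,
                     λ i → trans (setA-own (setReg s₁ (1 + d₀) 0) r _ (toℕ i) (Finₚ.toℕ<n i)) (own mt₂ i))
          (copy-step (firstA + r) (Computes.result c) (eval≤ e ρ ok ρ≤ fits)))
      λ s₂ (wr , ow) →
        exec-weaken ≤-refl
          (λ s₃ (sm , so) → _ , _ , match (λ i → trans (so (toℕ i) (Finₚ.toℕ<n i)) (ow i)) sm , refl , refl , refl)
          (note-exec r wr (subst (_≤ 2 ^ b) (sym ([f↦]-hit (reg g) r _)) (eval≤ e ρ ok ρ≤ fits)))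

  run-readFlag : ∀ x ρ g → Run (readFlag x) ρ g (is (ρ [ x ]≔ bit (thr <ᵇ reg g 0)) g (κ + κ))
  run-readFlag x ρ g = from-exec _ _ λ s mt →
    let mt₁ = setTmp-match {s = s} d₀ 0 ≤-refl (≤-trans (m≤n+m _ 3) nv≤) mt
        f≡ = flagA (sms mt₁)
        z≡ = [f↦]-hit (reg s) d₀ 0
        v≡ = trans (cong₂ _+_ f≡ z≡) (+-identityʳ _)
        f≤ = ≤-trans (bit≤1 (thr <ᵇ reg g 0)) (1≤2^ b)
    in exec-seq {Q = _≡ setReg s d₀ 0} (exec-const z≤n) λ where
      _ refl → exec-weaken ≤-refl
        (λ where _ refl → _ , _ , subst (λ z → Match (ρ [ x ]≔ z) g (setReg (setReg s d₀ 0) (toℕ x) (reg (setReg s d₀ 0) nVars + reg (setReg s d₀ 0) d₀))) v≡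
                                    (setOwn-match x _ mt₁) , refl , refl , refl)
        (exec-arith {o = add} (subst (_≤ 2 ^ b) (sym f≡) f≤) (subst (_≤ 2 ^ b) (sym z≡) z≤n) (subst (_≤ 2 ^ b) (sym v≡) f≤))

  run-loadA : ∀ X x e ρ g → Ok e → Small B ρ → Fits B X e ρ → mem g (eval e ρ) ≤ 2 ^ b →
              Run (loadA x e) ρ g (is (ρ [ x ]≔ mem g (eval e ρ)) g (steps e X * κ + κ))
  run-loadA X x e ρ g ok ρ≤ fits v≤ = from-exec _ _ λ s mt →
    exec-seq (eval-step d₀ e ρ g s mt ok ≤-refl d₀≤4+nVars ρ≤ fits) λ s₁ (c , mt₁) →
    let a≡ = Computes.result c
        v≡ = trans (cong (mem s₁) a≡) (memA (sms mt₁) _)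
    in _ , _ , ⇓load ,
       cost≤ (⊔-lub (subst (_≤ 2 ^ b) (sym a≡) (eval≤ e ρ ok ρ≤ fits)) (subst (_≤ 2 ^ b) (sym v≡) v≤)) ,
       _ , _ , subst (λ z → Match (ρ [ x ]≔ z) g (setReg s₁ (toℕ x) (mem s₁ (reg s₁ d₀)))) v≡ (setOwn-match x _ mt₁) ,
       refl , refl , refl

  run-storeA : ∀ X e f ρ g → Ok e → Ok f → Small B ρ → Fits B X e ρ → Fits B X f ρ →
               Run (storeA e f) ρ g
                 (is ρ (setMem g (eval e ρ) (eval f ρ)) (steps e X * κ + (steps f X * κ + κ)))
  run-storeA X e f ρ g oke okf ρ≤ fe ff = from-exec _ _ λ s mt →
    exec-seq (eval-step d₀ e ρ g s mt oke ≤-refl d₀≤4+nVars ρ≤ fe) λ s₁ (c₁ , mt₁) →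
    exec-seq (eval-step (1 + d₀) f ρ g s₁ mt₁ okf (n≤1+n _) (n≤1+n _) ρ≤ ff) λ s₂ (c₂ , mt₂) →
    let x≡ = trans (Agree.regs (Computes.frame c₂) d₀ (inj₁ ≤-refl)) (Computes.result c₁)
        y≡ = Computes.result c₂
    in _ , _ , ⇓store ,
       cost≤ (⊔-lub (subst (_≤ 2 ^ b) (sym x≡) (eval≤ e ρ oke ρ≤ fe)) (subst (_≤ 2 ^ b) (sym y≡) (eval≤ f ρ okf ρ≤ ff))) ,
       _ , _ , match (own mt₂) (sim (regA (sms mt₂)) (cells s₂ x≡ y≡ (memA (sms mt₂)))
                                    (tapeA (sms mt₂)) (flagA (sms mt₂)) (thrA (sms mt₂))) ,
       refl , refl , refl
    where
    cells : ∀ s → reg s d₀ ≡ eval e ρ → reg s (1 + d₀) ≡ eval f ρ → (∀ a → mem s a ≡ mem g a) →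
            ∀ a → (mem s [ reg s d₀ ↦ reg s (1 + d₀) ]) a ≡ (mem g [ eval e ρ ↦ eval f ρ ]) a
    cells s x≡ y≡ mm a rewrite x≡ | y≡ with a ≡ᵇ eval e ρ
    ... | true  = refl
    ... | false = mm a

  run-lift : ∀ {c g g′ t} ρ → MA.⟨ c , g ⟩⇓⟨ g′ , t ⟩ → Run (lift c) ρ g (is ρ g′ (W * t))
  run-lift ρ p = from-exec _ _ λ s mt →
    exec-weaken ≤-refl (λ s′ (sm , so) → _ , _ , match-trans mt so sm , refl , refl , refl) (simulate p (sms mt))

  run-ifnz : ∀ {x c d ρ g} (Q : Env → State → ℕ → Set) → lookup ρ x ≤ 2 ^ b →
             (lookup ρ x ≢ 0 → Run c ρ g (λ ρ′ g′ T → Q ρ′ g′ (κ + T))) →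
             (lookup ρ x ≡ 0 → Run d ρ g (λ ρ′ g′ T → Q ρ′ g′ (κ + T))) →
             Run (ifnz (toℕ x) c d) ρ g Q
  run-ifnz {x} {ρ = ρ} Q le p q s mt with lookup ρ x ≟ 0
  ... | yes z with q z s mt
  ...   | ρ′ , g′ , s′ , t , T , e , t≤ , mt′ , r =
    ρ′ , g′ , s′ , _ , κ + T , ⇓else (trans (own mt x) z) e ,
    +-mono-≤ (cost≤ (subst (_≤ 2 ^ b) (sym (own mt x)) le)) t≤ , mt′ , r
  run-ifnz {x} {ρ = ρ} Q le p q s mt | no nz with p nz s mt
  ...   | ρ′ , g′ , s′ , t , T , e , t≤ , mt′ , r =
    ρ′ , g′ , s′ , _ , κ + T , ⇓then (nz ∘ trans (sym (own mt x))) e ,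
    +-mono-≤ (cost≤ (subst (_≤ 2 ^ b) (sym (own mt x)) le)) t≤ , mt′ , r

  run-skip : ∀ ρ g → Run skip ρ g (is ρ g κ)
  run-skip ρ g s mt = ρ , g , s , 1 , κ , ⇓skip , 1≤κ , mt , refl , refl , refl

  B≤b : B ≤ b
  B≤b = ≤-trans (≤-trans (≤-reflexive (sym (*-identityˡ B))) (*-monoˡ-≤ B 1≤mw)) b≥

  -- I c ρ g t: with c iterations to go and after time t.  The body is
  -- entered with the counter already decremented.

  run-loop-step : ∀ {x body} (I : ℕ → Env → State → ℕ → Set) c {ρ g t} → lookup ρ x ≡ suc c → lookup ρ x ≤ 2 ^ b →
    Run (x := (var x ⊟ lit 1) ⨾ body) ρ g (λ ρ′ g′ T → I c ρ′ g′ (t + (κ + T))) →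
    (∀ ρ₁ g₁ T₁ → I c ρ₁ g₁ (t + (κ + T₁)) →
      Run (loop x body) ρ₁ g₁ (λ ρ′ g′ T → I 0 ρ′ g′ (t + (κ + T₁) + (T ∸ κ)) × κ ≤ T)) →
    Run (loop x body) ρ g (λ ρ′ g′ T → I 0 ρ′ g′ (t + (T ∸ κ)) × κ ≤ T)
  run-loop-step {x} I c {ρ} {g} {t} x≡ x≤ first rest s mt with first s mt
  ... | ρ₁ , g₁ , s₁ , t₁ , T₁ , e₁ , t₁≤ , mt₁ , i₁ with rest ρ₁ g₁ T₁ i₁ s₁ mt₁
  ...   | ρ₂ , g₂ , s₂ , t₂ , T₂ , e₂ , t₂≤ , mt₂ , i₂ , κ≤T₂ =
    ρ₂ , g₂ , s₂ , _ , κ + (T₁ + T₂) ,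
    ⇓loop (λ z → 0≢1+n (trans (sym z) (trans (own mt x) x≡))) e₁ e₂ ,
    +-mono-≤ (cost≤ (subst (_≤ 2 ^ b) (sym (own mt x)) x≤)) (+-mono-≤ t₁≤ t₂≤) ,
    mt₂ , subst (I 0 ρ₂ g₂) time i₂ , m≤m+n κ _
    where
    time : t + (κ + T₁) + (T₂ ∸ κ) ≡ t + (κ + (T₁ + T₂) ∸ κ)
    time = trans (+-assoc t (κ + T₁) _) (cong (t +_) (trans (sym (+-∸-assoc (κ + T₁) κ≤T₂)) (cong (_∸ κ) (+-assoc κ T₁ T₂))))

  run-decrement : ∀ {x body ρ g c} (Q : Env → State → ℕ → Set) → Ok (var x ⊟ lit 1) → lookup ρ x ≡ suc c → Small B ρ →
    Run body (ρ [ x ]≔ c) g (λ ρ′ g′ T → Q ρ′ g′ (7 * κ + T)) →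
    Run (x := (var x ⊟ lit 1) ⨾ body) ρ g (λ ρ′ g′ T → Q ρ′ g′ (κ + T))
  run-decrement {x} {ρ = ρ} {g} {c} Q ok x≡ ρ≤ p = run-seq (is (ρ [ x ]≔ c) g (6 * κ))
    (run-weaken (λ ρ′ g′ T (p , q , r) → trans p (cong (λ z → ρ [ x ]≔ (z ∸ 1)) x≡) , q , trans r (6κ κ))
      (run-:= 1 x (var x ⊟ lit 1) ρ g ok ρ≤ (tt , 1≤2^ B)))
    (λ where _ _ _ (refl , refl , refl) → run-weaken (λ ρ′ g′ T q → subst (Q ρ′ g′) (7κ κ T) q) p)
    where
    6κ : ∀ z → 4 * z + (z + z) ≡ 6 * z
    6κ = solve-∀
    7κ : ∀ z T → 7 * z + T ≡ z + (6 * z + T)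
    7κ = solve-∀

  -- The last test of the counter is kept out of the invariant, hence `T ∸ κ`; it is added again
  -- where the loop is used.
  run-loop : ∀ {x body} → Ok (var x ⊟ lit 1) → (I : ℕ → Env → State → ℕ → Set) →
    (∀ c ρ g t → I c ρ g t → lookup ρ x ≡ c × Small B ρ) →
    (∀ c ρ g t → I (suc c) ρ g t →
      Run body (ρ [ x ]≔ c) g (λ ρ′ g′ T → I c ρ′ g′ (t + (7 * κ + T)))) →
    ∀ c ρ g t → I c ρ g t → Run (loop x body) ρ g (λ ρ′ g′ T → I 0 ρ′ g′ (t + (T ∸ κ)) × κ ≤ T)
  run-loop {x} ok I ctr iter zero ρ g t i s mt =
    ρ , g , s , _ , κ , ⇓exit (trans (own mt x) (proj₁ (ctr 0 ρ g t i))) ,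
    cost≤ (subst (_≤ 2 ^ b) (sym (trans (own mt x) (proj₁ (ctr 0 ρ g t i)))) z≤n) , mt ,
    subst (I 0 ρ g) (sym (trans (cong (t +_) (n∸n≡0 κ)) (+-identityʳ t))) i , ≤-refl
  run-loop {x} ok I ctr iter (suc c) ρ g t i =
    let x≡ , ρ≤ = ctr (suc c) ρ g t i in
    run-loop-step I c x≡ (≤-trans (ρ≤ x) (2^-mono B≤b))
      (run-decrement (λ ρ′ g′ T → I c ρ′ g′ (t + T)) ok x≡ ρ≤ (iter c ρ g t i))
      (λ ρ₁ g₁ T₁ i₁ → run-loop ok I ctr iter c ρ₁ g₁ (t + (κ + T₁)) i₁)


  -- Without sums the loop bound is 0, so a common constant bounds the steps of each assignment. The
  -- indices compute the final environment and count the assignments.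
  data Straight (Z : ℕ) : Cmd → Env → Env → ℕ → Set where
    one  : ∀ {x ρ} e → Ok e → steps e 0 ≤ Z → Fits B 0 e ρ → eval e ρ ≤ 2 ^ B →
           Straight Z (x := e) ρ (ρ [ x ]≔ eval e ρ) 1
    more : ∀ {x ρ c ρ′ n} e → Ok e → steps e 0 ≤ Z → Fits B 0 e ρ → eval e ρ ≤ 2 ^ B →
           Straight Z c (ρ [ x ]≔ eval e ρ) ρ′ n → Straight Z (x := e ⨾ c) ρ ρ′ (suc n)

  run-one : ∀ {X Z x ρ} e g → Ok e → steps e X ≤ Z → Fits B X e ρ → eval e ρ ≤ 2 ^ B → Small B ρ →
            Run (x := e) ρ g (λ ρ″ g′ T →
              ρ″ ≡ ρ [ x ]≔ eval e ρ × g′ ≡ g × Small B (ρ [ x ]≔ eval e ρ) × T ≤ (2 + Z) * κ)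
  run-one {X} {Z} {x} {ρ} e g ok z f v ρ≤ = run-weaken
    (λ where _ _ _ (refl , refl , refl) → refl , refl , small-[]≔ B ρ x v ρ≤ ,
                ≤-trans (≤-reflexive (lem (steps e X) κ)) (*-monoˡ-≤ κ (+-monoʳ-≤ 2 z)))
    (run-:= X x e ρ g ok ρ≤ f)
    where
    lem : ∀ s k → s * k + (k + k) ≡ (2 + s) * k
    lem = solve-∀

  run-straight : ∀ {Z c ρ ρ′ n} → Straight Z c ρ ρ′ n → ∀ g → Small B ρ →
                 Run c ρ g (λ ρ″ g′ T → ρ″ ≡ ρ′ × g′ ≡ g × Small B ρ′ × T ≤ n * ((2 + Z) * κ))
  run-straight {Z} (one e ok z f v) g ρ≤ = run-weaken
    (λ where _ _ _ (p , q , sm , le) → p , q , sm , ≤-trans le (≤-reflexive (sym (*-identityˡ _))))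
    (run-one e g ok z f v ρ≤)
  run-straight {Z} (more e ok z f v rest) g ρ≤ = run-seq _ (run-one e g ok z f v ρ≤) λ where
    _ _ T (refl , refl , sm , le) → run-weaken
      (λ where _ _ U (p , q , sm′ , le′) → p , q , sm′ , +-mono-≤ le le′)
      (run-straight rest g sm)

  -- Registers and memory are functions, of which `Sim` sees only the values. This matters when the
  -- host hands its state to `preprocess`, which is known to run from `graphInput`.
  record _≐ₛ_ (g g′ : State) : Set where
    constructor pointwise
    field
      reg≐  : ∀ r → reg g r ≡ reg g′ r
      mem≐  : ∀ a → mem g a ≡ mem g′ a
      tape≐ : tape g ≡ tape g′

  run-swap : ∀ {c ρ g g′ Q} → g ≐ₛ g′ → Run c ρ g′ Q → Run c ρ g Q
  run-swap (pointwise rg mm tp) p s (match o (sim rA mA tA fA th)) = p s (match o (sim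
    (λ r → trans (rA r) (rg r)) (λ a → trans (mA a) (mm a)) (trans tA tp)
    (trans fA (cong (λ z → bit (thr <ᵇ z)) (rg 0))) th))

  ok : ∀ e {_ : True (width e ≤? maxW)} {_ : True ((4 + nVars) + size e ≤? tempEnd)} → Ok e
  ok e {p} {q} = toWitness p , toWitness q

  Z : ℕ
  Z = 30

  short : ∀ (e : Exp nVars) X {_ : True (steps e X ≤? Z)} → steps e X ≤ Z
  short e X {p} = toWitness p

  more′ : ∀ {x ρ c ρ′ n} e {_ : True (width e ≤? maxW)} {_ : True ((4 + nVars) + size e ≤? tempEnd)} {_ : True (steps e 0 ≤? Z)} →
          Fits B 0 e ρ → eval e ρ ≤ 2 ^ B → Straight Z c (ρ [ x ]≔ eval e ρ) ρ′ n → Straight Z (x := e ⨾ c) ρ ρ′ (suc n)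
  more′ e {p} {q} {r} = more e (ok e {p} {q}) (short e 0 {r})

  one′ : ∀ {x ρ} e {_ : True (width e ≤? maxW)} {_ : True ((4 + nVars) + size e ≤? tempEnd)} {_ : True (steps e 0 ≤? Z)} →
         Fits B 0 e ρ → eval e ρ ≤ 2 ^ B → Straight Z (x := e) ρ (ρ [ x ]≔ eval e ρ) 1
  one′ e {p} {q} {r} = one e (ok e {p} {q}) (short e 0 {r})

  record Cleared (bs : List Bool) (P : ℕ → ℕ → Set) (g : State) : Set where
    constructor cleared
    field
      regs0 : ∀ r → reg g r ≡ 0
      cells : ∀ a → P a (mem g a)
      bits  : tape g ≡ bs
  open Cleared public

  C₁ : ℕ
  C₁ = (7 + 3 + (2 + Z) + 4) * κ

  module Reading (N m K L L′ cnt : ℕ) (codeOf : ℕ → ℕ) (code< : ∀ i → codeOf i < 2 ^ N)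
                 (N≤ : N ≤ B) (F≤ : N * cnt ≤ B) (cnt≤ : cnt ≤ 2 ^ B) (bs : List Bool) where

    ρ₁ : (cnt F tmp : ℕ) → Env
    ρ₁ c F tmp = N ∷ m ∷ K ∷ L ∷ L′ ∷ c ∷ F ∷ tmp ∷ Vec.replicate 14 0

    W₀ : ℕ
    W₀ = 2 ^ N

    Cell : ℕ → ℕ → ℕ → Set
    Cell c a x = (a < c → x ≡ codeOf a) × (c ≤ a → x ≡ 0)

    record I (c : ℕ) (ρ : Env) (g : State) (t : ℕ) : Set where
      field
        k tmp : ℕ
        k≡    : c + k ≡ cnt
        ρ≡    : ρ ≡ ρ₁ c (horner codeOf W₀ c k) tmp
        small : Small B ρ
        clear : Cleared bs (Cell c) g
        time  : t ≤ k * C₁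

    horner≤ : ∀ c k → c + k ≡ cnt → horner codeOf W₀ c k ≤ 2 ^ B
    horner≤ c k k≡ = begin
      horner codeOf W₀ c k  ≤⟨ <⇒≤ (horner-< codeOf W₀ c k λ i _ → code< i) ⟩
      (2 ^ N) ^ k           ≡⟨ ^-*-assoc 2 N k ⟩
      2 ^ (N * k)           ≤⟨ 2^-mono (*-monoʳ-≤ N (subst (k ≤_) k≡ (m≤n+m k c))) ⟩
      2 ^ (N * cnt)         ≤⟨ 2^-mono F≤ ⟩
      2 ^ B                 ∎
      where open ≤-Reasoning

    iteration : ∀ c ρ g t → I (suc c) ρ g t →
      Run (loadA vTmp (var vCnt) ⨾ vF := (var vF ⊠ pow2 vN ⊞ var vTmp) ⨾ storeA (var vCnt) (lit 0))
          (ρ [ vCnt ]≔ c) g (λ ρ′ g′ T → I c ρ′ g′ (t + (7 * κ + T)))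
    iteration c ρ g t record { k = k ; tmp = tmp ; k≡ = k≡ ; ρ≡ = refl ; small = small ; clear = clear ; time = time } =
      run-seq _ (run-loadA 0 vTmp (var vCnt) (ρ₁ c X tmp) g (ok (var vCnt)) small₁ tt x≤b) λ where
        _ _ _ (refl , refl , refl) →
          run-seq _ (run-one {X = 0} (var vF ⊠ pow2 vN ⊞ var vTmp) g (ok (var vF ⊠ pow2 vN ⊞ var vTmp)) (short (var vF ⊠ pow2 vN ⊞ var vTmp) 0) ((tt , N≤) , tt)
                       (subst (_≤ 2 ^ B) new≡ (horner≤ c (suc k) k≡′)) small₂) λ where
            _ _ T₁ (refl , refl , small₃ , T₁≤) → run-weaken
              (λ where
                _ _ _ (refl , refl , refl) → record
                  { k = suc k ; tmp = mem g c ; k≡ = k≡′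
                  ; ρ≡ = cong (λ z → ρ₁ c z (mem g c)) (sym new≡) ; small = small₃
                  ; clear = cleared (regs0 clear) (cell (cells clear)) (bits clear)
                  ; time = time′ T₁ T₁≤ })
              (run-storeA 0 (var vCnt) (lit 0) (ρ₁ c (X * W₀ + mem g c) (mem g c)) g (ok (var vCnt)) (ok (lit 0)) small₃ tt z≤n)
      where
      X = horner codeOf W₀ (suc c) k
      k≡′ : c + suc k ≡ cnt
      k≡′ = trans (+-suc c k) k≡
      c≤ : c ≤ 2 ^ B
      c≤ = ≤-trans (subst (c ≤_) k≡′ (m≤m+n c (suc k))) cnt≤
      small₁ : Small B (ρ₁ c X tmp)
      small₁ = small-[]≔ B (ρ₁ (suc c) X tmp) vCnt c≤ small
      x≡ : mem g c ≡ codeOf c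
      x≡ = proj₁ (cells clear c) ≤-refl
      x≤B : mem g c ≤ 2 ^ B
      x≤B = subst (_≤ 2 ^ B) (sym x≡) (≤-trans (<⇒≤ (code< c)) (2^-mono N≤))
      x≤b : mem g c ≤ 2 ^ b
      x≤b = ≤-trans x≤B (2^-mono B≤b)
      small₂ : Small B (ρ₁ c X (mem g c))
      small₂ = small-[]≔ B (ρ₁ c X tmp) vTmp x≤B small₁
      new≡ : horner codeOf W₀ c (suc k) ≡ X * W₀ + mem g c
      new≡ = trans (+-comm (codeOf c) _) (cong₂ _+_ (*-comm W₀ X) (sym x≡))
      cell : (∀ a → Cell (suc c) a (mem g a)) → ∀ a → Cell c a ((mem g [ c ↦ 0 ]) a)
      cell old a with a ≟ c
      ... | yes refl = (λ lth → ⊥-elim (<-irrefl refl lth)) , λ _ → [f↦]-hit (mem g) c 0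
      ... | no a≢c = (λ lth → trans ([f↦]-miss (mem g) c 0 a≢c) (proj₁ (old a) (m<n⇒m<1+n lth))) ,
                     λ le → trans ([f↦]-miss (mem g) c 0 a≢c) (proj₂ (old a) (≤∧≢⇒< le (≢-sym a≢c)))
      time′ : ∀ T₁ → T₁ ≤ (2 + Z) * κ →
              t + (7 * κ + (2 * κ + κ + (T₁ + (2 * κ + (1 * κ + κ))))) ≤ suc k * C₁
      time′ T₁ T₁≤ = begin
        t + (7 * κ + (2 * κ + κ + (T₁ + (2 * κ + (1 * κ + κ)))))
          ≤⟨ +-mono-≤ time (+-monoʳ-≤ (7 * κ) (+-monoʳ-≤ (2 * κ + κ) (+-monoˡ-≤ _ T₁≤))) ⟩
        k * C₁ + (7 * κ + (2 * κ + κ + ((2 + Z) * κ + (2 * κ + (1 * κ + κ)))))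
          ≡⟨ cong (k * C₁ +_) (lem κ) ⟩
        k * C₁ + C₁
          ≡⟨ +-comm (k * C₁) C₁ ⟩
        suc k * C₁ ∎
        where
        open ≤-Reasoning
        lem : ∀ x → 7 * x + (2 * x + x + (32 * x + (2 * x + (1 * x + x)))) ≡ 46 * x
        lem = solve-∀

    run-readFormula : ∀ g → Cleared bs (Cell cnt) g → Small B (ρ₁ cnt 0 0) →
      Run readFormula (ρ₁ cnt 0 0) g λ ρ g′ T →
        (∃[ tmp ] (ρ ≡ ρ₁ 0 (horner codeOf W₀ 0 cnt) tmp)) × Small B ρ × Cleared bs (λ a x → x ≡ 0) g′ × T ≤ cnt * C₁ + κ
    run-readFormula g clear₀ small₀ = run-weaken
      (λ ρ g′ T (i , κ≤) → let open I i in
        (tmp , trans ρ≡ (cong (λ z → ρ₁ 0 (horner codeOf W₀ 0 z) tmp) k≡)) , small ,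
        cleared (regs0 clear) (λ a → proj₂ (cells clear a) z≤n) (bits clear) ,
        subst (_≤ cnt * C₁ + κ) (m∸n+n≡m κ≤) (+-monoˡ-≤ κ (subst (λ z → T ∸ κ ≤ z * C₁) k≡ time)))
      (run-loop (ok (var vCnt ⊟ lit 1)) I
        (λ c ρ g t i → let open I i in cong (λ ρ → lookup ρ vCnt) ρ≡ , small)
        iteration cnt (ρ₁ cnt 0 0) g 0
        record { k = 0 ; tmp = 0 ; k≡ = +-identityʳ cnt ; ρ≡ = refl ; small = small₀ ; clear = clear₀ ; time = z≤n })


  module Fixed (N m K L L′ F h 2h H M S R n : ℕ) where

    ρ₂ : (tmp cell u v τ j bt res : ℕ) → Env
    ρ₂ tmp cell u v τ j bt res =
      N ∷ m ∷ K ∷ L ∷ L′ ∷ 0 ∷ F ∷ tmp ∷ h ∷ 2h ∷ H ∷ M ∷ S ∷ R ∷ n ∷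
      cell ∷ u ∷ v ∷ τ ∷ j ∷ bt ∷ res ∷ []

    C₂ : ℕ → ℕ
    C₂ s = (7 + 2 * (2 + Z) + 3 + s) * κ

    module Writing (bs : List Bool) (tmp X : ℕ) (cellE : Exp nVars) (okE : Ok cellE) (value : ℕ → ℕ)
                   (fits : ∀ c u v → Fits B X cellE (ρ₂ tmp c u v 0 0 0 0))
                   (value≡ : ∀ c → c < n * n → eval cellE (ρ₂ tmp c (⟦ div ⟧ c n) (⟦ mod ⟧ c n) 0 0 0 0) ≡ value c)
                   (value-≥ : ∀ c → n * n ≤ c → value c ≡ 0)
                   (cells≤ : n * n ≤ 2 ^ B) where

      Cell : ℕ → ℕ → ℕ → Set
      Cell c a x = (a < c → x ≡ 0) × (c ≤ a → x ≡ value a)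

      C : ℕ
      C = C₂ (steps cellE X)

      ρₘ : ℕ → ℕ → ℕ → Env
      ρₘ c u v = ρ₂ tmp c u v 0 0 0 0

      record I (c : ℕ) (ρ : Env) (g : State) (t : ℕ) : Set where
        field
          u v   : ℕ
          c≤    : c ≤ n * n
          ρ≡    : ρ ≡ ρₘ c u v
          small : Small B ρ
          clear : Cleared bs (Cell c) g
          time  : t + c * C ≤ n * n * C

      iteration : ∀ c ρ g t → I (suc c) ρ g t →
        Run ((vu := arop quot (var vCell) (var vn) ⨾ vv := arop rem (var vCell) (var vn)) ⨾ storeA (var vCell) cellE)
            (ρ [ vCell ]≔ c) g (λ ρ′ g′ T → I c ρ′ g′ (t + (7 * κ + T)))
      iteration c ρ g t record { u = u ; v = v ; c≤ = c< ; ρ≡ = refl ; small = small ; clear = clear ; time = time } =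
        run-seq _ (run-straight
          (more′ (arop quot (var vCell) (var vn)) (tt , tt) (≤-trans (div-≤ c n) c≤B)
          (one′ (arop rem (var vCell) (var vn)) (tt , tt) (≤-trans (mod-≤ c n) c≤B)))
          g (small-[]≔ B (ρₘ (suc c) u v) vCell c≤B small)) λ where
          _ _ T₁ (refl , refl , small₁ , T₁≤) → run-weaken
            (λ where
              _ _ _ (refl , refl , refl) → record
                { u = ⟦ div ⟧ c n ; v = ⟦ mod ⟧ c n ; c≤ = <⇒≤ c< ; ρ≡ = refl ; small = small₁
                ; clear = cleared (regs0 clear) (cell (cells clear)) (bits clear)
                ; time = subst (_≤ n * n * C) (+-identityʳ _)
                    (bounded-time {t} {0} {_} {c} {C} {0}
                      (subst (_≤ n * n * C) (cong (t +_) (sym (+-identityʳ _))) time) (cost₁ T₁ T₁≤)) })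
            (run-storeA X (var vCell) cellE (ρₘ c (⟦ div ⟧ c n) (⟦ mod ⟧ c n)) g (ok (var vCell)) okE small₁ tt
              (fits c (⟦ div ⟧ c n) (⟦ mod ⟧ c n)))
        where
        c≤B : c ≤ 2 ^ B
        c≤B = ≤-trans (<⇒≤ c<) cells≤
        cell : (∀ a → Cell (suc c) a (mem g a)) →
               ∀ a → Cell c a ((mem g [ c ↦ eval cellE (ρₘ c (⟦ div ⟧ c n) (⟦ mod ⟧ c n)) ]) a)
        cell old a with a ≟ c
        ... | yes refl = (λ lth → ⊥-elim (<-irrefl refl lth)) ,
                         λ _ → trans ([f↦]-hit (mem g) c _) (value≡ c c<)
        ... | no a≢c = (λ lth → trans ([f↦]-miss (mem g) c _ a≢c) (proj₁ (old a) (m<n⇒m<1+n lth))) ,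
                       λ le → trans ([f↦]-miss (mem g) c _ a≢c) (proj₂ (old a) (≤∧≢⇒< le (≢-sym a≢c)))
        cost₁ : ∀ T₁ → T₁ ≤ 2 * ((2 + Z) * κ) → 7 * κ + (T₁ + (2 * κ + (steps cellE X * κ + κ))) ≤ C + 0
        cost₁ T₁ T₁≤ = begin
          7 * κ + (T₁ + (2 * κ + (steps cellE X * κ + κ)))
            ≤⟨ +-monoʳ-≤ (7 * κ) (+-monoˡ-≤ _ T₁≤) ⟩
          7 * κ + (2 * ((2 + Z) * κ) + (2 * κ + (steps cellE X * κ + κ)))
            ≡⟨ lem κ (steps cellE X) ⟩
          C + 0 ∎
          where
          open ≤-Reasoning
          lem : ∀ x s → 7 * x + (2 * (32 * x) + (2 * x + (s * x + x))) ≡ (7 + 2 * 32 + 3 + s) * x + 0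
          lem = solve-∀

      run-writeMatrix : ∀ g → Cleared bs (λ a x → x ≡ 0) g → Small B (ρₘ (n * n) 0 0) →
        Run (writeMatrix cellE) (ρₘ (n * n) 0 0) g λ ρ g′ T →
          (∃[ u ] ∃[ v ] (ρ ≡ ρₘ 0 u v)) × Small B ρ × Cleared bs (λ a x → x ≡ value a) g′ ×
          T ≤ n * n * C + κ
      run-writeMatrix g clear₀ small₀ = run-weaken
        (λ ρ g′ T (i , κ≤) → let open I i in
          (u , v , ρ≡) , small , cleared (regs0 clear) (λ a → proj₂ (cells clear a) z≤n) (bits clear) ,
          subst (_≤ n * n * C + κ) (m∸n+n≡m κ≤) (+-monoˡ-≤ κ (subst (_≤ n * n * C) (+-identityʳ _) time)))
        (run-loop (ok (var vCell ⊟ lit 1)) I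
          (λ c ρ g t i → let open I i in cong (λ ρ → lookup ρ vCell) ρ≡ , small)
          iteration (n * n) (ρₘ (n * n) 0 0) g 0
          record { u = 0 ; v = 0 ; c≤ = ≤-refl ; ρ≡ = refl ; small = small₀
                 ; clear = cleared (regs0 clear₀) (λ a → (λ _ → cells clear₀ a) , λ le → trans (cells clear₀ a) (sym (value-≥ a le))) (bits clear₀)
                 ; time = ≤-refl })


    C₄ : ℕ → ℕ
    C₄ s = (7 + (2 + s) + 1 + 5 + 8) * κ

    module Toggling (tmp cell u v τ res : ℕ) (m≤ : m ≤ 2 ^ B) (X : ℕ) (openE : Exp nVars) (okE : Ok openE)
                    (opened : ℕ → Bool)
                    (fits : ∀ j bt → Fits B X openE (ρ₂ tmp cell u v τ j bt res))
                    (opened≡ : ∀ j bt → eval openE (ρ₂ tmp cell u v τ j bt res) ≡ bit (opened j))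
                    (cmd : Cmd) (Ops : ℕ → State → ℕ → Set)
                    (op-step : ∀ c {g T} → c < m → Ops (suc c) g T → opened c ≡ true →
                      ∃[ g′ ] ∃[ t ] ∃[ T′ ] (MA.⟨ cmd , setReg (setReg g 0 c) 1 (M + c) ⟩⇓⟨ g′ , t ⟩ × Ops c g′ T′ × T ≡ t + T′))
                    (no-step : ∀ c {g T} → c < m → Ops (suc c) g T → opened c ≡ false → Ops c g T) where

      ρₚ : (j bt : ℕ) → Env
      ρₚ j bt = ρ₂ tmp cell u v τ j bt res

      Zo C : ℕ
      Zo = steps openE X
      C = C₄ Zo

      module _ (T₀ : ℕ) where

        record I (c : ℕ) (ρ : Env) (g : State) (t : ℕ) : Set where
          field
            bt rem-T : ℕ
            c≤      : c ≤ m
            ρ≡      : ρ ≡ ρₚ c bt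
            small   : Small B ρ
            session : Ops c g rem-T
            -- Only the total time of a session is guaranteed. What the rest of the session will
            -- take is therefore kept as credit, and a single slow update does no harm.
            time    : t + c * C + W * rem-T ≤ m * C + W * T₀

        cost-skip : ∀ T₁ → T₁ ≤ (2 + Zo) * κ → 7 * κ + (T₁ + (κ + κ)) ≤ C + 0
        cost-skip T₁ T₁≤ = begin
          7 * κ + (T₁ + (κ + κ))              ≤⟨ +-monoʳ-≤ (7 * κ) (+-monoˡ-≤ _ T₁≤) ⟩
          7 * κ + ((2 + Zo) * κ + (κ + κ))    ≤⟨ m≤m+n _ (12 * κ) ⟩
          7 * κ + ((2 + Zo) * κ + (κ + κ)) + 12 * κ ≡⟨ lem κ Zo ⟩
          C + 0                               ∎
          where
          open ≤-Reasoning
          lem : ∀ x s → 7 * x + ((2 + s) * x + (x + x)) + 12 * x ≡ (7 + (2 + s) + 1 + 5 + 8) * x + 0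
          lem = solve-∀

        cost-toggle : ∀ T₁ t′ → T₁ ≤ (2 + Zo) * κ →
          7 * κ + (T₁ + (κ + (2 * κ + (κ + κ) + κ + (5 * κ + (κ + κ) + κ + W * t′)))) ≤ C + W * t′
        cost-toggle T₁ t′ T₁≤ = begin
          7 * κ + (T₁ + (κ + (2 * κ + (κ + κ) + κ + (5 * κ + (κ + κ) + κ + W * t′))))
            ≤⟨ +-monoʳ-≤ (7 * κ) (+-monoˡ-≤ _ T₁≤) ⟩
          7 * κ + ((2 + Zo) * κ + (κ + (2 * κ + (κ + κ) + κ + (5 * κ + (κ + κ) + κ + W * t′))))
            ≡⟨ lem κ Zo (W * t′) ⟩
          C + W * t′ ∎
          where
          open ≤-Reasoning
          lem : ∀ x s y → 7 * x + ((2 + s) * x + (x + (2 * x + (x + x) + x + (5 * x + (x + x) + x + y)))) ≡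
                          (7 + (2 + s) + 1 + 5 + 8) * x + y
          lem = solve-∀

        module _ (c t : ℕ) {g : State} {TR : ℕ} (c< : c < m) (session : Ops (suc c) g TR)
                 (time : t + suc c * C + W * TR ≤ m * C + W * T₀)
                 (T₁ : ℕ) (T₁≤ : T₁ ≤ (2 + Zo) * κ) (small₂ : Small B (ρₚ c (bit (opened c)))) where

          untoggled : opened c ≡ false →
            Run skip (ρₚ c (bit (opened c))) g (λ ρ′ g′ T → I c ρ′ g′ (t + (7 * κ + (T₁ + (κ + T)))))
          untoggled o = run-weaken
            (λ where
              _ _ _ (refl , refl , refl) → record
                { bt = bit (opened c) ; rem-T = TR ; c≤ = <⇒≤ c< ; ρ≡ = refl ; small = small₂
                ; session = no-step c c< session o
                ; time = bounded-time {t} {W * TR} {_} {c} {C} {0}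
                    (subst (_≤ m * C + W * T₀) (+-assoc t _ _) time) (cost-skip T₁ T₁≤) })
            (run-skip (ρₚ c (bit (opened c))) g)

          toggled : opened c ≡ true →
            Run (setA 0 (var vj) ⨾ setA 1 (var vM ⊞ var vj) ⨾ lift cmd) (ρₚ c (bit (opened c))) g
                (λ ρ′ g′ T → I c ρ′ g′ (t + (7 * κ + (T₁ + (κ + T)))))
          toggled o with op-step c c< session o
          ... | g′ , t′ , TR′ , run , session′ , TR≡ =
            run-seq _ (run-setA 0 0 (var vj) (ρₚ c bt′) g (ok (var vj)) small₂ tt) λ where
              _ _ _ (refl , refl , refl) → run-seq _ (run-setA 0 1 (var vM ⊞ var vj) (ρₚ c bt′) (setReg g 0 c) (ok (var vM ⊞ var vj)) small₂ (tt , tt)) λ where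
                _ _ _ (refl , refl , refl) → run-weaken
                  (λ where
                    _ _ _ (refl , refl , refl) → record
                      { bt = bt′ ; rem-T = TR′ ; c≤ = <⇒≤ c< ; ρ≡ = refl ; small = small₂ ; session = session′
                      ; time = bounded-time {t} {W * TR′} {_} {c} {C} {W * t′}
                          (subst (λ z → t + (C + c * C + z) ≤ m * C + W * T₀) (trans (cong (W *_) TR≡) (*-distribˡ-+ W t′ TR′))
                            (subst (_≤ m * C + W * T₀) (+-assoc t _ _) time))
                          (cost-toggle T₁ t′ T₁≤) })
                  (run-lift (ρₚ c bt′) run)
            where
            bt′ = bit (opened c)

        is-true : ∀ x → bit x ≢ 0 → x ≡ true
        is-true true  _  = refl
        is-true false nz = ⊥-elim (nz refl)

        is-false : ∀ x → bit x ≡ 0 → x ≡ false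
        is-false false _ = refl

        bit≤2^ : ∀ x → bit x ≤ 2 ^ B
        bit≤2^ x = ≤-trans (bit≤1 x) (1≤2^ B)

        iteration : ∀ c ρ g t → I (suc c) ρ g t →
          Run (vBit := openE ⨾ ifnz (toℕ vBit) (setA 0 (var vj) ⨾ setA 1 (var vM ⊞ var vj) ⨾ lift cmd) skip)
              (ρ [ vj ]≔ c) g (λ ρ′ g′ T → I c ρ′ g′ (t + (7 * κ + T)))
        iteration c ρ g t record { bt = bt ; rem-T = TR ; c≤ = c< ; ρ≡ = refl ; small = small ; session = session ; time = time } =
          run-seq (λ ρ′ g′ T → ρ′ ≡ ρₚ c (bit (opened c)) × g′ ≡ g × Small B (ρₚ c (bit (opened c))) × T ≤ (2 + Zo) * κ)
            (subst (λ z → Run (vBit := openE) (ρₚ c bt) g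
                      (λ ρ′ g′ T → ρ′ ≡ ρₚ c z × g′ ≡ g × Small B (ρₚ c z) × T ≤ (2 + Zo) * κ)) (opened≡ c bt)
              (run-one {X = X} {Z = Zo} openE g okE ≤-refl (fits c bt) (subst (_≤ 2 ^ B) (sym (opened≡ c bt)) (bit≤2^ (opened c))) small₁)) λ where
            _ _ T₁ (refl , refl , small₂ , T₁≤) →
              run-ifnz _ (≤-trans (bit≤1 (opened c)) (1≤2^ b))
                (λ nz → toggled c t c< session time T₁ T₁≤ small₂ (is-true _ nz))
                (λ z → untoggled c t c< session time T₁ T₁≤ small₂ (is-false _ z))
          where
          small₁ : Small B (ρₚ c bt)
          small₁ = small-[]≔ B (ρₚ (suc c) bt) vj (≤-trans (<⇒≤ c<) m≤) small

        run-toggle : ∀ {g bt₀} → Small B (ρₚ m bt₀) → Ops m g T₀ →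
          Run (toggle openE cmd) (ρₚ m bt₀) g λ ρ g′ T →
            ∃[ bt′ ] ∃[ TR ] (ρ ≡ ρₚ 0 bt′ × Small B ρ × Ops 0 g′ TR × T + W * TR ≤ m * C + κ + W * T₀)
        run-toggle {g} {bt₀} small₀ session₀ = run-weaken
          (λ ρ g′ T (i , κ≤) → let open I i in
            bt , rem-T , ρ≡ , small , session , final T (W * rem-T) κ≤ (subst (λ z → z + W * rem-T ≤ m * C + W * T₀) (+-identityʳ _) time))
          (run-loop (ok (var vj ⊟ lit 1)) I
            (λ c ρ g t i → let open I i in cong (λ ρ → lookup ρ vj) ρ≡ , small)
            iteration m (ρₚ m bt₀) g 0
            record { bt = bt₀ ; rem-T = T₀ ; c≤ = ≤-refl ; ρ≡ = refl ; small = small₀ ; session = session₀ ; time = ≤-refl })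
          where
          final : ∀ T x → κ ≤ T → T ∸ κ + x ≤ m * C + W * T₀ → T + x ≤ m * C + κ + W * T₀
          final T x κ≤ le = begin
            T + x                     ≡⟨ cong (_+ x) (m∸n+n≡m κ≤) ⟨
            T ∸ κ + κ + x             ≡⟨ lem (T ∸ κ) κ x ⟩
            T ∸ κ + x + κ             ≤⟨ +-monoˡ-≤ κ le ⟩
            m * C + W * T₀ + κ        ≡⟨ lem (m * C) (W * T₀) κ ⟩
            m * C + κ + W * T₀        ∎
            where
            open ≤-Reasoning
            lem : ∀ a b c → a + b + c ≡ a + c + b
            lem = solve-∀

    C₃ : ℕ → ℕ
    C₃ s = (7 + 3 * (2 + Z) + 2) * κ + 2 * (m * C₄ s + κ)

    or-bits : ∀ x y → bit (0 <ᵇ bit x + bit y) ≡ bit (x ∨ y)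
    or-bits true  y     = refl
    or-bits false true  = refl
    or-bits false false = refl

    phase-time : ∀ {s t c bound TR ta TR₂ TR₃ T₁ T₂ T₃ T₄} →
      t + suc c * C₃ s + W * TR ≤ bound → T₁ ≤ (2 + Z) * κ → T₂ + W * (ta + TR₂) ≤ m * C₄ s + κ + W * TR →
      T₃ ≤ 2 * ((2 + Z) * κ) → T₄ + W * TR₃ ≤ m * C₄ s + κ + W * TR₂ →
      t + (7 * κ + (T₁ + (T₂ + (W * ta + (κ + κ + (T₃ + T₄)))))) + c * C₃ s + W * TR₃ ≤ bound
    phase-time {s} {t} {c} {bound} {TR} {ta} {TR₂} {TR₃} {T₁} {T₂} {T₃} {T₄} le T₁≤ T₂≤ T₃≤ T₄≤ = begin
      t + (7 * κ + (T₁ + (T₂ + (W * ta + (κ + κ + (T₃ + T₄)))))) + c * C₃ s + W * TR₃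
        ≡⟨ lem₁ t (7 * κ) T₁ T₂ (W * ta) (κ + κ) T₃ T₄ (c * C₃ s) (W * TR₃) ⟩
      t + (7 * κ + (T₁ + (T₂ + W * ta) + (κ + κ) + T₃ + (T₄ + W * TR₃))) + c * C₃ s
        ≤⟨ +-monoˡ-≤ (c * C₃ s) (+-monoʳ-≤ t (+-monoʳ-≤ (7 * κ)
             (+-mono-≤ (+-mono-≤ (+-monoˡ-≤ (κ + κ) (+-monoˡ-≤ (T₂ + W * ta) T₁≤)) T₃≤) T₄≤))) ⟩
      t + (7 * κ + ((2 + Z) * κ + (T₂ + W * ta) + (κ + κ) + 2 * ((2 + Z) * κ) + (m * C₄ s + κ + W * TR₂))) + c * C₃ s
        ≡⟨ lem₂ t (7 * κ) ((2 + Z) * κ) T₂ (W * ta) (κ + κ) (2 * ((2 + Z) * κ)) (m * C₄ s + κ) (W * TR₂) (c * C₃ s) ⟩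
      t + (7 * κ + ((2 + Z) * κ + (κ + κ) + 2 * ((2 + Z) * κ) + (m * C₄ s + κ))) + c * C₃ s + (T₂ + (W * ta + W * TR₂))
        ≡⟨ cong (λ z → t + (7 * κ + ((2 + Z) * κ + (κ + κ) + 2 * ((2 + Z) * κ) + (m * C₄ s + κ))) + c * C₃ s + (T₂ + z)) (*-distribˡ-+ W ta TR₂) ⟨
      t + (7 * κ + ((2 + Z) * κ + (κ + κ) + 2 * ((2 + Z) * κ) + (m * C₄ s + κ))) + c * C₃ s + (T₂ + W * (ta + TR₂))
        ≤⟨ +-monoʳ-≤ (t + (7 * κ + ((2 + Z) * κ + (κ + κ) + 2 * ((2 + Z) * κ) + (m * C₄ s + κ))) + c * C₃ s) T₂≤ ⟩
      t + (7 * κ + ((2 + Z) * κ + (κ + κ) + 2 * ((2 + Z) * κ) + (m * C₄ s + κ))) + c * C₃ s + (m * C₄ s + κ + W * TR)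
        ≡⟨ lem₃ t κ (m * C₄ s + κ) (c * C₃ s) (W * TR) ⟩
      t + suc c * C₃ s + W * TR
        ≤⟨ le ⟩
      bound ∎
      where
      open ≤-Reasoning
      lem₁ : ∀ t k a b w e f g c x → t + (k + (a + (b + (w + (e + (f + g)))))) + c + x ≡
                                     t + (k + (a + (b + w) + e + f + (g + x))) + c
      lem₁ = solve-∀
      lem₂ : ∀ t k a b w e f g x c → t + (k + (a + (b + w) + e + f + (g + x))) + c ≡
                                     t + (k + (a + e + f + g)) + c + (b + (w + x))
      lem₂ = solve-∀
      lem₃ : ∀ t k g c x → t + (7 * k + (32 * k + (k + k) + 2 * (32 * k) + g)) + c + (g + x) ≡
                           t + ((7 + 3 * 32 + 2) * k + 2 * g + c) + x
      lem₃ = solve-∀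

    module Phase-loop (Alg : DynamicAlgorithm) (opened : ℕ → ℕ → Bool) (operations : Operations wA m M Alg opened)
                      (tmp q u v : ℕ) (m≤ : m ≤ 2 ^ B) (X : ℕ) (openE : Exp nVars) (okE : Ok openE)
                      (fits : ∀ τ j bt res → Fits B X openE (ρ₂ tmp q u v τ j bt res))
                      (opened≡ : ∀ τ j bt res → eval openE (ρ₂ tmp q u v τ j bt res) ≡ bit (opened τ j))
                      (count : ℕ) (count≤ : count ≤ 2 ^ B) (goal : Bool) (T₀ : ℕ) where

      open Operations operations

      C : ℕ
      C = C₃ (steps openE X)

      record I (c : ℕ) (ρ : Env) (g : State) (t : ℕ) : Set where
        field
          {j bt rem-T} : ℕ
          {r}     : Bool
          {as}    : List ℕ
          c≤      : c ≤ count
          ρ≡      : ρ ≡ ρ₂ tmp q u v c j bt (bit r)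
          small   : Small B ρ
          session : Phases c g as rem-T
          target  : r ∨ anyAbove thr as ≡ goal
          time    : t + c * C + W * rem-T ≤ count * C + W * T₀

      bit≤2^ : ∀ x → bit x ≤ 2 ^ B
      bit≤2^ x = ≤-trans (bit≤1 x) (1≤2^ B)

      module _ (c t T₁ T₂ : ℕ) (g₂ : State) (ta : ℕ) {TR TR₂ : ℕ} {as′ : List ℕ} (r : Bool) (bt₁ : ℕ) (c< : c < count)
               (time : t + suc c * C + W * TR ≤ count * C + W * T₀) (T₁≤ : T₁ ≤ (2 + Z) * κ)
               (small₃ : Small B (ρ₂ tmp q u v c 0 bt₁ (bit r)))
               (T₂≤ : T₂ + W * (ta + TR₂) ≤ m * C₄ (steps openE X) + κ + W * TR)
               (closing : Closing c m g₂ as′ TR₂) (target : r ∨ ((thr <ᵇ reg g₂ 0) ∨ anyAbove thr as′) ≡ goal) where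

        f : Bool
        f = thr <ᵇ reg g₂ 0

        second-half : Run ((vRes := (lit 0 ≺ var vRes ⊞ var vBit) ⨾ vj := var vm) ⨾ toggle openE (deletion Alg))
          (ρ₂ tmp q u v c 0 (bit f) (bit r)) g₂
          (λ ρ′ g′ T → I c ρ′ g′ (t + (7 * κ + (T₁ + (T₂ + (W * ta + (κ + κ + T)))))))
        second-half =
          run-seq _ (run-straight
            (more′ (lit 0 ≺ var vRes ⊞ var vBit) (z≤n , tt , tt) (bit≤2^ (0 <ᵇ bit r + bit f)) (one′ (var vm) tt m≤)) g₂ small₄) λ where
            _ _ T₃ (refl , refl , small₅ , T₃≤) → run-weaken
              (λ where
                _ g′ T₄ (bt₂ , TR₃ , refl , small₆ , rest′ , T₄≤) → record
                  { r = r ∨ f ; c≤ = <⇒≤ c<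
                  ; ρ≡ = cong (ρ₂ tmp q u v c 0 bt₂) (or-bits r f) ; small = small₆ ; session = end-close rest′
                  ; target = trans (∨-assoc r f (anyAbove thr as′)) target
                  ; time = phase-time {steps openE X} {t} {c} {TR = TR} time T₁≤ T₂≤ T₃≤ T₄≤ })
              (Toggling.run-toggle tmp q u v c (bit (0 <ᵇ bit r + bit f)) m≤ X openE okE (opened c)
                 (λ j bt → fits c j bt _) (λ j bt → opened≡ c j bt _) (deletion Alg) (λ i g T → Closing c i g as′ T)
                 close-step close-skip TR₂ small₅ closing)
          where
          small₄ : Small B (ρ₂ tmp q u v c 0 (bit f) (bit r))
          small₄ = small-[]≔ B (ρ₂ tmp q u v c 0 bt₁ (bit r)) vBit (bit≤2^ f) small₃

      iteration : ∀ c ρ g t → I (suc c) ρ g t →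
        Run (phase openE Alg) (ρ [ vτ ]≔ c) g (λ ρ′ g′ T → I c ρ′ g′ (t + (7 * κ + T)))
      iteration c ρ g t record { j = j ; bt = bt ; rem-T = TR ; r = r ; as = as ; c≤ = c< ; ρ≡ = refl ; small = small
                               ; session = session ; target = target ; time = time } =
        run-seq _ (run-one {X = 0} {Z = Z} (var vm) g (ok (var vm)) (short (var vm) 0) tt m≤ small₁) λ where
          _ _ T₁ (refl , refl , small₂ , T₁≤) →
            run-seq _ (Toggling.run-toggle tmp q u v c (bit r) m≤ X openE okE (opened c)
                         (λ j bt → fits c j bt _) (λ j bt → opened≡ c j bt _) (insertion Alg) (λ i g T → Opening c i g as T)
                         open-step open-skip TR small₂ (begin-open session)) λ where
              _ g₁ T₂ (bt₁ , TR₁ , refl , small₃ , asking , T₂≤) → asked T₁ T₂ g₁ bt₁ TR₁ T₁≤ small₃ T₂≤ (ask asking)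
        where
        small₁ : Small B (ρ₂ tmp q u v c j bt (bit r))
        small₁ = small-[]≔ B (ρ₂ tmp q u v (suc c) j bt (bit r)) vτ (≤-trans (<⇒≤ c<) count≤) small
        asked : ∀ T₁ T₂ g₁ bt₁ TR₁ → T₁ ≤ (2 + Z) * κ → Small B (ρ₂ tmp q u v c 0 bt₁ (bit r)) →
          T₂ + W * TR₁ ≤ m * C₄ (steps openE X) + κ + W * TR →
          ∃[ g′ ] ∃[ t ] ∃[ as′ ] ∃[ T′ ] (MA.⟨ answer Alg , g₁ ⟩⇓⟨ g′ , t ⟩ × as ≡ reg g′ 0 ∷ as′ × Closing c m g′ as′ T′ × TR₁ ≡ t + T′) →
          Run (lift (answer Alg) ⨾ readFlag vBit ⨾ (vRes := (lit 0 ≺ var vRes ⊞ var vBit) ⨾ vj := var vm) ⨾ toggle openE (deletion Alg))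
              (ρ₂ tmp q u v c 0 bt₁ (bit r)) g₁ (λ ρ′ g′ T → I c ρ′ g′ (t + (7 * κ + (T₁ + (T₂ + T)))))
        asked T₁ T₂ g₁ bt₁ TR₁ T₁≤ small₃ T₂≤ (g₂ , ta , as′ , TR₂ , run , as≡ , closing , TR≡) =
          run-seq _ (run-lift (ρ₂ tmp q u v c 0 bt₁ (bit r)) run) λ where
            _ _ _ (refl , refl , refl) →
              run-seq _ (run-readFlag vBit (ρ₂ tmp q u v c 0 bt₁ (bit r)) g₂) λ where
                _ _ _ (refl , refl , refl) →
                  second-half c t T₁ T₂ g₂ ta r bt₁ c< time T₁≤ small₃
                    (subst (λ z → T₂ + W * z ≤ m * C₄ (steps openE X) + κ + W * TR) TR≡ T₂≤) closing
                    (trans (cong (λ as → r ∨ anyAbove thr as) (sym as≡)) target)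

      run-phases : ∀ {g as} → Small B (ρ₂ tmp q u v count 0 0 0) → Phases count g as T₀ → anyAbove thr as ≡ goal →
        Run (loop vτ (phase openE Alg)) (ρ₂ tmp q u v count 0 0 0) g λ ρ g′ T →
          (∃[ j ] ∃[ bt ] (ρ ≡ ρ₂ tmp q u v 0 j bt (bit goal))) × Small B ρ × T ≤ count * C + W * T₀ + κ
      run-phases {g} {as} small₀ session₀ goal≡ = run-weaken
        (λ ρ g′ T (i , κ≤) → finish i κ≤)
        (run-loop (ok (var vτ ⊟ lit 1)) I
          (λ c ρ g t i → let open I i in cong (λ ρ → lookup ρ vτ) ρ≡ , small)
          iteration count (ρ₂ tmp q u v count 0 0 0) g 0
          record { r = false ; c≤ = ≤-refl ; ρ≡ = refl ; small = small₀ ; session = session₀ ; target = goal≡ ; time = ≤-refl })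
        where
        finish : ∀ {ρ g′ T} → I 0 ρ g′ (T ∸ κ) → κ ≤ T →
          (∃[ j ] ∃[ bt ] (ρ ≡ ρ₂ tmp q u v 0 j bt (bit goal))) × Small B ρ × T ≤ count * C + W * T₀ + κ
        finish {T = T} record { j = j ; bt = bt ; r = r ; ρ≡ = refl ; small = small ; session = end ; target = target ; time = time } κ≤ =
          (j , bt , cong (ρ₂ tmp q u v 0 j bt) (cong bit (trans (sym (∨-identityʳ r))
            (trans (cong (λ as → r ∨ anyAbove thr as) (sym (finished end))) target)))) , small ,
          subst (_≤ count * C + W * T₀ + κ) (m∸n+n≡m κ≤)
            (+-monoˡ-≤ κ (≤-trans (m≤m+n _ _) (≤-trans (m≤m+n _ (W * _)) time)))

  module Body-run (N m K d ℓ′ : ℕ) .{{_ : NonZero N}} (codeOf : ℕ → ℕ) (code< : ∀ i → codeOf i < 2 ^ N) where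

    h H M S R n cnt F q : ℕ
    h   = ⟦ div ⟧ N d
    H   = 2 ^ h
    M   = suc m
    S   = M + M
    R   = suc (H + H)
    n   = S + R + R * S * suc ℓ′
    cnt = m * K
    F   = horner codeOf (2 ^ N) 0 cnt
    q   = N ∸ (h + h)

    open Fixed N m K (suc ℓ′) ℓ′ F h (h + h) H M S R n public

    record Bounds : Set where
      field
        N≤     : N ≤ B
        F≤     : N * cnt ≤ B
        cells≤ : n * n ≤ 2 ^ B
        K≤     : K ≤ 2 ^ B
        d≤     : d ≤ 2 ^ B
        ℓ≤     : suc ℓ′ ≤ 2 ^ B
        2h≤N   : h + h ≤ N

    module _ (bounds : Bounds) where

      open Bounds bounds

      ≤2^B : ∀ {x} → x ≤ B → x ≤ 2 ^ B
      ≤2^B p = ≤-trans p (<⇒≤ (n<2^n B))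

      n≤ : n ≤ 2 ^ B
      n≤ = ≤-trans (m≤m*n n n) cells≤

      S≤n : S ≤ n
      S≤n = ≤-trans (m≤m+n S R) (m≤m+n (S + R) _)

      M≤n : M ≤ n
      M≤n = ≤-trans (m≤m+n M M) S≤n

      R≤n : R ≤ n
      R≤n = ≤-trans (m≤n+m R S) (m≤m+n (S + R) _)

      m≤ : m ≤ 2 ^ B
      m≤ = ≤-trans (≤-trans (n≤1+n m) M≤n) n≤

      cnt≤ : cnt ≤ 2 ^ B
      cnt≤ = ≤2^B (≤-trans (m≤n*m cnt N) F≤)

      h≤N : h ≤ N
      h≤N = ≤-trans (m≤m+n h h) 2h≤N

      q≤B : q ≤ B
      q≤B = ≤-trans (m∸n≤m N (h + h)) N≤

      ρ₀ : Env
      ρ₀ = N ∷ m ∷ Vec.replicate 20 0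

      small₀ : Small B ρ₀
      small₀ = small-∷ B (≤2^B N≤) (small-∷ B m≤ λ i → subst (_≤ 2 ^ B) (sym (Vecₚ.lookup-replicate i 0)) z≤n)

      ρ₁ : (cnt F tmp : ℕ) → Env
      ρ₁ = Reading.ρ₁ N m K (suc ℓ′) ℓ′ cnt codeOf code< N≤ F≤ cnt≤ []

      run-initialise : ∀ g → Run (initialise K d ℓ′) ρ₀ g λ ρ g′ T →
        ρ ≡ ρ₁ cnt 0 0 × g′ ≡ g × Small B (ρ₁ cnt 0 0) × T ≤ 4 * ((2 + Z) * κ)
      run-initialise g = run-straight
        (more′ (lit K) K≤ K≤
        (more′ (lit (suc ℓ′)) ℓ≤ ℓ≤
        (more′ (lit ℓ′) (≤-trans (n≤1+n ℓ′) ℓ≤) (≤-trans (n≤1+n ℓ′) ℓ≤)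
        (one′ (var vm ⊠ var vK) (tt , tt) cnt≤)))) g small₀

      run-setParameters : ∀ tmp g → Small B (ρ₁ 0 F tmp) →
        Run (setParameters K d ℓ′) (ρ₁ 0 F tmp) g λ ρ g′ T →
          ρ ≡ ρ₂ tmp (n * n) 0 0 0 0 0 0 × g′ ≡ g × Small B (ρ₂ tmp (n * n) 0 0 0 0 0 0) ×
          T ≤ 8 * ((2 + Z) * κ)
      run-setParameters tmp g = run-straight
        (more′ (arop quot (var vN) (lit d)) (tt , d≤) (≤2^B (≤-trans h≤N N≤))
        (more′ (var vh ⊞ var vh) (tt , tt) (≤2^B (≤-trans 2h≤N N≤))
        (more′ (pow2 vh) (≤-trans h≤N N≤) (2^-mono (≤-trans h≤N N≤))
        (more′ (lit 1 ⊞ var vm) (1≤2^ B , tt) (≤-trans M≤n n≤)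
        (more′ (var vM ⊞ var vM) (tt , tt) (≤-trans S≤n n≤)
        (more′ (lit 1 ⊞ (var vH ⊞ var vH)) (1≤2^ B , tt , tt) (≤-trans R≤n n≤)
        (more′ (var vS ⊞ var vR ⊞ var vR ⊠ var vS ⊠ var vL) ((tt , tt) , (tt , tt) , tt) n≤
        (one′ (var vn ⊠ var vn) (tt , tt) cells≤)))))))) g

      module _ (Alg : DynamicAlgorithm) (opened : ℕ → ℕ → Bool) (operations : Operations wA m M Alg opened)
               (value : ℕ → ℕ) (value-≥ : ∀ c → n * n ≤ c → value c ≡ 0)
               (X : ℕ) (cellE : Exp nVars) (okC : Ok cellE)
               (fitsC : ∀ tmp c u v → Fits B X cellE (ρ₂ tmp c u v 0 0 0 0))
               (value≡ : ∀ tmp c → c < n * n → eval cellE (ρ₂ tmp c (⟦ div ⟧ c n) (⟦ mod ⟧ c n) 0 0 0 0) ≡ value c)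
               (Y : ℕ) (openE : Exp nVars) (okO : Ok openE)
               (fitsO : ∀ tmp cell u v τ j bt res → Fits B Y openE (ρ₂ tmp cell u v τ j bt res))
               (opened≡ : ∀ tmp cell u v τ j bt res → eval openE (ρ₂ tmp cell u v τ j bt res) ≡ bit (opened τ j)) where

        total : (tp TS : ℕ) → ℕ
        total tp TS = overheadTime κ n cnt (steps cellE X) + W * tp + (2 ^ q * phaseTime κ m (steps openE Y) + W * TS)

        module _ (bs : List Bool) {gi gs : State} {tp TS : ℕ} {as : List ℕ}
                 (reg0 : reg gi 0 ≡ n) (reg+ : ∀ r → reg gi (suc r) ≡ 0) (memory : ∀ a → mem gi a ≡ value a)
                 (random : tape gi ≡ bs)
                 (pre : MA.⟨ preprocess Alg , gi ⟩⇓⟨ gs , tp ⟩)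
                 (session : Operations.Phases operations (2 ^ q) gs as TS) where

          goal : Bool
          goal = anyAbove thr as

          sum-up : ∀ {T₁ T₂ T₃ T₄ T₆ T₇ T₈} → T₁ ≤ 4 * ((2 + Z) * κ) → T₂ ≤ cnt * C₁ + κ → T₃ ≤ 8 * ((2 + Z) * κ) →
            T₄ ≤ n * n * C₂ (steps cellE X) + κ → T₆ ≤ 2 * ((2 + Z) * κ) →
            T₇ ≤ 2 ^ q * C₃ (steps openE Y) + W * TS + κ → T₈ ≤ (2 + Z) * κ →
            κ + (T₁ + (T₂ + (T₃ + (T₄ + (2 * κ + (κ + κ) + κ + (W * tp + (T₆ + (T₇ + T₈)))))))) ≤ total tp TS
          sum-up {T₁} {T₂} {T₃} {T₄} {T₆} {T₇} {T₈} p₁ p₂ p₃ p₄ p₆ p₇ p₈ = begin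
            κ + (T₁ + (T₂ + (T₃ + (T₄ + (2 * κ + (κ + κ) + κ + (W * tp + (T₆ + (T₇ + T₈))))))))
              ≤⟨ +-monoʳ-≤ κ (+-mono-≤ p₁ (+-mono-≤ p₂ (+-mono-≤ p₃ (+-mono-≤ p₄ (+-monoʳ-≤ (2 * κ + (κ + κ) + κ)
                   (+-monoʳ-≤ (W * tp) (+-mono-≤ p₆ (+-mono-≤ p₇ p₈)))))))) ⟩
            κ + (4 * ((2 + Z) * κ) + (cnt * C₁ + κ + (8 * ((2 + Z) * κ) + (n * n * C₂ (steps cellE X) + κ +
              (2 * κ + (κ + κ) + κ + (W * tp + (2 * ((2 + Z) * κ) + (2 ^ q * C₃ (steps openE Y) + W * TS + κ + (2 + Z) * κ))))))))
              ≡⟨ lem κ (4 * ((2 + Z) * κ)) (cnt * C₁ + κ) (8 * ((2 + Z) * κ)) (n * n * C₂ (steps cellE X) + κ)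
                   (W * tp) (2 * ((2 + Z) * κ)) (2 ^ q * C₃ (steps openE Y) + W * TS) ((2 + Z) * κ) ⟩
            κ + (4 * ((2 + Z) * κ) + (cnt * C₁ + κ + (8 * ((2 + Z) * κ) + (n * n * C₂ (steps cellE X) + κ + 5 * κ)))) +
              2 * ((2 + Z) * κ) + κ + (2 + Z) * κ + W * tp + (2 ^ q * C₃ (steps openE Y) + W * TS)
              ≡⟨ cong (λ z → z + W * tp + (2 ^ q * C₃ (steps openE Y) + W * TS))
                   (lem′ κ ((2 + Z) * κ) (cnt * C₁) (n * n * C₂ (steps cellE X))) ⟩
            total tp TS ∎
            where
            open ≤-Reasoning
            lem′ : ∀ x z c w → x + (4 * z + (c + x + (8 * z + (w + x + 5 * x)))) + 2 * z + x + z ≡ w + (c + (9 * x + 15 * z))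
            lem′ = solve-∀
            lem : ∀ k a b c d w e p z →
              k + (a + (b + (c + (d + (2 * k + (k + k) + k + (w + (e + (p + k + z)))))))) ≡
              k + (a + (b + (c + (d + 5 * k)))) + e + k + z + w + p
            lem = solve-∀

          ready : ∀ g → Cleared bs (λ a x → x ≡ value a) g → setReg g 0 n ≐ₛ gi
          ready g (cleared rg cl tp) = pointwise
            (λ where
              zero    → sym reg0
              (suc r) → trans (rg (suc r)) (sym (reg+ r)))
            (λ a → trans (cl a) (sym (memory a))) (trans tp (sym random))

          Final : Env → State → ℕ → Set
          -- The additional `κ` pays for storing the threshold, which precedes `body`.
          Final ρ g T = lookup ρ vN ≡ bit goal × κ + T ≤ total tp TS

          run-body : ∀ g → Cleared bs (λ a x → (a < cnt → x ≡ codeOf a) × (cnt ≤ a → x ≡ 0)) g →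
                     Run (body K d ℓ′ cellE openE Alg) ρ₀ g Final
          run-body g₀ clear₀ =
            run-seq _ (run-initialise g₀) λ where
              _ _ T₁ (refl , refl , small₁ , T₁≤) →
                run-seq _ (Reading.run-readFormula N m K (suc ℓ′) ℓ′ cnt codeOf code< N≤ F≤ cnt≤ bs g₀ clear₀ small₁) λ where
                  _ g₂ T₂ ((tmp , refl) , small₂ , clear₂ , T₂≤) →
                    run-seq _ (run-setParameters tmp g₂ small₂) λ where
                      _ _ T₃ (refl , refl , small₃ , T₃≤) →
                        run-seq _ (Writing.run-writeMatrix bs tmp X cellE okC value (fitsC tmp) (value≡ tmp) value-≥ cells≤ g₂ clear₂ small₃) λ where
                          _ g₄ T₄ ((u , v , refl) , small₄ , clear₄ , T₄≤) →
                            run-seq _ (run-setA 0 0 (var vn) (ρ₂ tmp 0 u v 0 0 0 0) g₄ (ok (var vn)) small₄ tt) λ where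
                              _ _ _ (refl , refl , refl) → run-swap (ready g₄ clear₄)
                                (run-seq _ (run-lift (ρ₂ tmp 0 u v 0 0 0 0) pre) λ where
                                  _ _ _ (refl , refl , refl) → run-weaken
                                    (λ _ _ _ (e , bound) → e , bound T₁ T₂ T₃ T₄ T₁≤ T₂≤ T₃≤ T₄≤)
                                    (phases tmp u v small₄))
            where
            phases : ∀ tmp u v → Small B (ρ₂ tmp 0 u v 0 0 0 0) →
              Run ((vCell := (var vN ⊟ var v2h) ⨾ vτ := pow2 vCell) ⨾ loop vτ (phase openE Alg) ⨾ vN := var vRes)
                  (ρ₂ tmp 0 u v 0 0 0 0) gs λ ρ g T → lookup ρ vN ≡ bit goal ×
                    (∀ T₁ T₂ T₃ T₄ → T₁ ≤ 4 * ((2 + Z) * κ) → T₂ ≤ cnt * C₁ + κ → T₃ ≤ 8 * ((2 + Z) * κ) →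
                     T₄ ≤ n * n * C₂ (steps cellE X) + κ →
                     κ + (T₁ + (T₂ + (T₃ + (T₄ + (2 * κ + (κ + κ) + κ + (W * tp + T)))))) ≤ total tp TS)
            phases tmp u v small₄ =
              run-seq _ (run-straight
                (more′ (var vN ⊟ var v2h) (tt , tt) (≤2^B q≤B) (one′ (pow2 vCell) q≤B (2^-mono q≤B))) gs small₄) λ where
                _ _ T₆ (refl , refl , small₆ , T₆≤) →
                  run-seq _ (Phase-loop.run-phases Alg opened operations tmp q u v m≤ Y openE okO (λ τ j bt res → fitsO tmp q u v τ j bt res)
                               (λ τ j bt res → opened≡ tmp q u v τ j bt res) (2 ^ q) (2^-mono q≤B) goal TS small₆ session refl) λ where
                    _ g₇ T₇ ((j , bt , refl) , small₇ , T₇≤) → run-weaken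
                      (λ where
                        _ _ T₈ (refl , refl , _ , T₈≤) → refl , λ _ _ _ _ p₁ p₂ p₃ p₄ → sum-up p₁ p₂ p₃ p₄ T₆≤ T₇≤ T₈≤)
                      (run-one {X = 0} {Z = Z} (var vRes) g₇ (ok (var vRes)) (short (var vRes) 0) tt
                         (≤-trans (bit≤1 goal) (1≤2^ B)) small₇)

          run-solver : ∀ memory₀ → (∀ a → (a < cnt → memory₀ a ≡ codeOf a) × (cnt ≤ a → memory₀ a ≡ 0)) →
            ∃[ s ] ∃[ t ] (⟨ const (1 + nVars) thr ⨾ body K d ℓ′ cellE openE Alg , ⟪ contents (N ∷ m ∷ []) , memory₀ , bs ⟫ ⟩⇓⟨ s , t ⟩ ×
              reg s 0 ≡ bit (anyAbove thr as) ×
              t ≤ overheadTime (suc b ^ 2) n cnt (steps cellE X) + slowdown thr wA * tp +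
                  (2 ^ q * phaseTime (suc b ^ 2) m (steps openE Y) + slowdown thr wA * TS))
          run-solver memory₀ memory≡ = finish (run-body g₀ clear₀ s₁ match₁)
            where
            s₀ s₁ g₀ : State
            s₀ = ⟪ contents (N ∷ m ∷ []) , memory₀ , bs ⟫
            s₁ = setReg s₀ (1 + nVars) thr
            g₀ = ⟪ (λ _ → 0) , memory₀ , bs ⟫
            own₁ : ∀ i → reg s₁ (toℕ i) ≡ lookup ρ₀ i
            own₁ zero       = refl
            own₁ (suc zero) = refl
            own₁ (suc (suc i)) = trans
              ([f↦]-miss (reg s₀) (1 + nVars) thr (<⇒≢ (≤-trans (Finₚ.toℕ<n (suc (suc i))) (n≤1+n nVars))))
              (sym (Vecₚ.lookup-replicate i 0))
            zero-regs : ∀ r → reg s₁ (firstA + r) ≡ 0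
            zero-regs r = trans ([f↦]-miss (reg s₀) (1 + nVars) thr (≢-sym (k+≢ 2+v≤k))) (beyond (firstA + r) (≤-trans 2≤firstA (m≤m+n firstA r)))
              where
              2≤firstA : 2 ≤ firstA
              2≤firstA = ≤-trans (from-yes (2 ≤? 28)) nv≤
              beyond : ∀ x → 2 ≤ x → contents (N ∷ m ∷ []) x ≡ 0
              beyond (suc (suc x)) _ = refl
              beyond (suc zero) (s≤s ())
            match₁ : Match ρ₀ g₀ s₁
            match₁ = match own₁ (sim zero-regs (λ a → refl) refl refl refl)
            clear₀ : Cleared bs (λ a x → (a < cnt → x ≡ codeOf a) × (cnt ≤ a → x ≡ 0)) g₀
            clear₀ = cleared (λ _ → refl) memory≡ refl
            finish : ∃[ ρ′ ] ∃[ g′ ] ∃[ s′ ] ∃[ t ] ∃[ T ] (⟨ body K d ℓ′ cellE openE Alg , s₁ ⟩⇓⟨ s′ , t ⟩ × t ≤ T ×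
                       Match ρ′ g′ s′ × Final ρ′ g′ T) →
                     ∃[ s ] ∃[ t ] (⟨ const (1 + nVars) thr ⨾ body K d ℓ′ cellE openE Alg , s₀ ⟩⇓⟨ s , t ⟩ ×
                       reg s 0 ≡ bit (anyAbove thr as) ×
                       t ≤ overheadTime (suc b ^ 2) n cnt (steps cellE X) + slowdown thr wA * tp +
                           (2 ^ q * phaseTime (suc b ^ 2) m (steps openE Y) + slowdown thr wA * TS))
            finish (ρ′ , g′ , s′ , t , T , e , t≤ , mt , (res , T≤)) =
              s′ , _ , ⇓seq ⇓const e , trans (own mt vN) res ,
              subst (λ κ → _ ≤ overheadTime κ n cnt (steps cellE X) + slowdown thr wA * tp +
                                (2 ^ q * phaseTime κ m (steps openE Y) + slowdown thr wA * TS)) κ≡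
                (≤-trans (+-mono-≤ (cost≤ thr≤) t≤) T≤)


-- Polynomial factors and exponential savings.

IsPoly : (ℕ → ℕ) → Set
IsPoly f = ∃[ C ] (∀ N → .{{NonZero N}} → f N ≤ C * N ^ C)

poly-raise : ∀ N .{{_ : NonZero N}} {c C k K} → c ≤ C → k ≤ K → c * N ^ k ≤ C * N ^ K
poly-raise N c≤ k≤ = *-mono-≤ c≤ (^-monoʳ-≤ N k≤)

poly-const : ∀ c → IsPoly (λ _ → c)
poly-const c = c , λ N → ≤-trans (≤-reflexive (sym (*-identityʳ c))) (poly-raise N {c} {c} {0} {c} ≤-refl z≤n)

poly-id : IsPoly (λ N → N)
poly-id = 1 , λ N → ≤-reflexive (sym (trans (*-identityˡ (N ^ 1)) (^-identityʳ N)))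

poly-+ : ∀ {f g} → IsPoly f → IsPoly g → IsPoly (λ N → f N + g N)
poly-+ (C , p) (D , q) = C + D , λ N → ≤-trans
  (+-mono-≤ (≤-trans (p N) (poly-raise N {C} ≤-refl (m≤m+n C D))) (≤-trans (q N) (poly-raise N {D} ≤-refl (m≤n+m D C))))
  (≤-reflexive (sym (*-distribʳ-+ (N ^ (C + D)) C D)))

poly-* : ∀ {f g} → IsPoly f → IsPoly g → IsPoly (λ N → f N * g N)
poly-* (C , p) (D , q) = C * D + (C + D) , λ N → ≤-trans (*-mono-≤ (p N) (q N))
  (≤-trans (≤-reflexive (trans (lem C (N ^ C) D (N ^ D)) (cong (C * D *_) (sym (^-distribˡ-+-* N C D)))))
    (poly-raise N (m≤m+n (C * D) (C + D)) (m≤n+m (C + D) (C * D))))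
  where
  lem : ∀ a b c d → a * b * (c * d) ≡ a * c * (b * d)
  lem = solve-∀

poly-^ : ∀ k {f} → IsPoly f → IsPoly (λ N → f N ^ k)
poly-^ zero    p = poly-const 1
poly-^ (suc k) p = poly-* p (poly-^ k p)

-- x ^ q · H ≤ (p y) ^ q, so that x is smaller than p y by a factor H ^ (1/q).

module Saving (q H : ℕ) where

  record Saves (x p y : ℕ) : Set where
    constructor saves
    field
      saving : x ^ q * H ≤ (p * y) ^ q
  open Saves

  saves-≤ : ∀ {x x′ p y} → x ≤ x′ → Saves x′ p y → Saves x p y
  saves-≤ x≤ (saves s) = saves (≤-trans (*-monoˡ-≤ H (^-monoˡ-≤ q x≤)) s)

  -- The saving concerns q-th powers, which are not additive; but the sum is at most twice the
  -- maximum, and the maximum is one of the two. This is the origin of the factor 2.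
  saves-+ : ∀ {x x′ p p′ y} → Saves x p y → Saves x′ p′ y → Saves (x + x′) (2 * (p + p′)) y
  saves-+ {x} {x′} {p} {p′} {y} (saves s) (saves s′) = saves (begin
    (x + x′) ^ q * H               ≤⟨ *-monoˡ-≤ H (^-monoˡ-≤ q sum≤) ⟩
    (2 * (x ⊔ x′)) ^ q * H         ≡⟨ cong (_* H) (^-distribʳ-* q 2 (x ⊔ x′)) ⟩
    2 ^ q * (x ⊔ x′) ^ q * H       ≡⟨ *-assoc (2 ^ q) _ H ⟩
    2 ^ q * ((x ⊔ x′) ^ q * H)     ≤⟨ *-monoʳ-≤ (2 ^ q) max ⟩
    2 ^ q * ((p + p′) * y) ^ q     ≡⟨ ^-distribʳ-* q 2 ((p + p′) * y) ⟨
    (2 * ((p + p′) * y)) ^ q       ≡⟨ cong (_^ q) (*-assoc 2 (p + p′) y) ⟨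
    (2 * (p + p′) * y) ^ q         ∎)
    where
    open ≤-Reasoning
    sum≤ : x + x′ ≤ 2 * (x ⊔ x′)
    sum≤ = +-mono-≤ (m≤m⊔n x x′) (≤-trans (m≤n⊔m x x′) (m≤m+n _ 0))
    max : (x ⊔ x′) ^ q * H ≤ ((p + p′) * y) ^ q
    max with ⊔-sel x x′
    ... | inj₁ e = subst (λ z → z ^ q * H ≤ ((p + p′) * y) ^ q) (sym e) (≤-trans s (^-monoˡ-≤ q (*-monoˡ-≤ y (m≤m+n p p′))))
    ... | inj₂ e = subst (λ z → z ^ q * H ≤ ((p + p′) * y) ^ q) (sym e) (≤-trans s′ (^-monoˡ-≤ q (*-monoˡ-≤ y (m≤n+m p′ p))))

  saves-* : ∀ {x p y} c → Saves x p y → Saves (c * x) (c * p) y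
  saves-* {x} {p} {y} c (saves s) = saves (begin
    (c * x) ^ q * H           ≡⟨ cong (_* H) (^-distribʳ-* q c x) ⟩
    c ^ q * x ^ q * H         ≡⟨ *-assoc (c ^ q) _ H ⟩
    c ^ q * (x ^ q * H)       ≤⟨ *-monoʳ-≤ (c ^ q) s ⟩
    c ^ q * (p * y) ^ q       ≡⟨ ^-distribʳ-* q c (p * y) ⟨
    (c * (p * y)) ^ q         ≡⟨ cong (_^ q) (*-assoc c p y) ⟨
    (c * p * y) ^ q           ∎)
    where open ≤-Reasoning

  saves-scale : ∀ {x p y} c → Saves x p y → Saves (c * x) p (c * y)
  saves-scale {x} {p} {y} c s = saves (≤-trans (saving (saves-* c s)) (≤-reflexive (cong (_^ q) (lem c p y))))
    where
    lem : ∀ c p y → c * p * y ≡ p * (c * y)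
    lem = solve-∀

  saves-raise : ∀ {x p p′ y} → p ≤ p′ → Saves x p y → Saves x p′ y
  saves-raise {y = y} p≤ (saves s) = saves (≤-trans s (^-monoˡ-≤ q (*-monoˡ-≤ y p≤)))

  saves-factor : 1 ≤ q → 1 ≤ H → ∀ {x p y} → x * H ≤ p * y → Saves x p y
  saves-factor 1≤q 1≤H {x} le = saves (≤-trans
    (*-monoʳ-≤ (x ^ q) (≤-trans (≤-reflexive (sym (^-identityʳ H))) (^-monoʳ-≤ H {{>-nonZero 1≤H}} 1≤q)))
    (≤-trans (≤-reflexive (sym (^-distribʳ-* q x H))) (^-monoˡ-≤ q le)))

  -- A factor H, with 2 ^ N ≤ 2 ^ d · H ^ d, is a factor (2 ^ N) ^ (1/d).

  saves-bounded : ∀ {x p N} d → 1 ≤ q → 2 ^ N ≤ 2 ^ d * H ^ d → Saves x p (2 ^ N) →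
                  x ^ (q * d) * 2 ^ N ≤ (2 * p) ^ (q * d) * (2 ^ N) ^ (q * d)
  saves-bounded {x} {p} {N} d 1≤q N≤ (saves s) = begin
    x ^ (q * d) * 2 ^ N                  ≤⟨ *-monoʳ-≤ (x ^ (q * d)) N≤ ⟩
    x ^ (q * d) * (2 ^ d * H ^ d)        ≡⟨ cong (_* (2 ^ d * H ^ d)) (^-*-assoc x q d) ⟨
    (x ^ q) ^ d * (2 ^ d * H ^ d)        ≡⟨ lem ((x ^ q) ^ d) (2 ^ d) (H ^ d) ⟩
    2 ^ d * ((x ^ q) ^ d * H ^ d)        ≡⟨ cong (2 ^ d *_) (^-distribʳ-* d (x ^ q) H) ⟨
    2 ^ d * (x ^ q * H) ^ d              ≤⟨ *-mono-≤ (2^-mono (≤-trans (≤-reflexive (sym (*-identityˡ d))) (*-monoˡ-≤ d 1≤q))) (^-monoˡ-≤ d s) ⟩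
    2 ^ (q * d) * ((p * 2 ^ N) ^ q) ^ d  ≡⟨ cong (2 ^ (q * d) *_) (^-*-assoc (p * 2 ^ N) q d) ⟩
    2 ^ (q * d) * (p * 2 ^ N) ^ (q * d)  ≡⟨ ^-distribʳ-* (q * d) 2 (p * 2 ^ N) ⟨
    (2 * (p * 2 ^ N)) ^ (q * d)          ≡⟨ cong (_^ (q * d)) (*-assoc 2 p (2 ^ N)) ⟨
    (2 * p * 2 ^ N) ^ (q * d)            ≡⟨ ^-distribʳ-* (q * d) (2 * p) (2 ^ N) ⟩
    (2 * p) ^ (q * d) * (2 ^ N) ^ (q * d) ∎
    where
    open ≤-Reasoning
    lem : ∀ a b c → a * (b * c) ≡ b * (a * c)
    lem = solve-∀

-- The number of clauses.

allVecs : ∀ {A : Set} → List A → ∀ K → List (Vec A K)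
allVecs xs zero    = [] ∷ []
allVecs xs (suc K) = concatMap (λ x → map (x ∷_) (allVecs xs K)) xs

length-allVecs : ∀ {A : Set} (xs : List A) K → length (allVecs xs K) ≡ length xs ^ K
length-allVecs xs zero    = refl
length-allVecs xs (suc K) = trans
  (length-concatMap _ (length (allVecs xs K)) xs λ x → Listₚ.length-map (x ∷_) (allVecs xs K))
  (cong (length xs *_) (length-allVecs xs K))

∈-allVecs : ∀ {A : Set} {xs : List A} → (∀ x → x ∈ xs) → ∀ {K} (v : Vec A K) → v ∈ allVecs xs K
∈-allVecs all []      = here refl
∈-allVecs {xs = xs} all {suc K} (x ∷ v) =
  Memₚ.∈-concatMap⁺ (λ x → map (x ∷_) (allVecs xs K)) (Any.map (λ where refl → Memₚ.∈-map⁺ (x ∷_) (∈-allVecs all v)) (all x))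

-- Distinctness of the clauses makes their number, and with it the number of updates in a phase,
-- polynomial in `N`.
clauses-≤ : ∀ {K N} (φ : List (Clause K N)) → Unique φ → length φ ≤ (2 * N) ^ K
clauses-≤ {K} {N} φ uniq = begin
  length φ                   ≤⟨ unique-⊆-length uniq (λ {v} _ → ∈-allVecs all v) ⟩
  length (allVecs lits K)    ≡⟨ length-allVecs lits K ⟩
  length lits ^ K            ≡⟨ cong (_^ K) len ⟩
  (2 * N) ^ K                ∎
  where
  open ≤-Reasoning
  signs : List Bool
  signs = true ∷ false ∷ []
  lits : List (Literal N)
  lits = concatMap (λ x → map (x ,_) signs) (allFin N)
  len : length lits ≡ 2 * N
  len = trans (length-concatMap _ 2 (allFin N) λ _ → refl) (trans (cong (_* 2) (Listₚ.length-tabulate {n = N} id)) (*-comm N 2))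
  all : ∀ l → l ∈ lits
  all (x , s) = Memₚ.∈-concatMap⁺ (λ x → map (x ,_) signs) (Any.map (λ where refl → Memₚ.∈-map⁺ (x ,_) (sign s)) (Memₚ.∈-allFin x))
    where
    sign : ∀ s → s ∈ signs
    sign true  = here refl
    sign false = there (here refl)

-- The approximation ratio and the length of the legs.

numerator-positive : ∀ ε → 0ℚ ℚ.< ε → 1 ≤ ℤ.∣ ↥ ε ∣
numerator-positive (mkℚ (ℤ.+ zero) _ _) (ℚ.*<* lth) = ⊥-elim (ℤₚ.<-irrefl refl lth)
numerator-positive (mkℚ (ℤ.+ suc n) _ _) _ = s≤s z≤n
numerator-positive (mkℚ (ℤ.-[1+ n ]) _ _) _ = s≤s z≤n

-- For ε = p / q the approximation guarantee, multiplied by 2 q.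

approximation-ℕ : ∀ ε → 0ℚ ℚ.< ε → ∀ P P̂ → fromℕ P̂ ℚ.≤ (3/2 ℚ.- ε) ℚ.* fromℕ P →
                  2 * ↧ₙ ε * P̂ + 2 * ℤ.∣ ↥ ε ∣ * P ≤ 3 * ↧ₙ ε * P
approximation-ℕ (mkℚ (ℤ.+ zero) _ _) (ℚ.*<* lth) P P̂ le = ⊥-elim (ℤₚ.<-irrefl refl lth)
approximation-ℕ (mkℚ (ℤ.-[1+ n ]) _ _) (ℚ.*<* ()) P P̂ le
approximation-ℕ ε@(mkℚ (ℤ.+ suc n) d-1 cop) _ P P̂ le = ℤₚ.drop‿+≤+ final
  where
  p q : ℕ
  p = suc n
  q = suc d-1
  leᵘ : ℚᵘ.mkℚᵘ (ℤ.+ P̂) 0 ℚᵘ.≤ (ℚᵘ.mkℚᵘ (ℤ.+ 3) 1 ℚᵘ.- ℚᵘ.mkℚᵘ (ℤ.+ p) d-1) ℚᵘ.* ℚᵘ.mkℚᵘ (ℤ.+ P) 0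
  leᵘ = ℚᵘₚ.≤-respʳ-≃ rhs (ℚᵘₚ.≤-respˡ-≃ (ℚₚ.toℚᵘ-fromℚᵘ (ℚᵘ.mkℚᵘ (ℤ.+ P̂) 0)) (ℚₚ.toℚᵘ-mono-≤ le))
    where
    rhs : ℚ.toℚᵘ ((3/2 ℚ.- ε) ℚ.* fromℕ P) ℚᵘ.≃ (ℚᵘ.mkℚᵘ (ℤ.+ 3) 1 ℚᵘ.- ℚᵘ.mkℚᵘ (ℤ.+ p) d-1) ℚᵘ.* ℚᵘ.mkℚᵘ (ℤ.+ P) 0
    rhs = ℚᵘₚ.≃-trans (ℚₚ.toℚᵘ-homo-* (3/2 ℚ.- ε) (fromℕ P))
      (ℚᵘₚ.*-cong (ℚᵘₚ.≃-trans (ℚₚ.toℚᵘ-homo-+ 3/2 (ℚ.- ε)) (ℚᵘₚ.+-congʳ (ℚᵘ.mkℚᵘ (ℤ.+ 3) 1) (ℚₚ.toℚᵘ-homo‿- ε)))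
                  (ℚₚ.toℚᵘ-fromℚᵘ (ℚᵘ.mkℚᵘ (ℤ.+ P) 0)))
  leᶻ : ℤ.+ P̂ ℤ.* ℤ.+ (2 * q * 1) ℤ.≤ ((ℤ.+ 3 ℤ.* ℤ.+ q ℤ.+ (ℤ.- (ℤ.+ p)) ℤ.* ℤ.+ 2) ℤ.* ℤ.+ P) ℤ.* ℤ.+ 1
  leᶻ = ℚᵘₚ.drop-*≤* leᵘ
  lhs≡ : ℤ.+ (2 * q * P̂ + 2 * p * P) ≡ ℤ.+ P̂ ℤ.* ℤ.+ (2 * q * 1) ℤ.+ ℤ.+ 2 ℤ.* ℤ.+ p ℤ.* ℤ.+ P
  lhs≡ = trans (ℤₚ.pos-+ (2 * q * P̂) (2 * p * P)) (cong₂ ℤ._+_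
    (trans (cong ℤ.+_ (trans (*-comm (2 * q) P̂) (cong (P̂ *_) (sym (*-identityʳ (2 * q)))))) (ℤₚ.pos-* P̂ (2 * q * 1)))
    (trans (ℤₚ.pos-* (2 * p) P) (cong (ℤ._* ℤ.+ P) (ℤₚ.pos-* 2 p))))
  rhs≡ : ((ℤ.+ 3 ℤ.* ℤ.+ q ℤ.+ (ℤ.- (ℤ.+ p)) ℤ.* ℤ.+ 2) ℤ.* ℤ.+ P) ℤ.* ℤ.+ 1 ℤ.+ ℤ.+ 2 ℤ.* ℤ.+ p ℤ.* ℤ.+ P ≡ ℤ.+ (3 * q * P)
  rhs≡ = trans (lem (ℤ.+ q) (ℤ.+ p) (ℤ.+ P)) (sym (trans (ℤₚ.pos-* (3 * q) P) (cong (ℤ._* ℤ.+ P) (ℤₚ.pos-* 3 q))))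
    where
    lem : ∀ q p P → ((ℤ.+ 3 ℤ.* q ℤ.+ (ℤ.- p) ℤ.* ℤ.+ 2) ℤ.* P) ℤ.* ℤ.+ 1 ℤ.+ ℤ.+ 2 ℤ.* p ℤ.* P ≡ ℤ.+ 3 ℤ.* q ℤ.* P
    lem = ℤ-Solver.solve-∀
  final : ℤ.+ (2 * q * P̂ + 2 * p * P) ℤ.≤ ℤ.+ (3 * q * P)
  final = subst₂ ℤ._≤_ (sym lhs≡) rhs≡ (ℤₚ.+-monoˡ-≤ (ℤ.+ 2 ℤ.* ℤ.+ p ℤ.* ℤ.+ P) leᶻ)

-- Let q be the denominator of ε. As the numerator is at least 1, 2 q D̂ is at most (3 q - 2) D,
-- hence at most (3 q - 2) (4 ℓ + 3). This is less than 2 q (6 ℓ + 1) whenever 7 q < 8 ℓ + 6, in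
-- particular for ℓ = q + 1.
gap : ∀ ε → 0ℚ ℚ.< ε → ∀ D D̂ → Approximates (3/2 ℚ.- ε) D D̂ →
      let ℓ = suc (↧ₙ ε) in D ≤ ℓ + suc ℓ + suc (ℓ + suc ℓ) → D̂ ≤ 6 * ℓ
gap ε 0<ε D D̂ (_ , le) D≤ = ≮⇒≥ λ D̂> → <⇒≱ ≤-refl (absurd D̂>)
  where
  x = ℚ.denominator-1 ε
  open ≤-Reasoning
  absurd : 6 * suc (suc x) < D̂ → suc (2 * suc x * suc (6 * suc (suc x))) ≤ 2 * suc x * suc (6 * suc (suc x))
  absurd D̂> = begin
    suc (2 * suc x * suc (6 * suc (suc x)))
      ≤⟨ s≤s (+-cancelʳ-≤ (2 * D) _ _ (begin
           2 * suc x * suc (6 * suc (suc x)) + 2 * D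
             ≤⟨ +-mono-≤ (*-monoʳ-≤ (2 * suc x) D̂>) (*-monoˡ-≤ D (*-monoʳ-≤ 2 (numerator-positive ε 0<ε))) ⟩
           2 * suc x * D̂ + 2 * ℤ.∣ ↥ ε ∣ * D
             ≤⟨ approximation-ℕ ε 0<ε D D̂ le ⟩
           3 * suc x * D
             ≡⟨ lem₁ x D ⟩
           (3 * x + 1) * D + 2 * D ∎)) ⟩
    suc ((3 * x + 1) * D)
      ≤⟨ s≤s (*-monoʳ-≤ (3 * x + 1) D≤) ⟩
    suc ((3 * x + 1) * (suc (suc x) + suc (suc (suc x)) + suc (suc (suc x) + suc (suc (suc x)))))
      ≤⟨ m≤m+n _ (x + 14) ⟩
    suc ((3 * x + 1) * (suc (suc x) + suc (suc (suc x)) + suc (suc (suc x) + suc (suc (suc x))))) + (x + 14)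
      ≡⟨ lem₂ x ⟩
    2 * suc x * suc (6 * suc (suc x)) ∎
    where
    lem₁ : ∀ x D → 3 * suc x * D ≡ (3 * x + 1) * D + 2 * D
    lem₁ = solve-∀
    lem₂ : ∀ x → suc ((3 * x + 1) * (suc (suc x) + suc (suc (suc x)) + suc (suc (suc x) + suc (suc (suc x))))) + (x + 14) ≡
                 2 * suc x * suc (6 * suc (suc x))
    lem₂ = solve-∀


-- Explicit polynomial bounds in the number of variables.

module Polynomials (cA K d ℓ′ CP k CU CV : ℕ) where

  ℓ̂ : ℕ
  ℓ̂ = suc ℓ′

  -- Each name bounds a quantity of the reduction after its power of `H` has been taken out; for
  -- example, `order` is at most `H * ô N`. `ĝ` belongs to the work before the phases and `ŝ` to the
  -- phases.
  m̂ Ŝ ô B̂ κ̂ ŵ Ŵ x̂ ê ĝ Ĉ₃ ŝ P̂ : ℕ → ℕ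
  m̂ N = (2 * N) ^ K
  Ŝ N = suc (m̂ N) + suc (m̂ N)
  ô N = Ŝ N + 3 + 3 * Ŝ N * ℓ̂
  -- The summands provide for `N`, the `N * cnt` bits of `F`, the `order * order` matrix cells, and
  -- for `K`, `d` and the threshold.
  B̂ N = 1 + N + N * (m̂ N * K) + (2 * N + 2 * ô N) + K + d + 6 * ℓ̂
  κ̂ N = suc (maxW * B̂ N) ^ 2
  ŵ N = suc cA * suc (N + ô N)
  Ŵ N = 2 * (suc (6 * ℓ̂) * ŵ N) ^ 2
  x̂ N = ô N * suc K
  ê N = ô N ^ 2 * ((74 + coeff Source.cellExp * x̂ N ^ 3) * κ̂ N) + (m̂ N * K * (46 * κ̂ N) + (9 * κ̂ N + 15 * (32 * κ̂ N)))
  ĝ N = ê N + Ŵ N * (CP * ô N ^ k)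
  Ĉ₃ N = 105 * κ̂ N + 2 * (m̂ N * ((23 + steps Source.openExp K) * κ̂ N) + κ̂ N)
  ŝ N = 2 * (Ĉ₃ N + Ŵ N * (2 * ((m̂ N + m̂ N) * (CU * ô N ^ 2) + CV * ô N ^ 2)))
  P̂ N = 2 * (2 * (ĝ N + ŝ N))

  -- Kept abstract, since normalising such terms is expensive.

  abstract

    bound : ℕ → ℕ
    bound = P̂

    P̂≤bound : ∀ N → P̂ N ≤ bound N
    P̂≤bound N = ≤-refl

    bound-poly : IsPoly bound
    bound-poly = twice (twice (poly-+ ĝ-poly ŝ-poly))
      where
      twice : ∀ {f} → IsPoly f → IsPoly (λ N → 2 * f N)
      twice = poly-* (poly-const 2)
      one+ : ∀ {f} → IsPoly f → IsPoly (λ N → suc (f N))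
      one+ = poly-+ (poly-const 1)
      m̂-poly : IsPoly m̂
      m̂-poly = poly-^ K (twice poly-id)
      Ŝ-poly : IsPoly Ŝ
      Ŝ-poly = poly-+ (one+ m̂-poly) (one+ m̂-poly)
      ô-poly : IsPoly ô
      ô-poly = poly-+ (poly-+ Ŝ-poly (poly-const 3)) (poly-* (poly-* (poly-const 3) Ŝ-poly) (poly-const ℓ̂))
      B̂-poly : IsPoly B̂
      B̂-poly = poly-+ (poly-+ (poly-+ (poly-+ (poly-+ (one+ poly-id) (poly-* poly-id (poly-* m̂-poly (poly-const K))))
        (poly-+ (twice poly-id) (twice ô-poly))) (poly-const K)) (poly-const d)) (poly-const (6 * ℓ̂))
      κ̂-poly : IsPoly κ̂
      κ̂-poly = poly-^ 2 (one+ (poly-* (poly-const maxW) B̂-poly))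
      Ŵ-poly : IsPoly Ŵ
      Ŵ-poly = twice (poly-^ 2 (poly-* (poly-const (suc (6 * ℓ̂))) (poly-* (poly-const (suc cA)) (one+ (poly-+ poly-id ô-poly)))))
      ê-poly : IsPoly ê
      ê-poly = poly-+
        (poly-* (poly-^ 2 ô-poly) (poly-* (poly-+ (poly-const 74) (poly-* (poly-const (coeff Source.cellExp)) (poly-^ 3 (poly-* ô-poly (poly-const (suc K)))))) κ̂-poly))
        (poly-+ (poly-* (poly-* m̂-poly (poly-const K)) (poly-* (poly-const 46) κ̂-poly))
          (poly-+ (poly-* (poly-const 9) κ̂-poly) (poly-* (poly-const 15) (poly-* (poly-const 32) κ̂-poly))))
      ĝ-poly : IsPoly ĝ
      ĝ-poly = poly-+ ê-poly (poly-* Ŵ-poly (poly-* (poly-const CP) (poly-^ k ô-poly)))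
      Ĉ₃-poly : IsPoly Ĉ₃
      Ĉ₃-poly = poly-+ (poly-* (poly-const 105) κ̂-poly)
        (twice (poly-+ (poly-* m̂-poly (poly-* (poly-const (23 + steps Source.openExp K)) κ̂-poly)) κ̂-poly))
      ŝ-poly : IsPoly ŝ
      ŝ-poly = twice (poly-+ Ĉ₃-poly (poly-* Ŵ-poly (twice (poly-+
        (poly-* (poly-+ m̂-poly m̂-poly) (poly-* (poly-const CU) (poly-^ 2 ô-poly)))
        (poly-* (poly-const CV) (poly-^ 2 ô-poly))))))


-- The registers `vK`, `vL′`, `vS` and `vR`, the loop bounds of `cellExp`.
loopVars : ℕ → Bool
loopVars i = (i ≡ᵇ 2) ∨ ((i ≡ᵇ 4) ∨ ((i ≡ᵇ 12) ∨ (i ≡ᵇ 13)))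

module Lookups (N m K L L′ F h 2h H M S R n cell u v τ j bt res tmp : ℕ) {B X : ℕ} (1≤B : 1 ≤ B) (N≤ : N ≤ B) where

  open Source

  ρ : Vec ℕ nVars
  ρ = N ∷ m ∷ K ∷ L ∷ L′ ∷ 0 ∷ F ∷ tmp ∷ h ∷ 2h ∷ H ∷ M ∷ S ∷ R ∷ n ∷
      cell ∷ u ∷ v ∷ τ ∷ j ∷ bt ∷ res ∷ []

  cell-fits : K ≤ X → L′ ≤ X → S ≤ X → R ≤ X → Fits B X cellExp ρ
  cell-fits K≤ L′≤ S≤ R≤ = plain-fits loopVars 0 cellExp ρ 1≤B (λ i e → lookup-at {P = _≤ B} ρ i vN e N≤) bound refl
    where
    bound : ∀ i → 0 ≤ toℕ i → loopVars (toℕ i) ≡ true → lookup ρ i ≤ X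
    bound i _ e with ∨-split (toℕ i ≡ᵇ 2) e
    ... | inj₁ p = lookup-at {P = _≤ X} ρ i vK (≡ᵇ-true _ 2 p) K≤
    ... | inj₂ e₁ with ∨-split (toℕ i ≡ᵇ 4) e₁
    ...   | inj₁ p = lookup-at {P = _≤ X} ρ i vL′ (≡ᵇ-true _ 4 p) L′≤
    ...   | inj₂ e₂ with ∨-split (toℕ i ≡ᵇ 12) e₂
    ...     | inj₁ p = lookup-at {P = _≤ X} ρ i vS (≡ᵇ-true _ 12 p) S≤
    ...     | inj₂ p = lookup-at {P = _≤ X} ρ i vR (≡ᵇ-true _ 13 p) R≤

  open-fits : K ≤ X → Fits B X openExp ρ
  open-fits K≤ = plain-fits (_≡ᵇ 2) 0 openExp ρ 1≤B (λ i e → lookup-at {P = _≤ B} ρ i vN e N≤)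
    (λ i _ e → lookup-at {P = _≤ X} ρ i vK (≡ᵇ-true _ 2 e) K≤) refl

module _ {A : DynamicAlgorithm} {w : ℕ} .{{_ : NonZero w}} {n : ℕ} {s : State} {ops : List (Operation n)} {as : List ℕ} {T : ℕ} where

  session-insert : ∀ {u v u≢v} → Session A w s (insert u v u≢v ∷ ops) as T →
    ∃[ s′ ] ∃[ t ] ∃[ T′ ] (Machine.⟨_,_⟩⇓⟨_,_⟩ w (insertion A) (withEdge s u v) s′ t × Session A w s′ ops as T′ × T ≡ t + T′)
  session-insert (insert run rest) = _ , _ , _ , run , rest , refl

  session-delete : ∀ {u v u≢v} → Session A w s (delete u v u≢v ∷ ops) as T →
    ∃[ s′ ] ∃[ t ] ∃[ T′ ] (Machine.⟨_,_⟩⇓⟨_,_⟩ w (deletion A) (withEdge s u v) s′ t × Session A w s′ ops as T′ × T ≡ t + T′)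
  session-delete (delete run rest) = _ , _ , _ , run , rest , refl

  session-query : Session A w s (query ∷ ops) as T →
    ∃[ s′ ] ∃[ t ] ∃[ as′ ] ∃[ T′ ] (Machine.⟨_,_⟩⇓⟨_,_⟩ w (answer A) s s′ t × as ≡ reg s′ 0 ∷ as′ × Session A w s′ ops as′ T′ × T ≡ t + T′)
  session-query (query run rest) = _ , _ , _ , _ , run , refl , rest , refl

time-poly : ∀ t P C x N {p r′ r} → p ≡ 1 → r′ ≡ r → t ^ r′ * x ≤ P ^ r′ * x ^ r′ → P ≤ C * N ^ C →
            t ^ r * x ^ p ≤ (C * N ^ C) ^ r * x ^ (1 * r)
time-poly t P C x N {r = r} refl refl le P≤ = begin
  t ^ r * x ^ 1                  ≡⟨ cong (t ^ r *_) (^-identityʳ x) ⟩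
  t ^ r * x                      ≤⟨ le ⟩
  P ^ r * x ^ r                  ≤⟨ *-monoˡ-≤ (x ^ r) (^-monoˡ-≤ r P≤) ⟩
  (C * N ^ C) ^ r * x ^ r        ≡⟨ cong (λ z → (C * N ^ C) ^ r * x ^ z) (*-identityˡ r) ⟨
  (C * N ^ C) ^ r * x ^ (1 * r)  ∎
  where open ≤-Reasoning

-- The reduction for one formula: correctness and running time.

module Correctness (Alg : DynamicAlgorithm) (K k ℓ′ CP CU CV p q : ℕ) (1≤p : 1 ≤ p) (1≤q : 1 ≤ q)
                   {N : ℕ} .{{_ : NonZero N}} (φ : List (Clause K N)) (m≤m̂ : length φ ≤ (2 * N) ^ K) where

  open Source

  -- Up to polynomials in `N`, writing the matrix costs `H ^ 5` and preprocessing `H ^ k`, both at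
  -- most `H ^ (k + 5)`. As `H ^ d` is at most `2 ^ N`, the value k + 7 of `d` leaves room for a
  -- saved factor `H`.
  d′ d h : ℕ
  d′ = k + 5
  d  = suc (suc d′)
  h  = N / d

  2h≤N : h + h ≤ N
  2h≤N = begin
    h + h    ≡⟨ lem h ⟩
    h * 2    ≤⟨ *-monoʳ-≤ h (s≤s (s≤s z≤n)) ⟩
    h * d    ≤⟨ m/n*n≤m N d ⟩
    N        ∎
    where
    open ≤-Reasoning
    lem : ∀ h → h + h ≡ h * 2
    lem = solve-∀

  open Formula φ public
  open Blocks h 2h≤N public
  open Reduction (2 ^ h) ℓ′ m inBlockA inBlockB public
  open Phases inBlockC public

  thr w wA cnt : ℕ
  thr = 6 * ℓ
  w   = wordLength 0 N
  wA  = wordLength (wordConstant Alg) order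
  cnt = m * K

  Remaining : Cmd → ℕ → (State → ℕ → Set) → State → ℕ → Set
  Remaining cmd c Rest g T = ∃[ g′ ] ∃[ t ] ∃[ T′ ]
    (Machine.⟨_,_⟩⇓⟨_,_⟩ wA cmd (withEdge g (u-node c) (w-node c)) g′ t × Rest g′ T′ × T ≡ t + T′)

  insertion-step : ∀ τ c (p : c < m) {ops as g T} → Session Alg wA g (openOps τ (suc c) p ops) as T → inBlockC τ c ≡ true →
    Remaining (insertion Alg) c (λ g′ T′ → Session Alg wA g′ (openOps τ c (<⇒≤ p) ops) as T′) g T
  insertion-step τ c p {ops} {as} {g} {T} s o = session-insert (subst (λ z → Session Alg wA g
    (if z then insert (u-node c) (w-node c) (u≢w p) ∷ openOps τ c (<⇒≤ p) ops else openOps τ c (<⇒≤ p) ops) as T) o s)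

  insertion-skip : ∀ τ c (p : c < m) {ops as g T} → Session Alg wA g (openOps τ (suc c) p ops) as T → inBlockC τ c ≡ false →
    Session Alg wA g (openOps τ c (<⇒≤ p) ops) as T
  insertion-skip τ c p {ops} {as} {g} {T} s o = subst (λ z → Session Alg wA g
    (if z then insert (u-node c) (w-node c) (u≢w p) ∷ openOps τ c (<⇒≤ p) ops else openOps τ c (<⇒≤ p) ops) as T) o s

  deletion-step : ∀ τ c (p : c < m) {ops as g T} → Session Alg wA g (closeOps τ (suc c) p ops) as T → inBlockC τ c ≡ true →
    Remaining (deletion Alg) c (λ g′ T′ → Session Alg wA g′ (closeOps τ c (<⇒≤ p) ops) as T′) g T
  deletion-step τ c p {ops} {as} {g} {T} s o = session-delete (subst (λ z → Session Alg wA g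
    (if z then delete (u-node c) (w-node c) (u≢w p) ∷ closeOps τ c (<⇒≤ p) ops else closeOps τ c (<⇒≤ p) ops) as T) o s)

  deletion-skip : ∀ τ c (p : c < m) {ops as g T} → Session Alg wA g (closeOps τ (suc c) p ops) as T → inBlockC τ c ≡ false →
    Session Alg wA g (closeOps τ c (<⇒≤ p) ops) as T
  deletion-skip τ c p {ops} {as} {g} {T} s o = subst (λ z → Session Alg wA g
    (if z then delete (u-node c) (w-node c) (u≢w p) ∷ closeOps τ c (<⇒≤ p) ops else closeOps τ c (<⇒≤ p) ops) as T) o s

  with-endpoints : ∀ {c cmd g g′ t} → c < m → Machine.⟨_,_⟩⇓⟨_,_⟩ wA cmd (withEdge g (u-node c) (w-node c)) g′ t →
                   Machine.⟨_,_⟩⇓⟨_,_⟩ wA cmd (setReg (setReg g 0 c) 1 (M + c)) g′ t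
  with-endpoints {c} {cmd} {g} {g′} {t} c< run =
    subst₂ (λ x y → Machine.⟨_,_⟩⇓⟨_,_⟩ wA cmd (setReg (setReg g 0 x) 1 y) g′ t) (toℕ-u c<) (toℕ-w c<) run

  cell-value : ∀ c → c < order * order →
    bit (0 <ᵇ linkCount (c / order) (c % order) + linkCount (c % order) (c / order)) ≡ matrixCell G₀ c
  cell-value c c< = let u , v , u≡ , v≡ , e = matrixCell-< G₀ c c< in trans (cong₂ (λ u v → bit (0 <ᵇ linkCount u v + linkCount v u)) (sym u≡) (sym v≡)) (sym e)

  open Polynomials (wordConstant Alg) K d ℓ′ CP k CU CV

  H : ℕ
  H = 2 ^ h

  1≤H : 1 ≤ H
  1≤H = 1≤2^ h

  S≤ : S ≤ Ŝ N
  S≤ = +-mono-≤ (s≤s m≤m̂) (s≤s m≤m̂)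

  order≤ : order ≤ H * ô N
  order≤ = begin
    S + R + R * S * ℓ
      ≤⟨ +-mono-≤ (+-mono-≤ (≤-trans S≤ (≤-trans (≤-reflexive (sym (*-identityˡ (Ŝ N)))) (*-monoˡ-≤ (Ŝ N) 1≤H))) R≤)
                  (*-monoˡ-≤ ℓ (*-mono-≤ R≤ S≤)) ⟩
    H * Ŝ N + H * 3 + H * 3 * Ŝ N * ℓ
      ≡⟨ lem H (Ŝ N) ℓ ⟩
    H * ô N ∎
    where
    open ≤-Reasoning
    R≤ : R ≤ H * 3
    R≤ = ≤-trans (+-monoˡ-≤ (H + H) 1≤H) (≤-reflexive (lem H))
      where
      lem : ∀ h → h + (h + h) ≡ h * 3
      lem = solve-∀
    lem : ∀ h s l → h * s + h * 3 + h * 3 * s * l ≡ h * (s + 3 + 3 * s * l)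
    lem = solve-∀

  H≤order : H ≤ order
  H≤order = ≤-trans (≤-trans (m≤m+n H H) (n≤1+n (H + H))) (≤-trans (m≤n+m R S) (m≤m+n (S + R) _))

  H≤2^N : H ≤ 2 ^ N
  H≤2^N = 2^-mono (m/n≤m N d)

  order≤2^ : order ≤ 2 ^ (N + ô N)
  order≤2^ = ≤-trans order≤ (≤-trans (*-mono-≤ H≤2^N (<⇒≤ (n<2^n (ô N)))) (≤-reflexive (sym (^-distribˡ-+-* 2 N (ô N)))))

  B : ℕ
  B = B̂ N

  private
    below-2^ : ∀ {x} → x ≤ B → x ≤ 2 ^ B
    below-2^ x≤ = ≤-trans x≤ (<⇒≤ (n<2^n B))

    part₁ : 1 + N + N * (m̂ N * K) + (2 * N + 2 * ô N) ≤ B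
    part₁ = ≤-trans (m≤m+n _ K) (≤-trans (m≤m+n _ d) (m≤m+n _ (6 * ℓ)))

    1+N≤B : 1 + N ≤ B
    1+N≤B = ≤-trans (≤-trans (m≤m+n (1 + N) _) (m≤m+n _ (2 * N + 2 * ô N))) part₁

  1≤B : 1 ≤ B
  1≤B = ≤-trans (m≤m+n 1 N) 1+N≤B

  N≤B : N ≤ B
  N≤B = ≤-trans (n≤1+n N) 1+N≤B

  K≤ : K ≤ 2 ^ B
  K≤ = below-2^ (≤-trans (≤-trans (m≤n+m K (1 + N + N * (m̂ N * K) + (2 * N + 2 * ô N))) (m≤m+n _ d)) (m≤m+n _ (6 * ℓ)))

  d≤ : d ≤ 2 ^ B
  d≤ = below-2^ (≤-trans (m≤n+m d (1 + N + N * (m̂ N * K) + (2 * N + 2 * ô N) + K)) (m≤m+n _ (6 * ℓ)))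

  thr≤ : thr ≤ 2 ^ B
  thr≤ = below-2^ (m≤n+m (6 * ℓ) (1 + N + N * (m̂ N * K) + (2 * N + 2 * ô N) + K + d))

  F≤ : N * cnt ≤ B
  F≤ = ≤-trans (*-monoʳ-≤ N (*-monoˡ-≤ K m≤m̂)) (≤-trans (≤-trans (m≤n+m _ (1 + N)) (m≤m+n _ (2 * N + 2 * ô N))) part₁)

  cells≤ : order * order ≤ 2 ^ B
  cells≤ = ≤-trans (*-mono-≤ order≤2^ order≤2^) (≤-trans (≤-reflexive (trans (sym (^-distribˡ-+-* 2 (N + ô N) (N + ô N))) (cong (2 ^_) (lem N (ô N)))))
             (2^-mono (≤-trans (m≤n+m (2 * N + 2 * ô N) (1 + N + N * (m̂ N * K))) part₁)))
    where
    lem : ∀ n o → n + o + (n + o) ≡ 2 * n + 2 * o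
    lem = solve-∀

  κ W : ℕ
  κ = suc (maxW * B) ^ 2
  W = slowdown thr wA

  operations : Operations wA m M Alg inBlockC
  operations = record
    { Phases     = λ τ g as T → Session Alg wA g (phaseOps τ) as T
    ; Opening    = λ τ c g as T → Σ (c ≤ m) λ p → Session Alg wA g (openOps τ c p (query ∷ closeOps τ m ≤-refl (phaseOps τ))) as T
    ; Closing    = λ τ c g as T → Σ (c ≤ m) λ p → Session Alg wA g (closeOps τ c p (phaseOps τ)) as T
    ; finished   = λ where done → refl
    ; begin-open = λ s → ≤-refl , s
    ; open-step  = λ {τ} c c< (p , s) o →
        let g′ , t , T′ , run , s′ , T≡ = insertion-step τ c p s o in g′ , t , T′ , with-endpoints c< run , (<⇒≤ p , s′) , T≡
    ; open-skip  = λ {τ} c _ (p , s) o → <⇒≤ p , insertion-skip τ c p s o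
    ; ask        = λ (p , s) → let g′ , t , as′ , T′ , run , as≡ , rest , T≡ = session-query s in
        g′ , t , as′ , T′ , run , as≡ , (≤-refl , rest) , T≡
    ; close-step = λ {τ} c c< (p , s) o →
        let g′ , t , T′ , run , s′ , T≡ = deletion-step τ c p s o in g′ , t , T′ , with-endpoints c< run , (<⇒≤ p , s′) , T≡
    ; close-skip = λ {τ} c _ (p , s) o → <⇒≤ p , deletion-skip τ c p s o
    ; end-close  = λ (p , s) → s }

  -- `order` exceeds the numbers of stars and of legs and the length of a leg; `K` is added for the
  -- loop over the literals of a clause.
  X : ℕ
  X = order + K

  S≤order : S ≤ order
  S≤order = ≤-trans (m≤m+n S R) (m≤m+n (S + R) _)

  R≤order : R ≤ order
  R≤order = ≤-trans (m≤n+m R S) (m≤m+n (S + R) _)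

  ℓ≤order : ℓ ≤ order
  ℓ≤order = ≤-trans (≤-trans (≤-reflexive (sym (*-identityˡ ℓ))) (*-monoˡ-≤ ℓ {1} {R * S} z<s)) (m≤n+m _ (S + R))

  ρ₂ : (tmp cell u v τ j bt res : ℕ) → Vec ℕ nVars
  ρ₂ tmp cell u v τ j bt res =
    N ∷ m ∷ K ∷ ℓ ∷ ℓ′ ∷ 0 ∷ F ∷ tmp ∷ h ∷ h + h ∷ 2 ^ h ∷ M ∷ S ∷ R ∷ order ∷
    cell ∷ u ∷ v ∷ τ ∷ j ∷ bt ∷ res ∷ []

  cellFits : ∀ tmp c u v → Fits B X cellExp (ρ₂ tmp c u v 0 0 0 0)
  cellFits tmp c u v = Lookups.cell-fits N m K ℓ ℓ′ F h (h + h) (2 ^ h) M S R order c u v 0 0 0 0 tmp 1≤B N≤B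
    (m≤n+m K order) (≤-trans (≤-trans (n≤1+n ℓ′) ℓ≤order) (m≤m+n order K)) (≤-trans S≤order (m≤m+n order K)) (≤-trans R≤order (m≤m+n order K))

  openFits : ∀ tmp cell u v τ j bt res → Fits B K openExp (ρ₂ tmp cell u v τ j bt res)
  openFits tmp cell u v τ j bt res =
    Lookups.open-fits N m K ℓ ℓ′ F h (h + h) (2 ^ h) M S R order cell u v τ j bt res tmp 1≤B N≤B ≤-refl

  cell≡ : ∀ tmp c → c < order * order → eval cellExp (ρ₂ tmp c (c / order) (c % order) 0 0 0 0) ≡ matrixCell G₀ c
  cell≡ tmp c c< = cell-value c c<

  open≡ : ∀ tmp cell u v τ j bt res → eval openExp (ρ₂ tmp cell u v τ j bt res) ≡ bit (inBlockC τ j)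
  open≡ tmp cell u v τ j bt res = refl

  overhead : ℕ
  overhead = overheadTime κ order cnt (steps cellExp X)

  C₃ₒ : ℕ
  C₃ₒ = phaseTime κ m (steps openExp K)

  total : (tp TS : ℕ) → ℕ
  total tp TS = overhead + W * tp + (2 ^ Q * C₃ₒ + W * TS)

  run-solver : ∀ bs {gs tp as TS} →
    Machine.⟨_,_⟩⇓⟨_,_⟩ wA (preprocess Alg) (graphInput G₀ bs) gs tp → Session Alg wA gs (phaseOps (2 ^ Q)) as TS →
    ∃[ s ] ∃[ t ] (Machine.⟨_,_⟩⇓⟨_,_⟩ w (solver K d ℓ′ Alg) (satInput φ bs) s t ×
                   reg s 0 ≡ bit (anyAbove thr as) × t ≤ total tp TS)
  run-solver bs {tp = tp} {as} {TS} pre session = subst (λ c → ∃[ s ] ∃[ t ] (Machine.⟨_,_⟩⇓⟨_,_⟩ w c (satInput φ bs) s t ×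
      reg s 0 ≡ bit (anyAbove thr as) × t ≤ total tp TS)) (sym (solver≡ K d ℓ′ Alg))
    (Runs.Body-run.run-solver w B (maxW * B) 1≤B ≤-refl wA thr (≤-trans thr≤ (2^-mono (m≤n*m B maxW)))
    N m K d ℓ′ (contents (codes φ)) contents<W
    (record { N≤ = N≤B ; F≤ = F≤ ; cells≤ = cells≤ ; K≤ = K≤ ; d≤ = d≤ ; ℓ≤ = ≤-trans (m≤n*m ℓ 6) thr≤ ; 2h≤N = 2h≤N })
    Alg inBlockC operations (matrixCell G₀) (matrixCell-≥ G₀)
    X cellExp (from-yes (width cellExp ≤? maxW) , from-yes ((4 + nVars) + size cellExp ≤? tempEnd)) cellFits cell≡
    K openExp (from-yes (width openExp ≤? maxW) , from-yes ((4 + nVars) + size openExp ≤? tempEnd)) openFits open≡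
    bs refl (λ _ → refl) (λ _ → refl) refl pre session (contents (codes φ))
    (λ a → (λ _ → refl) , λ le → beyond (codes φ) a (subst (_≤ a) (sym (length-codes φ)) le)))
    where
    beyond : ∀ xs a → length xs ≤ a → contents xs a ≡ 0
    beyond []       a       _  = refl
    beyond (x ∷ xs) (suc a) le = beyond xs a (s≤s⁻¹ le)

  κ≤ : κ ≤ κ̂ N
  κ≤ = ≤-refl

  wA≤ : wA ≤ ŵ N
  wA≤ = *-monoʳ-≤ (suc (wordConstant Alg)) (s≤s (≤-trans (⌊log₂⌋-mono-≤ order≤2^) (≤-reflexive (⌊log₂[2^n]⌋≡n (N + ô N)))))

  W≤ : W ≤ Ŵ N
  W≤ = *-monoʳ-≤ 2 (^-monoˡ-≤ 2 (*-monoʳ-≤ (suc thr) wA≤))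

  H^-mono : ∀ {i j} → i ≤ j → H ^ i ≤ H ^ j
  H^-mono = ^-monoʳ-≤ H {{>-nonZero 1≤H}}

  order^≤ : ∀ j → order ^ j ≤ H ^ j * ô N ^ j
  order^≤ j = ≤-trans (^-monoˡ-≤ j order≤) (≤-reflexive (^-distribʳ-* j H (ô N)))

  -- The `order * order` cells give `H ^ 2`. In `cellExp` sums are nested three deep with bounds at
  -- most `X`, which gives `H ^ 3`.
  overhead≤ : overhead ≤ H ^ 5 * ê N
  overhead≤ = begin
    overhead
      ≤⟨ +-mono-≤ matrix (≤-trans small (m≤n*m _ (H ^ 5) {{>-nonZero (^-pos H 5 1≤H)}})) ⟩
    H ^ 5 * (ô N ^ 2 * ((74 + coeff cellExp * x̂ N ^ 3) * κ̂ N)) + H ^ 5 * (m̂ N * K * (46 * κ̂ N) + (9 * κ̂ N + 15 * (32 * κ̂ N)))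
      ≡⟨ *-distribˡ-+ (H ^ 5) _ _ ⟨
    H ^ 5 * ê N ∎
    where
    open ≤-Reasoning
    small : cnt * (46 * κ) + (9 * κ + 15 * (32 * κ)) ≤ m̂ N * K * (46 * κ̂ N) + (9 * κ̂ N + 15 * (32 * κ̂ N))
    small = +-mono-≤ (*-mono-≤ (*-monoˡ-≤ K m≤m̂) (*-monoʳ-≤ 46 κ≤)) (+-mono-≤ (*-monoʳ-≤ 9 κ≤) (*-monoʳ-≤ 15 (*-monoʳ-≤ 32 κ≤)))
    1≤order : 1 ≤ order
    1≤order = ≤-trans 1≤H H≤order
    X≤ : order + K ≤ H * x̂ N
    X≤ = begin
      order + K              ≤⟨ +-monoʳ-≤ order (≤-trans (≤-reflexive (sym (*-identityˡ K))) (*-monoˡ-≤ K 1≤order)) ⟩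
      order + order * K      ≡⟨ *-suc order K ⟨
      order * suc K          ≤⟨ *-monoˡ-≤ (suc K) order≤ ⟩
      H * ô N * suc K        ≡⟨ *-assoc H (ô N) (suc K) ⟩
      H * x̂ N               ∎
    cell-steps : steps cellExp (order + K) ≤ H ^ 3 * (coeff cellExp * x̂ N ^ 3)
    cell-steps = begin
      steps cellExp (order + K)              ≤⟨ steps-≤ cellExp (order + K) (≤-trans 1≤order (m≤m+n order K)) ⟩
      coeff cellExp * (order + K) ^ 3        ≤⟨ *-monoʳ-≤ (coeff cellExp) (^-monoˡ-≤ 3 X≤) ⟩
      coeff cellExp * (H * x̂ N) ^ 3         ≡⟨ cong (coeff cellExp *_) (^-distribʳ-* 3 H (x̂ N)) ⟩
      coeff cellExp * (H ^ 3 * x̂ N ^ 3)     ≡⟨ swap (coeff cellExp) (H ^ 3) (x̂ N ^ 3) ⟩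
      H ^ 3 * (coeff cellExp * x̂ N ^ 3)     ∎
      where
      swap : ∀ a b c → a * (b * c) ≡ b * (a * c)
      swap = solve-∀
    matrix : order * order * ((74 + steps cellExp (order + K)) * κ) ≤ H ^ 5 * (ô N ^ 2 * ((74 + coeff cellExp * x̂ N ^ 3) * κ̂ N))
    matrix = begin
      order * order * ((74 + steps cellExp (order + K)) * κ)
        ≡⟨ cong (λ z → order * z * ((74 + steps cellExp (order + K)) * κ)) (sym (*-identityʳ order)) ⟩
      order ^ 2 * ((74 + steps cellExp (order + K)) * κ)
        ≤⟨ *-mono-≤ (order^≤ 2) (*-mono-≤ (+-mono-≤ (m≤n*m 74 (H ^ 3) {{>-nonZero (^-pos H 3 1≤H)}}) cell-steps) κ≤) ⟩
      H ^ 2 * ô N ^ 2 * ((H ^ 3 * 74 + H ^ 3 * (coeff cellExp * x̂ N ^ 3)) * κ̂ N)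
        ≡⟨ regroup (H ^ 2) (ô N ^ 2) (H ^ 3) 74 (coeff cellExp * x̂ N ^ 3) (κ̂ N) ⟩
      H ^ 2 * H ^ 3 * (ô N ^ 2 * ((74 + coeff cellExp * x̂ N ^ 3) * κ̂ N))
        ≡⟨ cong (_* (ô N ^ 2 * ((74 + coeff cellExp * x̂ N ^ 3) * κ̂ N))) (^-distribˡ-+-* H 2 3) ⟨
      H ^ 5 * (ô N ^ 2 * ((74 + coeff cellExp * x̂ N ^ 3) * κ̂ N)) ∎
      where
      regroup : ∀ a o b c x κ → a * o * ((b * c + b * x) * κ) ≡ a * b * (o * ((c + x) * κ))
      regroup = solve-∀

  H^d≤2^N : H ^ d ≤ 2 ^ N
  H^d≤2^N = ≤-trans (≤-reflexive (^-*-assoc 2 h d)) (2^-mono (m/n*n≤m N d))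

  2^N≤ : 2 ^ N ≤ 2 ^ d * H ^ d
  2^N≤ = begin
    2 ^ N                ≡⟨ cong (2 ^_) (m≡m%n+[m/n]*n N d) ⟩
    2 ^ (N % d + h * d)  ≤⟨ 2^-mono (+-monoˡ-≤ (h * d) (<⇒≤ (m%n<n N d))) ⟩
    2 ^ (d + h * d)      ≡⟨ ^-distribˡ-+-* 2 d (h * d) ⟩
    2 ^ d * 2 ^ (h * d)  ≡⟨ cong (2 ^ d *_) (^-*-assoc 2 h d) ⟨
    2 ^ d * H ^ d        ∎
    where open ≤-Reasoning

  open Saving q H

  -- The work before the phases is done once, whereas `2 ^ N` is the yardstick for all phases
  -- together. By the choice of `d` it saves a full factor `H` and not merely a root of it.
  saves-before : ∀ {tp} → tp ≤ CP * order ^ k → Saves (overhead + W * tp) (ĝ N) (2 ^ N)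
  saves-before {tp} tp≤ = saves-factor 1≤q 1≤H {p = ĝ N} (begin
    (overhead + W * tp) * H
      ≤⟨ *-monoˡ-≤ H (+-mono-≤ (≤-trans overhead≤ (*-monoˡ-≤ (ê N) (H^-mono (m≤n+m 5 k)))) pre) ⟩
    (H ^ (k + 5) * ê N + H ^ (k + 5) * (Ŵ N * (CP * ô N ^ k))) * H
      ≡⟨ lem (H ^ (k + 5)) (ê N) (Ŵ N * (CP * ô N ^ k)) H ⟩
    ĝ N * H ^ (suc (k + 5))
      ≤⟨ *-monoʳ-≤ (ĝ N) (≤-trans (H^-mono (n≤1+n (suc (k + 5)))) H^d≤2^N) ⟩
    ĝ N * 2 ^ N ∎)
    where
    open ≤-Reasoning
    lem : ∀ a b c h → (a * b + a * c) * h ≡ (b + c) * (h * a)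
    lem = solve-∀
    pre : W * tp ≤ H ^ (k + 5) * (Ŵ N * (CP * ô N ^ k))
    pre = begin
      W * tp                                 ≤⟨ *-mono-≤ W≤ (≤-trans tp≤ (*-monoʳ-≤ CP (order^≤ k))) ⟩
      Ŵ N * (CP * (H ^ k * ô N ^ k))        ≡⟨ swap (Ŵ N) CP (H ^ k) (ô N ^ k) ⟩
      H ^ k * (Ŵ N * (CP * ô N ^ k))        ≤⟨ *-monoˡ-≤ _ (H^-mono (m≤m+n k 5)) ⟩
      H ^ (k + 5) * (Ŵ N * (CP * ô N ^ k))  ∎
      where
      swap : ∀ w c a b → w * (c * (a * b)) ≡ a * (w * (c * b))
      swap = solve-∀

  -- Of the gain `order ^ p` only a factor `H` is kept, since H ≤ order ≤ order ^ p; positivity of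
  -- `p` is that of ε′.
  saves-update : ∀ {U C} → U ^ q * order ^ p ≤ C ^ q * order ^ (2 * q) → Saves U (C * ô N ^ 2) (H ^ 2)
  saves-update {U} {C} le = saves (begin
    U ^ q * H                    ≤⟨ *-monoʳ-≤ (U ^ q) (≤-trans H≤order (≤-trans (≤-reflexive (sym (^-identityʳ order))) (^-monoʳ-≤ order 1≤p))) ⟩
    U ^ q * order ^ p            ≤⟨ le ⟩
    C ^ q * order ^ (2 * q)      ≡⟨ cong (C ^ q *_) (^-*-assoc order 2 q) ⟨
    C ^ q * (order ^ 2) ^ q      ≡⟨ ^-distribʳ-* q C (order ^ 2) ⟨
    (C * order ^ 2) ^ q          ≤⟨ ^-monoˡ-≤ q (≤-trans (*-monoʳ-≤ C (order^≤ 2)) (≤-reflexive (swap C (H ^ 2) (ô N ^ 2)))) ⟩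
    (C * ô N ^ 2 * H ^ 2) ^ q    ∎)
    where
    open ≤-Reasoning
    swap : ∀ c a b → c * (a * b) ≡ c * b * a
    swap = solve-∀

  C₃≤ : C₃ₒ ≤ Ĉ₃ N
  C₃≤ = +-mono-≤ (*-monoʳ-≤ 105 κ≤)
    (*-monoʳ-≤ 2 (+-mono-≤ (*-mono-≤ m≤m̂ (≤-trans (≤-reflexive (lem κ (steps openExp K))) (*-monoʳ-≤ (23 + steps openExp K) κ≤))) κ≤))
    where
    lem : ∀ x s → (7 + (2 + s) + 1 + 5 + 8) * x ≡ (23 + s) * x
    lem = solve-∀

  -- Within a phase the yardstick is `H ^ 2`, the number of pairs of candidates; the `2 ^ Q` phases
  -- turn it into `2 ^ N`, as Q + 2 h = N. The own work of a phase is polynomial in `N` and saves a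
  -- whole factor `H`, the operations of the algorithm save its q-th root.
  saves-phases : ∀ {U V TS} → U ^ q * order ^ p ≤ CU ^ q * order ^ (2 * q) → V ^ q * order ^ p ≤ CV ^ q * order ^ (2 * q) →
    TS ≤ 2 ^ Q * (m + m) * U + 2 ^ Q * V → Saves (2 ^ Q * C₃ₒ + W * TS) (ŝ N) (2 ^ N)
  saves-phases {U} {V} {TS} u v TS≤ = subst (Saves _ (ŝ N)) 2^Q*H² (saves-≤ all≤ (saves-scale (2 ^ Q) s₄))
    where
    s₁ : Saves ((m + m) * U) ((m̂ N + m̂ N) * (CU * ô N ^ 2)) (H ^ 2)
    s₁ = saves-raise (*-monoˡ-≤ (CU * ô N ^ 2) (+-mono-≤ m≤m̂ m≤m̂)) (saves-* (m + m) (saves-update u))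
    s₂ : Saves ((m + m) * U + V) (2 * ((m̂ N + m̂ N) * (CU * ô N ^ 2) + CV * ô N ^ 2)) (H ^ 2)
    s₂ = saves-+ s₁ (saves-update v)
    s₃ : Saves (W * ((m + m) * U + V)) (Ŵ N * (2 * ((m̂ N + m̂ N) * (CU * ô N ^ 2) + CV * ô N ^ 2))) (H ^ 2)
    s₃ = saves-raise (*-monoˡ-≤ (2 * ((m̂ N + m̂ N) * (CU * ô N ^ 2) + CV * ô N ^ 2)) W≤) (saves-* W s₂)
    open ≤-Reasoning
    C₃*H : C₃ₒ * H ≤ Ĉ₃ N * H ^ 2
    C₃*H = *-mono-≤ C₃≤ (≤-trans (≤-reflexive (sym (^-identityʳ H))) (H^-mono {1} {2} (s≤s z≤n)))
    s₄ : Saves (C₃ₒ + W * ((m + m) * U + V)) (ŝ N) (H ^ 2)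
    s₄ = saves-+ {x = C₃ₒ} {p = Ĉ₃ N} {p′ = Ŵ N * (2 * ((m̂ N + m̂ N) * (CU * ô N ^ 2) + CV * ô N ^ 2))}
           (saves-factor 1≤q 1≤H {x = C₃ₒ} {p = Ĉ₃ N} C₃*H) s₃
    all≤ : 2 ^ Q * C₃ₒ + W * TS ≤ 2 ^ Q * (C₃ₒ + W * ((m + m) * U + V))
    all≤ = begin
      2 ^ Q * C₃ₒ + W * TS                                          ≤⟨ +-monoʳ-≤ (2 ^ Q * C₃ₒ) (*-monoʳ-≤ W TS≤) ⟩
      2 ^ Q * C₃ₒ + W * (2 ^ Q * (m + m) * U + 2 ^ Q * V)           ≡⟨ lem (2 ^ Q) C₃ₒ W (m + m) U V ⟩
      2 ^ Q * (C₃ₒ + W * ((m + m) * U + V))                         ∎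
      where
      lem : ∀ a c w m u v → a * c + w * (a * m * u + a * v) ≡ a * (c + w * (m * u + v))
      lem = solve-∀
    2^Q*H² : 2 ^ Q * H ^ 2 ≡ 2 ^ N
    2^Q*H² = trans (cong (2 ^ Q *_) (^-*-assoc 2 h 2)) (trans (sym (^-distribˡ-+-* 2 Q (h * 2)))
      (cong (2 ^_) (trans (cong (Q +_) (lem h)) (m∸n+n≡m 2h≤N))))
      where
      lem : ∀ h → h * 2 ≡ h + h
      lem = solve-∀

  total-bounded : ∀ {tp TS U V t} → tp ≤ CP * order ^ k →
    U ^ q * order ^ p ≤ CU ^ q * order ^ (2 * q) → V ^ q * order ^ p ≤ CV ^ q * order ^ (2 * q) →
    TS ≤ 2 ^ Q * (m + m) * U + 2 ^ Q * V → t ≤ total tp TS →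
    t ^ (q * d) * 2 ^ N ≤ P̂ N ^ (q * d) * (2 ^ N) ^ (q * d)
  total-bounded tp≤ u v TS≤ t≤ = saves-bounded {N = N} d 1≤q 2^N≤
    (saves-≤ t≤ (saves-+ {p = ĝ N} {p′ = ŝ N} (saves-before tp≤) (saves-phases u v TS≤)))

  module Decision (Tp Tu Tq : ℕ → ℕ) (Tp≤ : ∀ n → .{{_ : NonZero n}} → Tp n ≤ CP * n ^ k)
                  (Tu≤ : ∀ n → .{{_ : NonZero n}} → Tu n ^ q * n ^ p ≤ CU ^ q * n ^ (2 * q))
                  (Tq≤ : ∀ n → .{{_ : NonZero n}} → Tq n ^ q * n ^ p ≤ CV ^ q * n ^ (2 * q))
                  (α : ℚ) (gap′ : ∀ D D̂ → Approximates α D D̂ → D ≤ ℓ + suc ℓ + suc (ℓ + suc ℓ) → D̂ ≤ 6 * ℓ) where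

    module _ {L : ℕ} {initial : Vec Bool L → State} {t : Vec Bool L → ℕ} {answers : Vec Bool L → List ℕ} {T : Vec Bool L → ℕ}
             (pre : ∀ v → Machine.⟨_,_⟩⇓⟨_,_⟩ wA (preprocess Alg) (graphInput G₀ (toList v)) (initial v) (t v))
             (t≤ : ∀ v → t v ≤ Tp order)
             (session : ∀ v → Session Alg wA (initial v) (phaseOps (2 ^ Q)) (answers v) (T v))
             (T≤ : ∀ v → T v ≤ updates (phaseOps (2 ^ Q)) * Tu order + queries (phaseOps (2 ^ Q)) * Tq order) where

      abstract
        run : ∀ v → ∃[ s ] ∃[ u ] (Machine.⟨_,_⟩⇓⟨_,_⟩ w (solver K d ℓ′ Alg) (satInput φ (toList v)) s u ×
                                    reg s 0 ≡ bit (anyAbove thr (answers v)) × u ≤ total (t v) (T v))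
        run v = run-solver (toList v) (pre v) (session v)

        final : Vec Bool L → State
        final v = proj₁ (run v)

        time : Vec Bool L → ℕ
        time v = proj₁ (proj₂ (run v))

        halts : ∀ v → Machine.⟨_,_⟩⇓⟨_,_⟩ w (solver K d ℓ′ Alg) (satInput φ (toList v)) (final v) (time v)
        halts v = proj₁ (proj₂ (proj₂ (run v)))

        time-bounded : ∀ v → time v ^ (q * d) * 2 ^ N ≤ P̂ N ^ (q * d) * (2 ^ N) ^ (q * d)
        time-bounded v = total-bounded (≤-trans (t≤ v) (Tp≤ order)) (Tu≤ order) (Tq≤ order)
          (≤-trans (T≤ v) (+-mono-≤ (*-monoˡ-≤ (Tu order) (proj₁ (updates-phases (2 ^ Q))))
                                    (*-monoˡ-≤ (Tq order) (≤-reflexive (proj₂ (updates-phases (2 ^ Q)))))))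
          (proj₂ (proj₂ (proj₂ (proj₂ (run v)))))

        correct : ∀ v → AnswersCorrect α G₀ (phaseOps (2 ^ Q)) (answers v) → reg (final v) 0 ≡ 1 ⇔ Satisfiable φ
        correct v ac = mk⇔
          (λ e → Equivalence.to satisfiable⇔good (Equivalence.to phases (bit-injective (trans (sym res) e))))
          (λ s → trans res (cong bit (Equivalence.from phases (Equivalence.from satisfiable⇔good s))))
          where
          res : reg (final v) 0 ≡ bit (anyAbove thr (answers v))
          res = proj₁ (proj₂ (proj₂ (proj₂ (run v))))
          phases : anyAbove thr (answers v) ≡ true ⇔ (∃[ τ ] (τ < 2 ^ Q × GoodPhase τ))
          phases = correct-answers thr GoodPhase (2 ^ Q)
            (λ τ G a _ rep apx → decides (inBlockC τ) {G} rep {α} gap′ a apx) represents-G₀ ac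

    abstract

      -- εₛ is 1 / (q d).

      solves : ∀ εₛ C → ℤ.∣ ↥ εₛ ∣ ≡ 1 → ↧ₙ εₛ ≡ q * d → bound N ≤ C * N ^ C →
        ApproximatesDiameter (Sparse 4) α Alg Tp Tu Tq →
        ∃[ L ] Σ (Vec Bool L → State) λ final → Σ (Vec Bool L → ℕ) λ time →
           (∀ v → Machine.⟨_,_⟩⇓⟨_,_⟩ w (solver K d ℓ′ Alg) (satInput φ (toList v)) (final v) (time v))
         × (∀ v → BoundedBy (time v) (C * N ^ C) (2 ^ N) 1 εₛ)
         × ProbAtLeast⅔ (λ v → reg (final v) 0 ≡ 1 ⇔ Satisfiable φ)
      solves εₛ C num den P≤ approximates = assemble (approximates order G₀ (phaseOps (2 ^ Q)) (admissible (2 ^ Q) represents-G₀))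
        where
        assemble : (∃[ L ] Σ (Vec Bool L → State) λ initial → Σ (Vec Bool L → ℕ) λ t →
                           Σ (Vec Bool L → List ℕ) λ answers → Σ (Vec Bool L → ℕ) λ T →
             (∀ v → Machine.⟨_,_⟩⇓⟨_,_⟩ wA (preprocess Alg) (graphInput G₀ (toList v)) (initial v) (t v))
           × (∀ v → t v ≤ Tp order)
           × (∀ v → Session Alg wA (initial v) (phaseOps (2 ^ Q)) (answers v) (T v))
           × (∀ v → T v ≤ updates (phaseOps (2 ^ Q)) * Tu order + queries (phaseOps (2 ^ Q)) * Tq order)
           × ProbAtLeast⅔ (λ v → AnswersCorrect α G₀ (phaseOps (2 ^ Q)) (answers v))) →
          ∃[ L ] Σ (Vec Bool L → State) λ final → Σ (Vec Bool L → ℕ) λ time →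
             (∀ v → Machine.⟨_,_⟩⇓⟨_,_⟩ w (solver K d ℓ′ Alg) (satInput φ (toList v)) (final v) (time v))
           × (∀ v → BoundedBy (time v) (C * N ^ C) (2 ^ N) 1 εₛ)
           × ProbAtLeast⅔ (λ v → reg (final v) 0 ≡ 1 ⇔ Satisfiable φ)
        assemble (L , initial , t , answers , T , pre , t≤ , session , T≤ , vs , vs-unique , vs-correct , vs-many) =
          L , final pre t≤ session T≤ , time pre t≤ session T≤ , halts pre t≤ session T≤ ,
          (λ v → time-poly (time pre t≤ session T≤ v) (P̂ N) C (2 ^ N) N num (sym den)
                   (time-bounded pre t≤ session T≤ v) (≤-trans (P̂≤bound N) P≤)) ,
          -- The host flips no bits of its own, so it runs on the same tapes as the algorithm. The
          -- operations depend on the formula only and not on earlier answers. Hence every tape with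
          -- correct answers decides the formula correctly, and the list of such tapes is taken
          -- over.
          vs , vs-unique , All.map (λ {v} → correct pre t≤ session T≤ v) vs-correct , vs-many

-- Contradiction to SETH.

reciprocal : ℕ → ℚ
reciprocal n = mkℚ (ℤ.+ 1) n (1-coprimeTo (suc n))

0<reciprocal : ∀ n → 0ℚ ℚ.< reciprocal n
0<reciprocal n = ℚ.*<* (ℤ.+<+ (s≤s z≤n))

-- The order of quantifiers is essential: `εₛ` depends on the preprocessing exponent `k` and the
-- denominator of `ε′`, but not on `K`, which affects only the polynomial factor. So one `εₛ`
-- violates SETH for all `K`.
solve-SAT : ∀ ε ε′ → 0ℚ ℚ.< ε → 0ℚ ℚ.< ε′ → SubquadraticAlgorithm (Sparse 4) (3/2 - ε) ε′ →
            ∃[ εₛ ] (0ℚ ℚ.< εₛ × (∀ K → SolvableKSAT K εₛ))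
solve-SAT ε ε′ 0<ε 0<ε′ (Alg , Tp , Tu , Tq , approximates , (CP , k , Tp≤) , (CU , Tu≤) , (CV , Tq≤)) =
  reciprocal r , 0<reciprocal r , λ K →
    let C , bound≤ = Polynomials.bound-poly (wordConstant Alg) K (suc (suc (k + 5))) (↧ₙ ε) CP k CU CV in
    Source.solver K (suc (suc (k + 5))) (↧ₙ ε) Alg , 0 , C , λ N φ uniq →
      Correctness.Decision.solves Alg K k (↧ₙ ε) CP CU CV ℤ.∣ ↥ ε′ ∣ (↧ₙ ε′) (numerator-positive ε′ 0<ε′) (s≤s z≤n)
        φ (clauses-≤ φ uniq) Tp Tu Tq Tp≤ Tu≤ Tq≤ (3/2 - ε) (gap ε 0<ε)
        (reciprocal r) C refl refl (bound≤ N) approximates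
  where
  r : ℕ
  -- Chosen so that `suc r` is the denominator of `ε′` times `d`, the exponent that `saves-bounded`
  -- arrives at.
  r = suc (k + 5) + ℚ.denominator-1 ε′ * suc (suc (k + 5))

theorem1p1 : SETH → (ε : ℚ) → 0ℚ ℚ.< ε →
    ((ε′ : ℚ) → 0ℚ ℚ.< ε′ → ¬ SubquadraticAlgorithm AllGraphs (3/2 - ε) ε′)
    × (∃[ c ] ((ε′ : ℚ) → 0ℚ ℚ.< ε′ → ¬ SubquadraticAlgorithm (Sparse c) (3/2 - ε) ε′))
theorem1p1 seth ε 0<ε =
  -- An algorithm for all graphs works in particular on sequences of sparse ones, so this half
  -- follows from the other.
  (λ ε′ 0<ε′ (Alg , Tp , Tu , Tq , approximates , rates) →
     refute ε′ 0<ε′ (Alg , Tp , Tu , Tq ,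
       (λ n G ops adm → approximates n G ops (admissible-⊆ {Sparse 4} {AllGraphs} (λ _ → tt) adm)) , rates)) ,
  4 , refute
  where
  refute : ∀ ε′ → 0ℚ ℚ.< ε′ → ¬ SubquadraticAlgorithm (Sparse 4) (3/2 - ε) ε′
  refute ε′ 0<ε′ algorithm =
    let εₛ , 0<εₛ , solvable = solve-SAT ε ε′ 0<ε 0<ε′ algorithm
        K , unsolvable       = seth εₛ 0<εₛ
    in unsolvable (solvable K)
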